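{- Let $F$ be a subfield of $\mathbb{R}$. Let $S\subseteq\mathbb{R}^n$ ($n\ge1$) be an $F$-rational polyhedral subset. Let $f: S \cap F^n \to \mathbb{R}$ be a function such that for every $F$-rational line $L\subseteq \mathbb{R}^n$, the restriction of $f$ to $S\cap F^n\cap L$ is $F$-integral polyhedral. Then $f$ is $F$-integral polyhedral.
   Context: An affine functional $\lambda(x_1,\dots,x_n)=a_1x_1+\cdots+a_nx_n+b$ on $\mathbb{R}^n$ is $F$-integral if $a_1,\dots,a_n\in\mathbb{Z}$ and $b\in F$. An $F$-rational polyhedral subset of $\mathbb{R}^n$ is an intersection of finitely many (possibly zero) closed halfspaces $\{x:\lambda(x)\ge 0\}$ with each $\lambda$ an $F$-integral affine functional with $(a_1,\dots,a_n)\neq 0$ (it need not be bounded). An $F$-rational line is an affine line in $\mathbb{R}^n$ that is an $F$-rational polyhedral subset. For any $T\subseteq\mathbb{R}^n$, a function $g:T\to\mathbb{R}$ is $F$-integral polyhedral if $g(x)=\max\{\lambda_1(x),\dots,\lambda_m(x)\}$ for all $x\in T$, for some finite list of $F$-integral affine functionals $\lambda_1,\dots,\lambda_m$ on $\mathbb{R}^n$. -}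

module Defs where

open import Algebra.Bundles using (CommutativeRing)
import Algebra.Definitions as AlgebraDefinitions
import Algebra.Definitions.RawMonoid as RawMonoidDefinitions
open import Data.Integer.Base using (ℤ; +_; -[1+_]; 0ℤ)
open import Data.List.Base using (List)
import Data.List.Extrema as Extrema
open import Data.List.NonEmpty as List⁺ using (List⁺)
open import Data.List.Relation.Unary.All using (All)
open import Data.Nat.Base using (ℕ; suc)
open import Data.Product.Base using (Σ; ∃; ∃₂; _×_; _,_; proj₁; proj₂)
open import Data.Vec.Functional using (Vector)
import Data.Vec.Functional.Relation.Binary.Equality.Setoid as VectorEquality
open import Function.Bundles using (Func)
open import Level using (0ℓ) renaming (suc to lsuc)
open import Relation.Binary.Bundles using (Setoid; TotalOrder)
import Relation.Binary.Construct.On as On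
open import Relation.Binary.PropositionalEquality.Core using (_≡_)
open import Relation.Binary.Structures using (IsTotalOrder)
open import Relation.Nullary.Negation.Core using (¬_)
open import Relation.Unary using (Pred; _∈_; _⊆_; _≐_)

-- The library has no real numbers.  They are axiomatised as a
-- Dedekind-complete ordered field, which classically determines them up to
-- unique isomorphism; a statement about ℝ is a statement about every such R.
-- As usual for constructions of ℝ in setoids, equality is _≈_.
record RealField : Set (lsuc 0ℓ) where
  infix 4 _≤_
  field
    commutativeRing : CommutativeRing 0ℓ 0ℓ

  open CommutativeRing commutativeRing public
  open AlgebraDefinitions _≈_ using (Invertible)

  field
    1≉0          : ¬ (1# ≈ 0#)
    invertible   : ∀ x → ¬ (x ≈ 0#) → Invertible 1# _*_ x
    _≤_          : Carrier → Carrier → Set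
    isTotalOrder : IsTotalOrder _≈_ _≤_
    +-monoˡ-≤    : ∀ {x y} z → x ≤ y → x + z ≤ y + z
    *-nonneg     : ∀ {x y} → 0# ≤ x → 0# ≤ y → 0# ≤ x * y

  UpperBound : Pred Carrier 0ℓ → Pred Carrier 0ℓ
  UpperBound P u = ∀ x → x ∈ P → x ≤ u

  field
    complete : (P : Pred Carrier 0ℓ) → ∃ P → ∃ (UpperBound P) →
               ∃ λ s → s ∈ UpperBound P × (∀ u → u ∈ UpperBound P → s ≤ u)

  totalOrder : TotalOrder 0ℓ 0ℓ 0ℓ
  totalOrder = record { isTotalOrder = isTotalOrder }

  open RawMonoidDefinitions +-rawMonoid public
    using (sum) renaming (_×_ to _·_)

  fromℤ : ℤ → Carrier
  fromℤ (+ n)    = n · 1#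
  fromℤ -[1+ n ] = - (suc n · 1#)

record Subfield (R : RealField) : Set (lsuc 0ℓ) where
  open RealField R
  field
    member   : Pred Carrier 0ℓ
    resp-≈   : ∀ {x y} → x ≈ y → x ∈ member → y ∈ member
    0-closed : 0# ∈ member
    1-closed : 1# ∈ member
    +-closed : ∀ {x y} → x ∈ member → y ∈ member → x + y ∈ member
    neg-closed : ∀ {x} → x ∈ member → - x ∈ member
    *-closed : ∀ {x y} → x ∈ member → y ∈ member → x * y ∈ member
    -- The hypothesis says that y is the inverse of x.
    inverse-closed : ∀ {x y} → x * y ≈ 1# → x ∈ member → y ∈ member

module Polyhedral (R : RealField) (F : Subfield R) where
  open RealField R
  open Subfield F using (member)
  open VectorEquality setoid using (_≋_; ≋-setoid)

  Point : ℕ → Set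
  Point n = Vector Carrier n

  Fⁿ : ∀ {n} → Pred (Point n) 0ℓ
  Fⁿ x = ∀ i → x i ∈ member

  record IntegralFunctional (n : ℕ) : Set where
    field
      coeff   : Vector ℤ n
      const   : Carrier
      const∈F : const ∈ member

  open IntegralFunctional public

  eval : ∀ {n} → IntegralFunctional n → Point n → Carrier
  eval l x = sum (λ i → fromℤ (coeff l i) * x i) + const l

  NonConstant : ∀ {n} → Pred (IntegralFunctional n) 0ℓ
  NonConstant l = ¬ (∀ i → coeff l i ≡ 0ℤ)

  Halfspace : ∀ {n} → IntegralFunctional n → Pred (Point n) 0ℓ
  Halfspace l x = 0# ≤ eval l x

  IsRationalPolyhedral : ∀ {n} → Pred (Point n) 0ℓ → Set
  IsRationalPolyhedral {n} S =
    Σ (List (IntegralFunctional n)) λ ls →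
      All NonConstant ls × S ≐ (λ x → All (λ l → x ∈ Halfspace l) ls)

  IsAffineLine : ∀ {n} → Pred (Point n) 0ℓ → Set
  IsAffineLine {n} L =
    ∃₂ λ (p v : Point n) →
      ¬ (∀ i → v i ≈ 0#) ×
      L ≐ (λ x → ∃ λ t → x ≋ (λ i → p i + t * v i))

  IsRationalLine : ∀ {n} → Pred (Point n) 0ℓ → Set
  IsRationalLine L = IsAffineLine L × IsRationalPolyhedral L

  -- Points of T up to equality in Rⁿ, so that values of a function on T do
  -- not depend on the membership proof.
  Subspace : ∀ {n} → Pred (Point n) 0ℓ → Setoid 0ℓ 0ℓ
  Subspace {n} T = On.setoid {B = Σ (Point n) T} (≋-setoid n) proj₁

  RealFunction : ∀ {n} → Pred (Point n) 0ℓ → Set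
  RealFunction T = Func (Subspace T) setoid

  restrict : ∀ {n} {T U : Pred (Point n) 0ℓ} →
             T ⊆ U → RealFunction U → RealFunction T
  restrict T⊆U g = record
    { to   = λ (x , x∈T) → Func.to g (x , T⊆U x∈T)
    ; cong = Func.cong g
    }

  maximum : List⁺ Carrier → Carrier
  maximum xs = Extrema.max totalOrder (List⁺.head xs) (List⁺.tail xs)

  -- The list is nonempty because the maximum of no functionals is undefined.
  IsIntegralPolyhedral : ∀ {n} {T : Pred (Point n) 0ℓ} → RealFunction T → Set
  IsIntegralPolyhedral {n} {T} g =
    Σ (List⁺ (IntegralFunctional n)) λ ls →
      ∀ x (x∈T : x ∈ T) →
        Func.to g (x , x∈T) ≈ maximum (List⁺.map (λ l → eval l x) ls)

{-# OPTIONS --safe #-}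
module Submission where

-- We work over F as an archimedean ordered field K and extend f by 0 to Kⁿ.  On lines f is a
-- maximum of finitely many functionals, so it has supporting slopes and germs there, and
-- convexity along the coordinate directions already makes f continuous inside S.  The
-- right slopes along the unit vectors are integers and upper semicontinuous, so near every interior
-- point there is a box on which their sum is minimal, hence constant; there f equals an integral
-- functional.  Such touching functionals lie below f on all of S, because every point sees the box
-- in some integral direction, and they approximate f inside S; in particular f is convex there.
-- It remains to bound their slopes, since finitely many integral slopes give finitely many touching
-- functionals.  Follow a direction from a box: either the ray stays in S, and the slope is at most
-- that of f along a parallel ray from a fixed point, or it leaves through a face of S.  On the face
-- f is polyhedral by induction on the number of constraints, and convexity bounds the growth of f
-- from the whole face into S in terms of its growth at one relative interior point of each piece.

open import Defs
open import Algebra.Bundles using (AbelianGroup; CommutativeRing)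
open import Algebra.Bundles.Raw using (RawRing)
import Algebra.Definitions.RawMonoid as RawMonoidDefinitions
import Algebra.Morphism.RingMonomorphism as RingMonomorphism
open import Algebra.Morphism.Structures using (IsRingMonomorphism)
import Algebra.Properties.CommutativeMonoid.Sum as MonoidSum
import Algebra.Properties.CommutativeSemigroup as CommutativeSemigroupProperties
import Algebra.Properties.Group as GroupProperties
import Algebra.Properties.Ring as RingProperties
import Algebra.Properties.Semiring.Mult as SemiringMult
import Algebra.Properties.Semiring.Sum as SemiringSum
import Algebra.Solver.Ring as RingSolver
open import Algebra.Solver.Ring.AlmostCommutativeRing
  using (fromCommutativeRing; _-Raw-AlmostCommutative⟶_)
open import Axiom.ExcludedMiddle using (ExcludedMiddle)
open import Data.Empty using (⊥-elim)
open import Data.Fin.Base using (Fin; zero; suc; punchIn; punchOut)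
import Data.Fin.Properties as FinP
open import Data.Integer.Base as ℤ using (ℤ; +_; -[1+_]; 0ℤ; 1ℤ)
import Data.Integer.DivMod as ℤD
import Data.Integer.Properties as ℤP
import Data.Integer.Solver as ℤSolver
open import Data.List.Base
  using (List; []; _∷_; _++_; allFin; map; length; upTo; cartesianProductWith)
import Data.List.Extrema as Extrema
open import Data.List.Membership.Propositional using (_∈_; find; lose)
open import Data.List.Membership.Propositional.Properties
  using (∈-allFin; ∈-∃++; ∈-upTo⁺; ∈-++⁺ˡ; ∈-++⁺ʳ; ∈-map⁺; ∈-map⁻)
open import Data.List.NonEmpty as List⁺ using (List⁺; _∷_)
import Data.List.Properties as ListP
open import Data.List.Relation.Unary.All as All using (All; []; _∷_)
import Data.List.Relation.Unary.All.Properties as AllP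
open import Data.List.Relation.Unary.Any as Any using (Any; here; there)
import Data.List.Relation.Unary.Any.Properties as AnyP
open import Data.Maybe.Base using (Maybe; just; nothing)
open import Data.Nat.Base as ℕ using (ℕ; zero; suc)
open import Data.Nat.Induction using (<-wellFounded)
import Data.Nat.Properties as ℕP
open import Data.Product.Base using (Σ; ∃; ∃₂; _×_; _,_; proj₁; proj₂; uncurry)
open import Data.Sum.Base using (_⊎_; inj₁; inj₂; [_,_]′)
open import Data.Unit.Base using (⊤; tt)
open import Data.Vec.Functional using (Vector) renaming (_∷_ to _◁_)
open import Function.Base using (_∘_; id)
open import Function.Bundles using (Func)
open import Induction.WellFounded using (Acc; acc)
open import Level using (0ℓ)
import Relation.Binary.Construct.On as On
open import Relation.Binary.PropositionalEquality.Core as ≡ using (_≡_)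
import Relation.Binary.PropositionalEquality.Properties as ≡P
open import Relation.Binary.Structures using (IsTotalOrder)
open import Relation.Nullary.Decidable.Core using (Dec; yes; no)
open import Relation.Nullary.Negation.Core using (¬_)
open import Relation.Unary using (Pred; _∩_; _≐_) renaming (_∈_ to _∈ᴾ_)

open CommutativeSemigroupProperties ℤP.*-commutativeSemigroup using (x∙yz≈y∙xz)
open GroupProperties (AbelianGroup.group ℤP.+-0-abelianGroup) using (∙-cancelʳ)

-- An F-rational line has a direction that can be taken integral, so in dimension at least two most
-- pairs of points of Fⁿ lie on no line that the hypothesis covers. Convexity between arbitrary
-- points is thus not given: it must come from global affine minorants, and these have to be built
-- before convexity is available. Nor is there compactness, since F need not be complete (it can be
-- ℚ): minima come from the well-ordering of ℕ applied to integral slopes, and limits from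
-- inequalities that hold up to every ε. The slopes of the minorants could a priori grow without
-- bound towards the boundary of S; to exclude this one must know f on the faces, which is why they
-- are treated first. Two facts keep the induction within one class of problems: f takes values in
-- F, because every point of Fⁿ lies on a rational line, and a hyperplane with primitive integral
-- normal admits a projection with integral coefficients, so passing to a face keeps slopes and
-- directions integral.

record OrderedField : Set₁ where
  infix 4 _≤_
  field
    commutativeRing : CommutativeRing 0ℓ 0ℓ

  open CommutativeRing commutativeRing public

  field
    1≉0          : ¬ (1# ≈ 0#)
    invertible   : ∀ x → ¬ (x ≈ 0#) → ∃ λ y → x * y ≈ 1#
    _≤_          : Carrier → Carrier → Set
    isTotalOrder : IsTotalOrder _≈_ _≤_
    +-monoˡ-≤    : ∀ {x y} z → x ≤ y → x + z ≤ y + z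
    *-nonneg     : ∀ {x y} → 0# ≤ x → 0# ≤ y → 0# ≤ x * y

  open RawMonoidDefinitions +-rawMonoid public
    using (sum) renaming (_×_ to _·_)

  fromℤ : ℤ → Carrier
  fromℤ (+ n)    = n · 1#
  fromℤ -[1+ n ] = - (suc n · 1#)

-- The archimedean property is what a subfield retains of the completeness of ℝ.
record ArchimedeanField : Set₁ where
  field
    orderedField : OrderedField

  open OrderedField orderedField using (Carrier; _≤_; _·_; 1#)

  field
    archimedean  : ∀ (x : Carrier) → ∃ λ n → x ≤ n · 1#

-- Arithmetic, inequalities and embedded integers in an ordered field

module FieldProperties (em : ExcludedMiddle 0ℓ) (K : OrderedField) where
  open OrderedField K hiding (zero) public
  open RingProperties ring using (-‿distribˡ-*; -‿distribʳ-*; -‿involutive; -0#≈0#; -‿+-comm)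
  open SemiringMult semiring using (×1-homo-*; ×-homo-+)
  open IsTotalOrder isTotalOrder public
    using () renaming (refl to ≤-refl; reflexive to ≤-reflexive; trans to ≤-trans;
                       antisym to ≤-antisym; total to ≤-total;
                       ≤-respˡ-≈ to ≤-respˡ; ≤-respʳ-≈ to ≤-respʳ)
  open import Relation.Binary.Reasoning.Setoid setoid

  private
    cancel-1 : ∀ x y → (1# + x) - (1# + y) ≈ x - y
    cancel-1 x y = begin
      (1# + x) + - (1# + y)       ≈⟨ +-congˡ (-‿+-comm 1# y) ⟨
      (1# + x) + (- 1# + - y)     ≈⟨ +-assoc _ _ _ ⟩
      1# + (x + (- 1# + - y))     ≈⟨ +-congˡ (+-assoc _ _ _) ⟨
      1# + ((x + - 1#) + - y)     ≈⟨ +-congˡ (+-congʳ (+-comm _ _)) ⟩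
      1# + ((- 1# + x) + - y)     ≈⟨ +-congˡ (+-assoc _ _ _) ⟩
      1# + (- 1# + (x + - y))     ≈⟨ +-assoc _ _ _ ⟨
      (1# + - 1#) + (x + - y)     ≈⟨ +-congʳ (-‿inverseʳ 1#) ⟩
      0# + (x + - y)              ≈⟨ +-identityˡ _ ⟩
      x - y                       ∎

  fromℤ-⊖ : ∀ m n → fromℤ (m ℤ.⊖ n) ≈ m · 1# - n · 1#
  fromℤ-⊖ zero    zero    = sym (-‿inverseʳ 0#)
  fromℤ-⊖ zero    (suc n) = sym (+-identityˡ _)
  fromℤ-⊖ (suc m) zero    = sym (trans (+-congˡ -0#≈0#) (+-identityʳ _))
  fromℤ-⊖ (suc m) (suc n) = begin
    fromℤ (suc m ℤ.⊖ suc n)           ≡⟨ ≡.cong fromℤ (ℤP.[1+m]⊖[1+n]≡m⊖n m n) ⟩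
    fromℤ (m ℤ.⊖ n)                   ≈⟨ fromℤ-⊖ m n ⟩
    m · 1# - n · 1#                   ≈⟨ cancel-1 _ _ ⟨
    (1# + m · 1#) - (1# + n · 1#)     ∎

  fromℤ-neg : ∀ i → fromℤ (ℤ.- i) ≈ - fromℤ i
  fromℤ-neg (+ zero)  = sym -0#≈0#
  fromℤ-neg (+ suc n) = refl
  fromℤ-neg -[1+ n ]  = sym (-‿involutive _)

  fromℤ-+ : ∀ i j → fromℤ (i ℤ.+ j) ≈ fromℤ i + fromℤ j
  fromℤ-+ (+ m)    (+ n)    = ×-homo-+ 1# m n
  fromℤ-+ (+ m)    -[1+ n ] = fromℤ-⊖ m (suc n)
  fromℤ-+ -[1+ m ] (+ n)    = trans (fromℤ-⊖ n (suc m)) (+-comm _ _)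
  fromℤ-+ -[1+ m ] -[1+ n ] = begin
    - (suc (suc (m ℕ.+ n)) · 1#)             ≡⟨ ≡.cong (λ k → - (k · 1#)) (≡.cong suc (≡.sym (ℕP.+-suc m n))) ⟩
    - ((suc m ℕ.+ suc n) · 1#)               ≈⟨ -‿cong (×-homo-+ 1# (suc m) (suc n)) ⟩
    - (suc m · 1# + suc n · 1#)              ≈⟨ -‿+-comm _ _ ⟨
    - (suc m · 1#) + - (suc n · 1#)          ∎

  private
    fromℤ-*-+ : ∀ m j → fromℤ (+ m ℤ.* j) ≈ m · 1# * fromℤ j
    fromℤ-*-+ m (+ n)    = begin
      fromℤ (+ m ℤ.* + n)   ≡⟨ ≡.cong fromℤ (ℤP.pos-* m n) ⟨
      (m ℕ.* n) · 1#        ≈⟨ ×1-homo-* m n ⟩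
      m · 1# * (n · 1#)     ∎
    fromℤ-*-+ m -[1+ n ] = begin
      fromℤ (+ m ℤ.* -[1+ n ])        ≡⟨ ≡.cong fromℤ (ℤP.neg-distribʳ-* (+ m) (+ suc n)) ⟨
      fromℤ (ℤ.- (+ m ℤ.* + suc n))   ≈⟨ fromℤ-neg (+ m ℤ.* + suc n) ⟩
      - fromℤ (+ m ℤ.* + suc n)       ≈⟨ -‿cong (fromℤ-*-+ m (+ suc n)) ⟩
      - (m · 1# * (suc n · 1#))       ≈⟨ -‿distribʳ-* _ _ ⟩
      m · 1# * - (suc n · 1#)         ∎

  fromℤ-* : ∀ i j → fromℤ (i ℤ.* j) ≈ fromℤ i * fromℤ j
  fromℤ-* (+ m)    j = fromℤ-*-+ m j
  fromℤ-* -[1+ m ] j = begin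
    fromℤ (-[1+ m ] ℤ.* j)          ≡⟨ ≡.cong fromℤ (ℤP.neg-distribˡ-* (+ suc m) j) ⟨
    fromℤ (ℤ.- (+ suc m ℤ.* j))     ≈⟨ fromℤ-neg (+ suc m ℤ.* j) ⟩
    - fromℤ (+ suc m ℤ.* j)         ≈⟨ -‿cong (fromℤ-*-+ (suc m) j) ⟩
    - (suc m · 1# * fromℤ j)        ≈⟨ -‿distribˡ-* _ _ ⟩
    - (suc m · 1#) * fromℤ j        ∎

  fromℤ-1 : fromℤ 1ℤ ≈ 1#
  fromℤ-1 = +-identityʳ 1#

  private
    -- Equals fromℤ, but sends 1 to 1# itself, so that the solver's constant 1 denotes 1#.
    ⟦_⟧ : ℤ → Carrier
    ⟦ + 1 ⟧ = 1#
    ⟦ i ⟧   = fromℤ i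

    ⟦⟧≈ : ∀ i → ⟦ i ⟧ ≈ fromℤ i
    ⟦⟧≈ (+ 0)           = refl
    ⟦⟧≈ (+ 1)           = sym fromℤ-1
    ⟦⟧≈ (+ suc (suc n)) = refl
    ⟦⟧≈ -[1+ n ]        = refl

    coefficients : ℤ.+-*-rawRing -Raw-AlmostCommutative⟶ fromCommutativeRing commutativeRing
    coefficients = record
      { ⟦_⟧    = ⟦_⟧
      ; +-homo = λ i j → trans (⟦⟧≈ (i ℤ.+ j)) (trans (fromℤ-+ i j) (sym (+-cong (⟦⟧≈ i) (⟦⟧≈ j))))
      ; *-homo = λ i j → trans (⟦⟧≈ (i ℤ.* j)) (trans (fromℤ-* i j) (sym (*-cong (⟦⟧≈ i) (⟦⟧≈ j))))
      ; -‿homo = λ i → trans (⟦⟧≈ (ℤ.- i)) (trans (fromℤ-neg i) (sym (-‿cong (⟦⟧≈ i))))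
      ; 0-homo = refl
      ; 1-homo = refl
      }

    _≟coeff_ : ∀ i j → Maybe (⟦ i ⟧ ≈ ⟦ j ⟧)
    i ≟coeff j with i ℤP.≟ j
    ... | yes i≡j = just (reflexive (≡.cong ⟦_⟧ i≡j))
    ... | no _    = nothing

  open RingSolver ℤ.+-*-rawRing (fromCommutativeRing commutativeRing) coefficients _≟coeff_ public
    using (solve; _:=_; _:+_; _:*_; _:-_; :-_; con; Polynomial)

  :0 :1 : ∀ {n} → Polynomial n
  :0 = con 0ℤ
  :1 = con 1ℤ

  infix 4 _<_
  _<_ : Carrier → Carrier → Set
  x < y = ¬ (y ≤ x)

  2# : Carrier
  2# = 1# + 1#

  infixl 6 _⊕_
  infixl 7 _⊗_

  opaque
    <⇒≤ : ∀ {x y} → x < y → x ≤ y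
    <⇒≤ {x} {y} x<y with ≤-total x y
    ... | inj₁ x≤y = x≤y
    ... | inj₂ y≤x = ⊥-elim (x<y y≤x)

    ≤⊎> : ∀ x y → x ≤ y ⊎ y < x
    ≤⊎> x y with em {x ≤ y}
    ... | yes x≤y = inj₁ x≤y
    ... | no x≰y  = inj₂ x≰y

    -- Reduces an inequality to a certificate: `gap`, `_⊕_` and `_⊗_` assemble a visibly nonnegative
    -- `e`, and the ring solver confirms that it is the difference of the two sides.
    ≤-by : ∀ {x y e} → 0# ≤ e → y - x ≈ e → x ≤ y
    ≤-by {x} {y} 0≤e eq = ≤-respˡ (+-identityˡ x) (≤-respʳ
      (solve 2 (λ x y → (y :- x) :+ x := y) refl x y) (+-monoˡ-≤ x (≤-respʳ (sym eq) 0≤e)))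

    gap : ∀ {x y} → x ≤ y → 0# ≤ y - x
    gap {x} x≤y = ≤-respˡ (-‿inverseʳ x) (+-monoˡ-≤ (- x) x≤y)

    _⊕_ : ∀ {x y} → 0# ≤ x → 0# ≤ y → 0# ≤ x + y
    _⊕_ {x} {y} 0≤x 0≤y = ≤-trans 0≤y (≤-respˡ (+-identityˡ y) (+-monoˡ-≤ y 0≤x))

    _⊗_ : ∀ {x y} → 0# ≤ x → 0# ≤ y → 0# ≤ x * y
    _⊗_ = *-nonneg

    +-mono : ∀ {x y u v} → x ≤ y → u ≤ v → x + u ≤ y + v
    +-mono {x} {y} {u} {v} p q = ≤-by (gap p ⊕ gap q)
      (solve 4 (λ x y u v → (y :+ v) :- (x :+ u) := (y :- x) :+ (v :- u)) refl x y u v)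

    *-monoˡ : ∀ {c x y} → 0# ≤ c → x ≤ y → c * x ≤ c * y
    *-monoˡ {c} {x} {y} 0≤c p = ≤-by (0≤c ⊗ gap p)
      (solve 3 (λ c x y → c :* y :- c :* x := c :* (y :- x)) refl c x y)

    neg-mono : ∀ {x y} → x ≤ y → - y ≤ - x
    neg-mono {x} {y} p = ≤-by (gap p) (solve 2 (λ x y → :- x :- :- y := y :- x) refl x y)

    neg≥0 : ∀ {x} → x ≤ 0# → 0# ≤ - x
    neg≥0 p = ≤-respˡ -0#≈0# (neg-mono p)

    <-≤-trans : ∀ {x y z} → x < y → y ≤ z → x < z
    <-≤-trans x<y y≤z z≤x = x<y (≤-trans y≤z z≤x)

    <-respʳ : ∀ {x y z} → y ≈ z → x < y → x < z
    <-respʳ y≈z x<y z≤x = x<y (≤-respˡ (sym y≈z) z≤x)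

    *-cancel-≈0 : ∀ {c x} → ¬ (c ≈ 0#) → c * x ≈ 0# → x ≈ 0#
    *-cancel-≈0 {c} {x} c≉0 cx≈0 = let d , cd≈1 = invertible c c≉0 in begin
      x           ≈⟨ *-identityˡ x ⟨
      1# * x      ≈⟨ *-congʳ cd≈1 ⟨
      c * d * x   ≈⟨ solve 3 (λ c d x → c :* d :* x := d :* (c :* x)) refl c d x ⟩
      d * (c * x) ≈⟨ *-congˡ cx≈0 ⟩
      d * 0#      ≈⟨ zeroʳ d ⟩
      0#          ∎

    >⇒≉ : ∀ {x} → 0# < x → ¬ (x ≈ 0#)
    >⇒≉ 0<x x≈0 = 0<x (≤-reflexive x≈0)

    pos-* : ∀ {x y} → 0# < x → 0# < y → 0# < x * y
    pos-* 0<x 0<y xy≤0 = >⇒≉ 0<y (*-cancel-≈0 (>⇒≉ 0<x) (≤-antisym xy≤0 (<⇒≤ 0<x ⊗ <⇒≤ 0<y)))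

    pos-+ : ∀ {x y} → 0# < x → 0# ≤ y → 0# < x + y
    pos-+ {x} {y} 0<x 0≤y p = 0<x (≤-by (0≤y ⊕ gap p)
      (solve 2 (λ x y → :0 :- x := y :+ (:0 :- (x :+ y))) refl x y))

    0<gap : ∀ {x y} → x < y → 0# < y - x
    0<gap {x} {y} x<y p = x<y (≤-by (gap p) (solve 2 (λ x y → x :- y := :0 :- (y :- x)) refl x y))

    *-cancel-≤ : ∀ {c x y} → 0# < c → c * x ≤ c * y → x ≤ y
    *-cancel-≤ {c} {x} {y} 0<c p with ≤⊎> x y
    ... | inj₁ x≤y = x≤y
    ... | inj₂ y<x = ⊥-elim (pos-* 0<c (0<gap y<x) (≤-by (gap p)
      (solve 3 (λ c x y → :0 :- c :* (x :- y) := c :* y :- c :* x) refl c x y)))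

  opaque
    0<1 : 0# < 1#
    0<1 1≤0 = 1≉0 (≤-antisym 1≤0 (≤-respʳ (solve 0 (:- :1 :* :- :1 := :1) refl)
      (neg≥0 1≤0 ⊗ neg≥0 1≤0)))

  opaque
    0≤1 : 0# ≤ 1#
    0≤1 = <⇒≤ 0<1

  opaque
    recip : ∀ x → 0# < x → ∃ λ y → 0# < y × x * y ≈ 1#
    recip x 0<x with invertible x (>⇒≉ 0<x)
    ... | y , xy≈1 = y , (λ y≤0 → 0<1 (≤-by (<⇒≤ 0<x ⊗ neg≥0 y≤0) (trans (+-congˡ (-‿cong (sym xy≈1)))
          (solve 2 (λ x y → :0 :- x :* y := x :* :- y) refl x y)))) , xy≈1

  opaque
    0<2 : 0# < 2#
    0<2 = pos-+ 0<1 0≤1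

  opaque
    half : ∀ x → 0# < x → ∃ λ h → 0# < h × h + h ≈ x
    half x 0<x with recip 2# 0<2
    ... | y , 0<y , 2y≈1 = y * x , pos-* 0<y 0<x , (begin
      y * x + y * x        ≈⟨ solve 2 (λ y x → y :* x :+ y :* x := (:1 :+ :1) :* y :* x) refl y x ⟩
      2# * y * x           ≈⟨ *-congʳ 2y≈1 ⟩
      1# * x               ≈⟨ *-identityˡ x ⟩
      x                    ∎)

  opaque
    min⁺ : ∀ x y → 0# < x → 0# < y → ∃ λ z → 0# < z × z ≤ x × z ≤ y
    min⁺ x y 0<x 0<y with ≤-total x y
    ... | inj₁ x≤y = x , 0<x , ≤-refl , x≤y
    ... | inj₂ y≤x = y , 0<y , y≤x , ≤-refl

    upper : ∀ x y → ∃ λ z → x ≤ z × y ≤ z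
    upper x y with ≤-total x y
    ... | inj₁ x≤y = y , x≤y , ≤-refl
    ... | inj₂ y≤x = x , ≤-refl , y≤x

  opaque
    small : ∀ c ε → 0# < ε → ∃ λ t → 0# < t × t * c ≤ ε
    -- A bound `d` of both `c` and 1 is invertible whatever the sign of `c`; the witness is ε/d.
    small c ε 0<ε with upper c 1#
    ... | d , c≤d , 1≤d with recip d (<-≤-trans 0<1 1≤d)
    ...   | y , 0<y , dy≈1 = y * ε , pos-* 0<y 0<ε , ≤-by ((<⇒≤ 0<y ⊗ <⇒≤ 0<ε) ⊗ gap c≤d) (begin
      ε - y * ε * c            ≈⟨ +-congʳ (trans (*-congʳ dy≈1) (*-identityˡ ε)) ⟨
      d * y * ε - y * ε * c    ≈⟨ solve 4 (λ c d y ε → d :* y :* ε :- y :* ε :* c := y :* ε :* (d :- c)) refl c d y ε ⟩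
      y * ε * (d - c)          ∎)

  opaque
    -- Stands in for the limit ε → 0: if y < x, an ε with C ε at most half of x - y refutes the
    -- hypothesis.
    ≤-of-small : ∀ {x y} C → (∀ ε → 0# < ε → x ≤ y + C * ε) → x ≤ y
    ≤-of-small {x} {y} C h with ≤⊎> x y
    ... | inj₁ x≤y = x≤y
    ... | inj₂ y<x with half (x - y) (0<gap y<x)
    ...   | g , 0<g , gg with small C g 0<g
    ...     | t , 0<t , tC≤g = ⊥-elim (0<g (≤-by (gap (h t 0<t) ⊕ gap tC≤g) (begin
      0# - g                                  ≈⟨ solve 1 (λ g → :0 :- g := g :- (g :+ g)) refl g ⟩
      g - (g + g)                             ≈⟨ +-congˡ (-‿cong gg) ⟩
      g - (x - y)                             ≈⟨ solve 5 (λ g x y C t → g :- (x :- y) := ((y :+ C :* t) :- x) :+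
            (g :- t :* C)) refl g x y C t ⟩
      ((y + C * t) - x) + (g - t * C)         ∎)))

  opaque
    ·1-nonneg : ∀ n → 0# ≤ n · 1#
    ·1-nonneg zero    = ≤-refl
    ·1-nonneg (suc n) = 0≤1 ⊕ ·1-nonneg n

    fromℤ-nonneg : ∀ {i} → 0ℤ ℤ.≤ i → 0# ≤ fromℤ i
    fromℤ-nonneg {+ n} _ = ·1-nonneg n

    fromℤ-mono : ∀ {i j} → i ℤ.≤ j → fromℤ i ≤ fromℤ j
    fromℤ-mono {i} {j} i≤j = ≤-by (fromℤ-nonneg (ℤP.i≤j⇒0≤j-i i≤j))
      (trans (+-congˡ (sym (fromℤ-neg i))) (sym (fromℤ-+ j (ℤ.- i))))

  opaque
    fromℤ-suc : ∀ i → fromℤ (ℤ.suc i) ≈ 1# + fromℤ i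
    fromℤ-suc i = trans (fromℤ-+ 1ℤ i) (+-congʳ fromℤ-1)

  opaque
    fromℤ-<-cancel : ∀ {i j} → fromℤ i < fromℤ j → i ℤ.< j
    fromℤ-<-cancel {i} {j} p with i ℤP.<? j
    ... | yes i<j = i<j
    ... | no i≮j  = ⊥-elim (p (fromℤ-mono (ℤP.≮⇒≥ i≮j)))

  opaque
    fromℤ-≤-cancel : ∀ {i j} → fromℤ i ≤ fromℤ j → i ℤ.≤ j
    fromℤ-≤-cancel {i} {j} p with i ℤP.≤? j
    ... | yes i≤j = i≤j
    ... | no i≰j  = ⊥-elim (<-≤-trans (pos-+ 0<1 ≤-refl) (≤-by (gap (fromℤ-mono (ℤP.i<j⇒suc[i]≤j (ℤP.≰⇒> i≰j))) ⊕ gap p)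
      (trans (solve 2 (λ i j → :0 :- (:1 :+ :0) := (i :- (:1 :+ j)) :+ (j :- i)) refl (fromℤ i) (fromℤ j))
         (+-congʳ (+-congˡ (-‿cong (sym (fromℤ-suc j))))))) ≤-refl)

  opaque
    fromℤ≈0⇒≡0 : ∀ {i} → fromℤ i ≈ 0# → i ≡ 0ℤ
    fromℤ≈0⇒≡0 {i} p = ℤP.≤-antisym (fromℤ-≤-cancel {i} {0ℤ} (≤-reflexive p))
          (fromℤ-≤-cancel {0ℤ} {i} (≤-reflexive (sym p)))

  opaque
    -- If D < L, the left side exceeds the right one by exactly 1 at t = (b - a + 1)/(L - D). This t
    -- is admissible because the case t = 0 gives a ≤ b.
    slope-≤ : ∀ {a b L D} → (∀ t → 0# ≤ t → a + t * L ≤ b + t * D) → L ≤ D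
    slope-≤ {a} {b} {L} {D} h with ≤⊎> L D
    ... | inj₁ L≤D = L≤D
    ... | inj₂ D<L with recip (L - D) (0<gap D<L)
    ...   | c , 0<c , [L-D]c≈1 = ⊥-elim (0<1 (≤-by (gap (h t 0≤t)) (sym (begin
        b + t * D - (a + t * L)                ≈⟨ solve 5 (λ a b L D c → b :+ (b :- a :+ :1) :* c :* D :-
              (a :+ (b :- a :+ :1) :* c :* L) := (b :- a) :- (b :- a :+ :1) :* ((L :- D) :* c)) refl a b L D c ⟩
        (b - a) - (b - a + 1#) * ((L - D) * c) ≈⟨ +-congˡ (-‿cong (*-congˡ [L-D]c≈1)) ⟩
        (b - a) - (b - a + 1#) * 1#            ≈⟨ solve 1 (λ d → d :- (d :+ :1) :* :1 := :0 :- :1) refl (b - a) ⟩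
        0# - 1#                                ∎))))
      where
      t : Carrier
      t = (b - a + 1#) * c
      a≤b : a ≤ b
      a≤b = ≤-respˡ (solve 2 (λ a L → a :+ :0 :* L := a) refl a L)
            (≤-respʳ (solve 2 (λ a L → a :+ :0 :* L := a) refl b D) (h 0# ≤-refl))
      0≤t : 0# ≤ t
      0≤t = (gap a≤b ⊕ 0≤1) ⊗ <⇒≤ 0<c

module ArchimedeanFieldProperties (em : ExcludedMiddle 0ℓ) (K : ArchimedeanField) where
  open ArchimedeanField K public using (orderedField; archimedean)
  open FieldProperties em orderedField
  open SemiringMult semiring using (×-homo-+)

  opaque
    floor : ∀ x → ∃ λ i → fromℤ i ≤ x × x ≤ fromℤ i + 1#
    floor x with archimedean x | archimedean (- x)
    -- The search climbs from -n with m + n steps in reserve, so its last candidate bound is m.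
    ... | m , x≤m | n , -x≤n = search (m ℕ.+ n) (ℤ.- (+ n))
      (≤-respˡ (sym (fromℤ-neg (+ n))) (≤-by (gap -x≤n)
         (solve 2 (λ x n → x :- :- n := n :- :- x) refl x (n · 1#))))
      (≤-by (gap x≤m) (trans (+-congʳ (+-cong (fromℤ-neg (+ n)) (×-homo-+ 1# m n)))
         (solve 3 (λ x n m → (:- n :+ (m :+ n)) :- x := m :- x) refl x (n · 1#) (m · 1#))))
      where
      search : ∀ n i → fromℤ i ≤ x → x ≤ fromℤ i + n · 1# → ∃ λ i → fromℤ i ≤ x × x ≤ fromℤ i + 1#
      search zero    i lo hi = i , lo , ≤-trans hi (+-mono ≤-refl 0≤1)
      search (suc n) i lo hi with ≤⊎> x (fromℤ i + 1#)
      ... | inj₁ x≤ = i , lo , x≤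
      ... | inj₂ >x = search n (ℤ.suc i) (≤-respˡ (trans (+-comm _ _) (sym (fromℤ-suc i))) (<⇒≤ >x))
            (≤-respʳ (trans (solve 2 (λ i n → i :+ (:1 :+ n) := (:1 :+ i) :+ n) refl (fromℤ i) (n · 1#))
               (+-congʳ (sym (fromℤ-suc i)))) hi)

-- Integer vectors: dot products, finite boxes and primitive parts

dot : ∀ {n} → Vector ℤ n → Vector ℤ n → ℤ
dot {zero}  a v = 0ℤ
dot {suc n} a v = a zero ℤ.* v zero ℤ.+ dot (a ∘ suc) (v ∘ suc)

unit : ∀ {n} → Fin n → Vector ℤ n
unit zero    zero    = 1ℤ
unit zero    (suc j) = 0ℤ
unit (suc i) zero    = 0ℤ
unit (suc i) (suc j) = unit i j

dot-unit : ∀ {n} (a : Vector ℤ n) i → dot a (unit i) ≡ a i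
dot-unit a zero    = ≡.trans (≡.cong₂ ℤ._+_ (ℤP.*-identityʳ (a zero)) (dot-zero (a ∘ suc))) (ℤP.+-identityʳ (a zero))
  where
  dot-zero : ∀ {n} (a : Vector ℤ n) → dot a (λ _ → 0ℤ) ≡ 0ℤ
  dot-zero {zero}  a = ≡.refl
  dot-zero {suc n} a = ≡.cong₂ ℤ._+_ (ℤP.*-zeroʳ (a zero)) (dot-zero (a ∘ suc))
dot-unit a (suc i) = ≡.trans (≡.cong₂ ℤ._+_ (ℤP.*-zeroʳ (a zero)) (dot-unit (a ∘ suc) i)) (ℤP.+-identityˡ _)

unit-same : ∀ {n} (i : Fin n) → unit i i ≡ 1ℤ
unit-same zero    = ≡.refl
unit-same (suc i) = unit-same i

unit-other : ∀ {n} {i j : Fin n} → ¬ i ≡ j → unit i j ≡ 0ℤ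
unit-other {i = zero}  {zero}  i≢j = ⊥-elim (i≢j ≡.refl)
unit-other {i = zero}  {suc j} i≢j = ≡.refl
unit-other {i = suc i} {zero}  i≢j = ≡.refl
unit-other {i = suc i} {suc j} i≢j = unit-other (i≢j ∘ ≡.cong suc)

allOrAny : ∀ {A : Set} {P Q : Pred A 0ℓ} {xs} → All (λ x → P x ⊎ Q x) xs → All P xs ⊎ Any Q xs
allOrAny []            = inj₁ []
allOrAny (inj₂ q ∷ ps) = inj₂ (here q)
allOrAny (inj₁ p ∷ ps) with allOrAny ps
... | inj₁ all = inj₁ (p ∷ all)
... | inj₂ any = inj₂ (there any)

-M≤⇒0≤+M : ∀ M {i} → ℤ.- (+ M) ℤ.≤ i → 0ℤ ℤ.≤ i ℤ.+ + M
-M≤⇒0≤+M M {i} -M≤i = ≡.subst (ℤ._≤ i ℤ.+ + M) (ℤP.+-inverseˡ (+ M)) (ℤP.+-monoˡ-≤ (+ M) -M≤i)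

-- The shift by `M` turns integers bounded below by -M into naturals without losing their order; the
-- descent in `constant-slopes` takes place there.
∣+M∣-mono : ∀ M {i k} → ℤ.- (+ M) ℤ.≤ i → i ℤ.≤ k → ℤ.∣ i ℤ.+ + M ∣ ℕ.≤ ℤ.∣ k ℤ.+ + M ∣
∣+M∣-mono M -M≤i i≤k = ℤP.drop‿+≤+ (≡.subst₂ ℤ._≤_
  (≡.sym (ℤP.0≤i⇒+∣i∣≡i (-M≤⇒0≤+M M -M≤i)))
  (≡.sym (ℤP.0≤i⇒+∣i∣≡i (-M≤⇒0≤+M M (ℤP.≤-trans -M≤i i≤k))))
  (ℤP.+-monoˡ-≤ (+ M) i≤k))

∣+M∣-injective : ∀ M {i k} → ℤ.- (+ M) ℤ.≤ i → i ℤ.≤ k → ℤ.∣ i ℤ.+ + M ∣ ≡ ℤ.∣ k ℤ.+ + M ∣ → i ≡ k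
∣+M∣-injective M {i} {k} -M≤i i≤k eq = ∙-cancelʳ (+ M) i k
  (≡.trans (≡.sym (ℤP.0≤i⇒+∣i∣≡i (-M≤⇒0≤+M M -M≤i)))
    (≡.trans (≡.cong +_ eq) (ℤP.0≤i⇒+∣i∣≡i (-M≤⇒0≤+M M (ℤP.≤-trans -M≤i i≤k)))))

box-vectors : ℕ → ∀ n → List (Vector ℤ n)
box-vectors M zero    = (λ ()) ∷ []
box-vectors M (suc n) = cartesianProductWith _◁_ (map +_ (upTo (suc M)) ++ map (λ k → ℤ.- (+ k)) (upTo (suc M)))
      (box-vectors M n)

-- Vectors are functions, so membership in the list can be claimed only up to pointwise equality.
box-vectors-complete : ∀ M {n} (a : Vector ℤ n) → (∀ i → ℤ.∣ a i ∣ ℕ.≤ M) → Any (λ b → ∀ i → b i ≡ a i)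
      (box-vectors M n)
box-vectors-complete M {zero}  a _ = here λ ()
box-vectors-complete M {suc n} a ∣a∣≤M = AnyP.cartesianProductWith⁺ _◁_ (λ e es → λ { zero → ≡.sym e ; (suc i) → es i })
  (head∈ (a zero) (∣a∣≤M zero)) (box-vectors-complete M (a ∘ suc) (∣a∣≤M ∘ suc))
  where
  head∈ : ∀ i → ℤ.∣ i ∣ ℕ.≤ M → i ∈ map +_ (upTo (suc M)) ++ map (λ k → ℤ.- (+ k)) (upTo (suc M))
  head∈ (+ k)    k≤M = ∈-++⁺ˡ (∈-map⁺ +_ (∈-upTo⁺ (ℕ.s≤s k≤M)))
  head∈ -[1+ k ] k≤M = ∈-++⁺ʳ (map +_ (upTo (suc M))) (∈-map⁺ (λ k → ℤ.- (+ k)) (∈-upTo⁺ (ℕ.s≤s k≤M)))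

-- The combination u i + v j divides both entries, which makes it a greatest common divisor up to
-- sign. The pair (0, 0) is covered, with divisor 0.
Bézout : ℤ → ℤ → Set
Bézout i j = ∃₂ λ u v → ∃₂ λ i′ j′ → i ≡ (u ℤ.* i ℤ.+ v ℤ.* j) ℤ.* i′ × j ≡ (u ℤ.* i ℤ.+ v ℤ.* j) ℤ.* j′

-- Euclid's algorithm: with i = r + q j, the combination u j + v r equals v i + (u - v q) j.
bézout : ∀ i j → Acc ℕ._<_ ℤ.∣ j ∣ → Bézout i j
bézout i j (acc rec) with j ℤP.≟ 0ℤ
... | yes ≡.refl = 1ℤ , 0ℤ , 1ℤ , 0ℤ ,
  solve 1 (λ i → i := (con 1ℤ :* i :+ con 0ℤ :* con 0ℤ) :* con 1ℤ) ≡.refl i ,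
  solve 1 (λ i → con 0ℤ := (con 1ℤ :* i :+ con 0ℤ :* con 0ℤ) :* con 0ℤ) ≡.refl i
  where open ℤSolver.+-*-Solver
... | no j≢0 = step (bézout j r (rec (ℤD.n%d<d i j)))
  where
  open ℤSolver.+-*-Solver
  open ≡P.≡-Reasoning
  instance
    j-nonZero : ℤ.NonZero j
    j-nonZero = ℤ.≢-nonZero j≢0
  r q : ℤ
  r = + (i ℤD.% j)
  q = i ℤD./ j
  i≡ : i ≡ r ℤ.+ q ℤ.* j
  i≡ = ℤD.a≡a%n+[a/n]*n i j
  step : Bézout j r → Bézout i j
  step (u , v , j′ , r′ , j≡ , r≡) = v , u ℤ.- v ℤ.* q , r′ ℤ.+ q ℤ.* j′ , j′ ,
    (begin
      i                                 ≡⟨ i≡ ⟩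
      r ℤ.+ q ℤ.* j                     ≡⟨ ≡.cong₂ (λ x y → x ℤ.+ q ℤ.* y) r≡ j≡ ⟩
      d ℤ.* r′ ℤ.+ q ℤ.* (d ℤ.* j′)     ≡⟨ solve 4 (λ d r q j → d :* r :+ q :* (d :* j) := d :* (r :+ q :* j))
            ≡.refl d r′ q j′ ⟩
      d ℤ.* (r′ ℤ.+ q ℤ.* j′)           ≡⟨ ≡.cong (ℤ._* (r′ ℤ.+ q ℤ.* j′)) d≡ ⟩
      _ ∎) ,
    ≡.trans j≡ (≡.cong (ℤ._* j′) d≡)
    where
    d : ℤ
    d = u ℤ.* j ℤ.+ v ℤ.* r
    d≡ : d ≡ v ℤ.* i ℤ.+ (u ℤ.- v ℤ.* q) ℤ.* j
    d≡ = ≡.trans (solve 5 (λ u v j r q → u :* j :+ v :* r := v :* (r :+ q :* j) :+ (u :- v :* q) :* j) ≡.refl u v j r q)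
      (≡.cong (λ x → v ℤ.* x ℤ.+ (u ℤ.- v ℤ.* q) ℤ.* j) (≡.sym i≡))

dot-*ˡ : ∀ {n} g (a w : Vector ℤ n) → dot (λ i → g ℤ.* a i) w ≡ g ℤ.* dot a w
dot-*ˡ {zero}  g a w = ≡.sym (ℤP.*-zeroʳ g)
dot-*ˡ {suc n} g a w = ≡.trans (≡.cong₂ ℤ._+_ (ℤP.*-assoc g (a zero) (w zero)) (dot-*ˡ g (a ∘ suc) (w ∘ suc)))
  (≡.sym (ℤP.*-distribˡ-+ g (a zero ℤ.* w zero) (dot (a ∘ suc) (w ∘ suc))))

dot-*ʳ : ∀ {n} g (a w : Vector ℤ n) → dot a (λ i → g ℤ.* w i) ≡ g ℤ.* dot a w
dot-*ʳ {zero}  g a w = ≡.sym (ℤP.*-zeroʳ g)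
dot-*ʳ {suc n} g a w = ≡.trans (≡.cong₂ ℤ._+_ (x∙yz≈y∙xz (a zero) g (w zero)) (dot-*ʳ g (a ∘ suc) (w ∘ suc)))
  (≡.sym (ℤP.*-distribˡ-+ g (a zero ℤ.* w zero) (dot (a ∘ suc) (w ∘ suc))))

dot-cong : ∀ {n} {a b : Vector ℤ n} w → (∀ i → a i ≡ b i) → dot a w ≡ dot b w
dot-cong {zero}  w a≗b = ≡.refl
dot-cong {suc n} w a≗b = ≡.cong₂ ℤ._+_ (≡.cong (ℤ._* w zero) (a≗b zero)) (dot-cong (w ∘ suc) (a≗b ∘ suc))

-- `dot a w` is a greatest common divisor of the entries of `a`, adjoined one entry at a time by
-- `bézout`.
content : ∀ {n} (a : Vector ℤ n) → Σ (Vector ℤ n) λ w → Σ (Vector ℤ n) λ a′ → ∀ i → a i ≡ dot a w ℤ.* a′ i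
content {zero}  a = (λ ()) , (λ ()) , λ ()
content {suc n} a with content (a ∘ suc)
... | w , a′ , a≡ with bézout (a zero) (dot (a ∘ suc) w) (<-wellFounded _)
...   | u , v , h , g , a₀≡ , d≡ = u ◁ (λ i → v ℤ.* w i) , h ◁ (λ i → g ℤ.* a′ i) , all
  where
  e : ℤ
  e = dot a (u ◁ (λ i → v ℤ.* w i))
  e≡ : u ℤ.* a zero ℤ.+ v ℤ.* dot (a ∘ suc) w ≡ e
  e≡ = ≡.cong₂ ℤ._+_ (ℤP.*-comm u (a zero)) (≡.sym (dot-*ʳ v (a ∘ suc) w))
  all : ∀ i → a i ≡ e ℤ.* (h ◁ (λ i → g ℤ.* a′ i)) i
  all zero    = ≡.trans a₀≡ (≡.cong (ℤ._* h) e≡)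
  all (suc i) = ≡.trans (a≡ i) (≡.trans (≡.cong (ℤ._* a′ i) (≡.trans d≡ (≡.cong (ℤ._* g) e≡))) (ℤP.*-assoc e g (a′ i)))

-- Cancelling g in g (a′ · w) = a · w = g leaves a′ · w = 1. The vector `w` becomes the direction of
-- the projection onto a hyperplane with normal `a′`.
primitive-part : ∀ {n} (a : Vector ℤ n) → ¬ (∀ i → a i ≡ 0ℤ) →
  ∃ λ g → Σ (Vector ℤ n) λ a′ → Σ (Vector ℤ n) λ w → ¬ g ≡ 0ℤ × (∀ i → a i ≡ g ℤ.* a′ i) × dot a′ w ≡ 1ℤ
primitive-part a a≢0 with content a
... | w , a′ , a≡ = g , a′ , w , g≢0 , a≡ , ℤP.*-cancelˡ-≡ g (dot a′ w) 1ℤ {{ℤ.≢-nonZero g≢0}}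
      (≡.trans (≡.sym (dot-*ˡ g a′ w)) (≡.trans (≡.sym (dot-cong w a≡)) (≡.sym (ℤP.*-identityʳ g))))
  where
  g : ℤ
  g = dot a w
  g≢0 : ¬ g ≡ 0ℤ
  g≢0 g≡0 = a≢0 λ i → ≡.trans (a≡ i) (≡.cong (ℤ._* a′ i) g≡0)

-- Right neighbourhoods of zero

module Neighbourhoods (em : ExcludedMiddle 0ℓ) (K : OrderedField) where
  open FieldProperties em K

  -- The filter of right neighbourhoods of 0, with 0 itself included. Closure under finite
  -- conjunctions spares the explicit choice of a common ε.
  Near : Pred Carrier 0ℓ → Set
  Near P = ∃ λ ε → 0# < ε × ∀ t → 0# ≤ t → t ≤ ε → P t

  near-map : ∀ {P Q : Pred Carrier 0ℓ} → (∀ t → P t → Q t) → Near P → Near Q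
  near-map f (ε , 0<ε , p) = ε , 0<ε , λ t 0≤t t≤ε → f t (p t 0≤t t≤ε)

  near-always : ∀ {P : Pred Carrier 0ℓ} → (∀ t → 0# ≤ t → P t) → Near P
  near-always p = 1# , 0<1 , λ t 0≤t _ → p t 0≤t

  opaque
    near-× : ∀ {P Q : Pred Carrier 0ℓ} → Near P → Near Q → Near (λ t → P t × Q t)
    near-× (ε , 0<ε , p) (δ , 0<δ , q) with min⁺ ε δ 0<ε 0<δ
    ... | η , 0<η , η≤ε , η≤δ = η , 0<η , λ t 0≤t t≤η → p t 0≤t (≤-trans t≤η η≤ε) , q t 0≤t (≤-trans t≤η η≤δ)

    near-All : ∀ {A : Set} {P : A → Pred Carrier 0ℓ} {xs} →
               All (λ a → Near (P a)) xs → Near (λ t → All (λ a → P a t) xs)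
    near-All []       = near-always λ _ _ → []
    near-All (p ∷ ps) = near-map (λ _ (q , qs) → q ∷ qs) (near-× p (near-All ps))

    near-Fin : ∀ {n} {P : Fin n → Pred Carrier 0ℓ} →
               (∀ i → Near (P i)) → Near (λ t → ∀ i → P i t)
    near-Fin {zero}  p = near-always λ _ _ ()
    near-Fin {suc n} p = near-map (λ _ (q , qs) → λ { zero → q ; (suc i) → qs i })
      (near-× (p zero) (near-Fin (p ∘ suc)))

    near-pos : ∀ {a} b → 0# < a → Near (λ t → 0# < a + t * b)
    near-pos {a} b 0<a with half a 0<a
    ... | h , 0<h , hh≈a with ≤⊎> 0# b
    ...   | inj₁ 0≤b = near-always λ t 0≤t → pos-+ 0<a (0≤t ⊗ 0≤b)
    ...   | inj₂ b<0 with small (- b) h 0<h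
    ...     | ε , 0<ε , εb≤h = ε , 0<ε , λ t 0≤t t≤ε → <-respʳ
      (trans (solve 4 (λ h ε b t → h :+ ((h :- ε :* :- b) :+ (ε :- t) :* :- b) := (h :+ h) :+ t :* b)
            refl h ε b t) (+-congʳ hh≈a))
      (pos-+ 0<h (gap εb≤h ⊕ gap t≤ε ⊗ neg≥0 (<⇒≤ b<0)))

  near-nonneg : ∀ {a} b → 0# < a → Near (λ t → 0# ≤ a + t * b)
  near-nonneg b 0<a = near-map (λ _ → <⇒≤) (near-pos b 0<a)

  near-witness : ∀ {P : Pred Carrier 0ℓ} → Near P → ∃ λ t → 0# < t × P t
  near-witness (ε , 0<ε , p) = ε , 0<ε , p ε (<⇒≤ 0<ε) ≤-refl

  near-≤ : ∀ {a} → 0# < a → Near (_≤ a)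
  near-≤ {a} 0<a = a , 0<a , λ t _ t≤a → t≤a

-- Affine functionals, boxes and polyhedra

module Functionals (em : ExcludedMiddle 0ℓ) (K : OrderedField) where
  open FieldProperties em K public
  open Neighbourhoods em K public
  open MonoidSum +-commutativeMonoid using (sum-cong-≋; sum-replicate-zero; ∑-distrib-+)
  open SemiringSum semiring using (*-distribˡ-sum)
  open import Relation.Binary.Reasoning.Setoid setoid

  Point : ℕ → Set
  Point n = Vector Carrier n

  -- The constant is any field element; over the subfield F this is precisely F-integrality.
  record Aff (n : ℕ) : Set where
    constructor aff
    field
      coeff : Vector ℤ n
      const : Carrier
  open Aff public

  ι : ∀ {n} → Vector ℤ n → Point n
  ι v i = fromℤ (v i)

  opaque
    lin : ∀ {n} → Aff n → Point n → Carrier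
    lin l x = sum (λ i → fromℤ (coeff l i) * x i)

  eval : ∀ {n} → Aff n → Point n → Carrier
  eval l x = lin l x + const l

  infix 4 _≋_
  _≋_ : ∀ {n} → Point n → Point n → Set
  x ≋ y = ∀ i → x i ≈ y i

  infixl 6 _+[_]_
  _+[_]_ : ∀ {n} → Point n → Carrier → Point n → Point n
  (x +[ t ] u) i = x i + t * u i

  comb : ∀ {n} → Carrier → Point n → Carrier → Point n → Point n
  comb α x β y i = α * x i + β * y i

  infixl 6 _⊝_
  _⊝_ : ∀ {n} → Point n → Point n → Point n
  (x ⊝ y) i = x i - y i

  opaque
    unfolding lin

    lin-cong : ∀ {n} (l : Aff n) {x y} → x ≋ y → lin l x ≈ lin l y
    lin-cong l x≋y = sum-cong-≋ (λ i → *-congˡ (x≋y i))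

    lin-comb : ∀ {n} (l : Aff n) α x β y → lin l (comb α x β y) ≈ α * lin l x + β * lin l y
    lin-comb {n} l α x β y = begin
      sum (λ i → a i * (α * x i + β * y i))
        ≈⟨ sum-cong-≋ (λ i → solve 5 (λ a α x β y → a :* (α :* x :+ β :* y) := α :* (a :* x) :+ β :* (a :* y))
              refl (a i) α (x i) β (y i)) ⟩
      sum (λ i → α * (a i * x i) + β * (a i * y i))
        ≈⟨ ∑-distrib-+ (λ i → α * (a i * x i)) (λ i → β * (a i * y i)) ⟩
      sum (λ i → α * (a i * x i)) + sum (λ i → β * (a i * y i))
        ≈⟨ +-cong (*-distribˡ-sum α (λ i → a i * x i)) (*-distribˡ-sum β (λ i → a i * y i)) ⟨
      α * lin l x + β * lin l y ∎
      where
      a : Vector Carrier n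
      a i = fromℤ (coeff l i)

    lin-coeff-+ : ∀ {n} (l : Aff n) p a q b c x →
      (∀ i → fromℤ (coeff l i) ≈ p * fromℤ (a i) + q * fromℤ (b i)) →
      lin l x ≈ p * lin (aff a c) x + q * lin (aff b c) x
    lin-coeff-+ l p a q b c x eq = begin
      sum (λ i → fromℤ (coeff l i) * x i)
        ≈⟨ sum-cong-≋ (λ i → trans (*-congʳ (eq i))
              (solve 5 (λ a p x q b → (p :* a :+ q :* b) :* x := p :* (a :* x) :+ q :* (b :* x))
              refl (fromℤ (a i)) p (x i) q (fromℤ (b i)))) ⟩
      sum (λ i → p * (fromℤ (a i) * x i) + q * (fromℤ (b i) * x i))
        ≈⟨ ∑-distrib-+ (λ i → p * (fromℤ (a i) * x i)) (λ i → q * (fromℤ (b i) * x i)) ⟩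
      sum (λ i → p * (fromℤ (a i) * x i)) + sum (λ i → q * (fromℤ (b i) * x i))
        ≈⟨ +-cong (*-distribˡ-sum p (λ i → fromℤ (a i) * x i)) (*-distribˡ-sum q (λ i → fromℤ (b i) * x i)) ⟨
      p * lin (aff a c) x + q * lin (aff b c) x ∎

    lin-0 : ∀ {n} (l : Aff n) x → (∀ i → coeff l i ≡ 0ℤ) → lin l x ≈ 0#
    lin-0 l x h = trans (lin-coeff-+ l 0# (coeff l) 0# (coeff l) 0# x
        (λ i → trans (reflexive (≡.cong fromℤ (h i))) (solve 1 (λ a → :0 := :0 :* a :+ :0 :* a)
              refl (fromℤ (coeff l i)))))
      (solve 2 (λ a b → :0 :* a :+ :0 :* b := :0) refl (lin (aff (coeff l) 0#) x) (lin (aff (coeff l) 0#) x))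

    eval-const : ∀ {n} (a : Vector ℤ n) c x → eval (aff a c) x ≈ eval (aff a 0#) x + c
    eval-const a c x = solve 2 (λ L c → L :+ c := L :+ :0 :+ c) refl (lin (aff a 0#) x) c

    lin-coeff-cong : ∀ {n} {l m : Aff n} x → (∀ i → coeff l i ≡ coeff m i) → lin l x ≈ lin m x
    lin-coeff-cong x eq = sum-cong-≋ (λ i → *-congʳ (reflexive (≡.cong fromℤ (eq i))))

    lin-const : ∀ {n} (a : Vector ℤ n) c d x → lin (aff a c) x ≈ lin (aff a d) x
    lin-const a c d x = refl

    fromℤ-dot : ∀ {n} a c (v : Vector ℤ n) → fromℤ (dot a v) ≈ lin (aff a c) (ι v)
    fromℤ-dot {zero}  a c v = refl
    fromℤ-dot {suc n} a c v = trans (fromℤ-+ (a zero ℤ.* v zero) _)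
      (+-cong (fromℤ-* (a zero) (v zero)) (fromℤ-dot (a ∘ suc) c (v ∘ suc)))

    lin-coordinate : ∀ {n} (j : Fin n) c x → lin (aff (unit j) c) x ≈ x j
    lin-coordinate {suc n} zero    c x = trans (+-cong (trans (*-congʳ fromℤ-1) (*-identityˡ _))
      (trans (sum-cong-≋ {n} (λ i → zeroˡ (x (suc i)))) (sum-replicate-zero n))) (+-identityʳ _)
    lin-coordinate {suc n} (suc j) c x = trans (+-cong (zeroˡ _) (lin-coordinate j c (x ∘ suc))) (+-identityˡ _)

  opaque
    eval-cong : ∀ {n} (l : Aff n) {x y} → x ≋ y → eval l x ≈ eval l y
    eval-cong l x≋y = +-congʳ (lin-cong l x≋y)

    move-zero : ∀ {n} (x : Point n) u → x ≋ x +[ 0# ] u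
    move-zero x u i = solve 2 (λ x u → x := x :+ :0 :* u) refl (x i) (u i)

    lin-move : ∀ {n} (l : Aff n) x t u → lin l (x +[ t ] u) ≈ lin l x + t * lin l u
    lin-move l x t u = begin
      lin l (x +[ t ] u)            ≈⟨ lin-cong l (λ i → +-congʳ (*-identityˡ (x i))) ⟨
      lin l (comb 1# x t u)         ≈⟨ lin-comb l 1# x t u ⟩
      1# * lin l x + t * lin l u    ≈⟨ +-congʳ (*-identityˡ _) ⟩
      lin l x + t * lin l u         ∎

    eval-move : ∀ {n} (l : Aff n) x t u → eval l (x +[ t ] u) ≈ eval l x + t * lin l u
    eval-move l x t u = trans (+-congʳ (lin-move l x t u))
      (solve 3 (λ a b c → a :+ b :+ c := a :+ c :+ b) refl (lin l x) (t * lin l u) (const l))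

    eval-comb : ∀ {n} (l : Aff n) α x β y → α + β ≈ 1# → eval l (comb α x β y) ≈ α * eval l x + β * eval l y
    eval-comb l α x β y α+β≈1 = begin
      lin l (comb α x β y) + c                      ≈⟨ +-cong (lin-comb l α x β y) (sym (*-identityˡ c)) ⟩
      α * lin l x + β * lin l y + 1# * c            ≈⟨ +-congˡ (*-congʳ α+β≈1) ⟨
      α * lin l x + β * lin l y + (α + β) * c       ≈⟨ solve 5 (λ α β a b c → α :* a :+ β :* b :+ (α :+ β) :* c
            := α :* (a :+ c) :+ β :* (b :+ c)) refl α β (lin l x) (lin l y) c ⟩
      α * eval l x + β * eval l y                   ∎
      where
      c : Carrier
      c = const l

    lin-⊝ : ∀ {n} (l : Aff n) x y → lin l (x ⊝ y) ≈ eval l x - eval l y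
    lin-⊝ l x y = begin
      lin l (x ⊝ y)               ≈⟨ lin-cong l (λ i → solve 2 (λ x y → x :- y := x :+ :- :1 :* y) refl (x i) (y i)) ⟩
      lin l (x +[ - 1# ] y)       ≈⟨ lin-move l x (- 1#) y ⟩
      lin l x + - 1# * lin l y    ≈⟨ solve 3 (λ a b c → a :+ :- :1 :* b := (a :+ c) :- (b :+ c))
            refl (lin l x) (lin l y) (const l) ⟩
      eval l x - eval l y         ∎

    lin-unit : ∀ {n} (l : Aff n) i → lin l (ι (unit i)) ≈ fromℤ (coeff l i)
    lin-unit l i = trans (sym (fromℤ-dot (coeff l) (const l) (unit i)))
          (reflexive (≡.cong fromℤ (dot-unit (coeff l) i)))

    lin-neg : ∀ {n} (l : Aff n) v → lin l (ι (ℤ.-_ ∘ v)) ≈ - lin l (ι v)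
    lin-neg l v = begin
      lin l (ι (ℤ.-_ ∘ v))                  ≈⟨ lin-cong l
            (λ i → trans (fromℤ-neg (v i)) (solve 1 (λ x → :- x := :- :1 :* x :+ :0 :* x) refl (fromℤ (v i)))) ⟩
      lin l (comb (- 1#) (ι v) 0# (ι v))    ≈⟨ lin-comb l (- 1#) (ι v) 0# (ι v) ⟩
      - 1# * lin l (ι v) + 0# * lin l (ι v) ≈⟨ solve 1 (λ x → :- :1 :* x :+ :0 :* x := :- x) refl (lin l (ι v)) ⟩
      - lin l (ι v)                         ∎

  affComb : ∀ {n} → ℤ → Aff n → ℤ → Aff n → Aff n
  affComb p l q m = aff (λ i → p ℤ.* coeff l i ℤ.+ q ℤ.* coeff m i) (fromℤ p * const l + fromℤ q * const m)

  opaque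
    lin-affComb : ∀ {n} p (l : Aff n) q m x → lin (affComb p l q m) x ≈ fromℤ p * lin l x + fromℤ q * lin m x
    lin-affComb p l q m x = trans (lin-coeff-+ (affComb p l q m) (fromℤ p) (coeff l) (fromℤ q) (coeff m) (const l) x
        (λ i → trans (fromℤ-+ (p ℤ.* coeff l i) (q ℤ.* coeff m i))
              (+-cong (fromℤ-* p (coeff l i)) (fromℤ-* q (coeff m i)))))
      (+-congˡ (*-congˡ (lin-const (coeff m) (const l) (const m) x)))

  opaque
    eval-affComb : ∀ {n} p (l : Aff n) q m x → eval (affComb p l q m) x ≈ fromℤ p * eval l x + fromℤ q * eval m x
    eval-affComb p l q m x = trans (+-congʳ (lin-affComb p l q m x))
      (solve 6 (λ p L c q M d → p :* L :+ q :* M :+ (p :* c :+ q :* d) := p :* (L :+ c) :+ q :* (M :+ d)) refl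
        (fromℤ p) (lin l x) (const l) (fromℤ q) (lin m x) (const m))

  minus : ∀ {n} → Aff n → Aff n → Aff n
  minus l m = affComb 1ℤ l (ℤ.- 1ℤ) m

  opaque
    eval-minus : ∀ {n} (l m : Aff n) x → eval (minus l m) x ≈ eval l x - eval m x
    eval-minus l m x = trans (eval-affComb 1ℤ l (ℤ.- 1ℤ) m x)
      (trans (+-cong (*-congʳ fromℤ-1) (*-congʳ (-‿cong fromℤ-1)))
            (solve 2 (λ l m → :1 :* l :+ :- :1 :* m := l :- m) refl (eval l x) (eval m x)))

  -- The closed ball of the supremum norm.
  Box : ∀ {n} → Point n → Carrier → Pred (Point n) 0ℓ
  Box x r y = ∀ i → x i - r ≤ y i × y i ≤ x i + r

  opaque
    box-centre : ∀ {n} {x : Point n} {r} → 0# ≤ r → Box x r x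
    box-centre {x = x} {r} 0≤r i = ≤-by 0≤r (solve 2 (λ x r → x :- (x :- r) := r) refl (x i) r) ,
      ≤-by 0≤r (solve 2 (λ x r → (x :+ r) :- x := r) refl (x i) r)

    box-mono : ∀ {n} {x y : Point n} {r s} → r ≤ s → Box x r y → Box x s y
    box-mono {x = x} {y} {r} {s} r≤s b i =
      ≤-by (gap (proj₁ (b i)) ⊕ gap r≤s) (solve 4 (λ x y r s → y :- (x :- s) := (y :- (x :- r)) :+ (s :- r))
            refl (x i) (y i) r s) ,
      ≤-by (gap (proj₂ (b i)) ⊕ gap r≤s) (solve 4 (λ x y r s → (x :+ s) :- y := ((x :+ r) :- y) :+ (s :- r))
            refl (x i) (y i) r s)

    box-trans : ∀ {n} {x y z : Point n} {r s} → Box x r y → Box y s z → Box x (r + s) z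
    box-trans {x = x} {y} {z} {r} {s} b c i =
      ≤-by (gap (proj₁ (b i)) ⊕ gap (proj₁ (c i)))
            (solve 5 (λ x y z r s → z :- (x :- (r :+ s)) := (y :- (x :- r)) :+ (z :- (y :- s)))
            refl (x i) (y i) (z i) r s) ,
      ≤-by (gap (proj₂ (b i)) ⊕ gap (proj₂ (c i)))
            (solve 5 (λ x y z r s → (x :+ (r :+ s)) :- z := ((x :+ r) :- y) :+ ((y :+ s) :- z))
            refl (x i) (y i) (z i) r s)

    -- `C` is the ℓ¹ norm of `a`, dual to the supremum norm of the boxes; the split on the sign of
    -- `a zero` supplies its absolute value.
    sum-lipschitz : ∀ {n} (a : Vector Carrier n) → ∃ λ C → 0# ≤ C × ∀ {x y r} → Box x r y →
                    sum (λ i → a i * x i) ≤ sum (λ i → a i * y i) + C * r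
    sum-lipschitz {zero}  a = 0# , ≤-refl , λ {x} {y} {r} _ → ≤-reflexive (solve 1 (λ r → :0 := :0 :+ :0 :* r) refl r)
    sum-lipschitz {suc n} a with sum-lipschitz (a ∘ suc) | ≤-total 0# (a zero)
    ... | C , 0≤C , h | inj₁ 0≤a = a zero + C , 0≤a ⊕ 0≤C , λ {x} {y} {r} b →
      ≤-by (0≤a ⊗ gap (proj₁ (b zero)) ⊕ gap (h (b ∘ suc)))
        (solve 7 (λ a x y C r s t → (a :* y :+ t :+ (a :+ C) :* r) :- (a :* x :+ s) := a :* (y :- (x :- r)) :+
              (t :+ C :* r :- s)) refl
          (a zero) (x zero) (y zero) C r (sum (λ i → a (suc i) * x (suc i))) (sum (λ i → a (suc i) * y (suc i))))
    ... | C , 0≤C , h | inj₂ a≤0 = - a zero + C , neg≥0 a≤0 ⊕ 0≤C , λ {x} {y} {r} b →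
      ≤-by (neg≥0 a≤0 ⊗ gap (proj₂ (b zero)) ⊕ gap (h (b ∘ suc)))
        (solve 7 (λ a x y C r s t → (a :* y :+ t :+ (:- a :+ C) :* r) :- (a :* x :+ s)
              := :- a :* ((x :+ r) :- y) :+ (t :+ C :* r :- s)) refl
          (a zero) (x zero) (y zero) C r (sum (λ i → a (suc i) * x (suc i))) (sum (λ i → a (suc i) * y (suc i))))

  opaque
    unfolding lin

    eval-lipschitz : ∀ {n} (l : Aff n) → ∃ λ C → 0# ≤ C × ∀ {x y r} → Box x r y → eval l x ≤ eval l y + C * r
    eval-lipschitz l with sum-lipschitz (λ i → fromℤ (coeff l i))
    ... | C , 0≤C , h = C , 0≤C , λ {x} {y} {r} b → ≤-by (gap (h b))
      (solve 4 (λ s t c r → (t :+ c :+ r) :- (s :+ c) := t :+ r :- s) refl (lin l x) (lin l y) (const l) (C * r))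

  opaque
    near-box-pos : ∀ {n} (l : Aff n) x → 0# < eval l x → Near (λ r → ∀ y → Box x r y → 0# < eval l y)
    near-box-pos l x 0<lx with eval-lipschitz l
    ... | C , 0≤C , h = near-map (λ r p y b q → p (≤-trans (≤-by (gap (h b))
      (solve 4 (λ x y C r → y :- (x :+ r :* :- C) := y :+ C :* r :- x) refl (eval l x) (eval l y) C r)) q))
            (near-pos (- C) 0<lx)

  -- `Str` is the open part in which no constraint is tight. It may be empty, and constraints may be
  -- constant, as happens after pulling back along the projection of a face.
  InS Str : ∀ {n} → List (Aff n) → Pred (Point n) 0ℓ
  InS μs x = All (λ μ → 0# ≤ eval μ x) μs
  Str μs x = All (λ μ → 0# < eval μ x) μs

  opaque
    inS-cong : ∀ {n} {μs : List (Aff n)} {x y} → x ≋ y → InS μs x → InS μs y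
    inS-cong x≋y = All.map λ {μ} → ≤-respʳ (eval-cong μ x≋y)

    str-cong : ∀ {n} {μs : List (Aff n)} {x y} → x ≋ y → Str μs x → Str μs y
    str-cong x≋y = All.map λ {μ} → <-respʳ (eval-cong μ x≋y)

    str⇒inS : ∀ {n} {μs : List (Aff n)} {x} → Str μs x → InS μs x
    str⇒inS = All.map <⇒≤

    inS-comb : ∀ {n} {μs : List (Aff n)} {α β x y} → 0# ≤ α → 0# ≤ β → α + β ≈ 1# →
               InS μs x → InS μs y → InS μs (comb α x β y)
    inS-comb _ _ _ [] [] = []
    inS-comb {μs = μ ∷ μs} {α} {β} {x} {y} 0≤α 0≤β e (p ∷ ps) (q ∷ qs) =
      ≤-respʳ (sym (eval-comb μ α x β y e)) (0≤α ⊗ p ⊕ 0≤β ⊗ q) ∷ inS-comb 0≤α 0≤β e ps qs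

    str-comb : ∀ {n} {μs : List (Aff n)} {α β x y} → 0# ≤ α → 0# < β → α + β ≈ 1# →
               InS μs x → Str μs y → Str μs (comb α x β y)
    str-comb _ _ _ [] [] = []
    str-comb {μs = μ ∷ μs} {α} {β} {x} {y} 0≤α 0<β e (p ∷ ps) (q ∷ qs) =
      <-respʳ (sym (eval-comb μ α x β y e)) (<-respʳ (+-comm _ _) (pos-+ (pos-* 0<β q) (0≤α ⊗ p))) ∷ str-comb
            0≤α 0<β e ps qs

    near-str : ∀ {n} {μs : List (Aff n)} x → Str μs x → Near (λ r → ∀ y → Box x r y → Str μs y)
    near-str x s = near-map (λ r p y b → All.map (λ q → q y b) p) (near-All (All.map (λ {μ} → near-box-pos μ x) s))

  halves : ∃ λ h → 0# < h × h + h ≈ 1#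
  halves = half 1# 0<1

  opaque
    -- A constraint that is positive somewhere on `R` becomes positive after passing to a midpoint
    -- with such a point, and this keeps positive the constraints that already were. The remaining
    -- ones vanish on `R`.
    relative-interior-point : ∀ {n} (R : Pred (Point n) 0ℓ) →
      (∀ {h x y} → 0# ≤ h → h + h ≈ 1# → R x → R y → R (comb h x h y)) → ∃ R →
      (ψs : List (Aff n)) → (∀ x → R x → InS ψs x) →
      ∃ λ x → R x × All (λ ψ → 0# < eval ψ x ⊎ (∀ y → R y → eval ψ y ≈ 0#)) ψs
    relative-interior-point R mid (x₀ , r₀) []       _   = x₀ , r₀ , []
    relative-interior-point {n} R mid inh   (ψ ∷ ψs) R⊆ψ
      with relative-interior-point R mid inh ψs (λ x r → All.tail (R⊆ψ x r)) | em {∃ λ y → R y × 0# < eval ψ y}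
    ... | x , r , ps | no ¬∃ = x , r , inj₂ (λ y ry → ≤-antisym
            (positive-part y ry) (All.head (R⊆ψ y ry))) ∷ ps
      where
      positive-part : ∀ y → R y → eval ψ y ≤ 0#
      positive-part y ry with ≤⊎> (eval ψ y) 0#
      ... | inj₁ p = p
      ... | inj₂ p = ⊥-elim (¬∃ (y , ry , p))
    ... | x , r , ps | yes (y , ry , 0<ψy) with halves
    ...   | h , 0<h , hh = z , mid (<⇒≤ 0<h) hh r ry ,
            inj₁ (<-respʳ (trans (+-comm _ _) (sym (eval-comb ψ h x h y hh)))
              (pos-+ (pos-* 0<h 0<ψy) (<⇒≤ 0<h ⊗ All.head (R⊆ψ x r)))) ∷
            All.zipWith (λ {φ} (p , q) → improve φ p q) (ps , All.tail (R⊆ψ y ry))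
      where
      z : Point n
      z = comb h x h y
      improve : ∀ φ → 0# < eval φ x ⊎ (∀ y → R y → eval φ y ≈ 0#) → 0# ≤ eval φ y →
                0# < eval φ z ⊎ (∀ y → R y → eval φ y ≈ 0#)
      improve φ (inj₁ p) q = inj₁ (<-respʳ (sym (eval-comb φ h x h y hh)) (pos-+ (pos-* 0<h p) (<⇒≤ 0<h ⊗ q)))
      improve φ (inj₂ p) q = inj₂ p

    -- A segment ending at a relative interior point can be prolonged a little: positive constraints
    -- survive by openness, and the others are zero along the whole line through `x` and `y`.
    extend-beyond : ∀ {n} (ψs : List (Aff n)) {x} y → InS ψs x → InS ψs y →
      All (λ ψ → 0# < eval ψ x ⊎ (∀ y → InS ψs y → eval ψ y ≈ 0#)) ψs →
      Near (λ r → InS ψs (x +[ r ] (x ⊝ y)))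
    extend-beyond ψs {x} y x∈ y∈ ps = near-All (All.map (λ {ψ} → each ψ) ps)
      where
      each : ∀ ψ → 0# < eval ψ x ⊎ (∀ y → InS ψs y → eval ψ y ≈ 0#) → Near (λ r → 0# ≤ eval ψ (x +[ r ] (x ⊝ y)))
      each ψ (inj₁ p) = near-map (λ r → ≤-respʳ (sym (eval-move ψ x r (x ⊝ y)))) (near-nonneg (lin ψ (x ⊝ y)) p)
      each ψ (inj₂ p) = near-always λ r _ → ≤-reflexive (sym (begin
        eval ψ (x +[ r ] (x ⊝ y))           ≈⟨ eval-move ψ x r (x ⊝ y) ⟩
        eval ψ x + r * lin ψ (x ⊝ y)        ≈⟨ +-cong (p x x∈)
              (*-congˡ (trans (lin-⊝ ψ x y) (+-cong (p x x∈) (-‿cong (p y y∈))))) ⟩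
        0# + r * (0# - 0#)                  ≈⟨ solve 1 (λ r → :0 :+ r :* (:0 :- :0) := :0) refl r ⟩
        0#                                  ∎))

    -- If `u` is not a recession direction, `s` is the least of the times `eval μ x` / (- `lin μ u`)
    -- at which a decreasing constraint reaches zero.
    exit-point : ∀ {n} (μs : List (Aff n)) {x} u → Str μs x →
      All (λ μ → 0# ≤ lin μ u) μs ⊎
      ∃ λ s → 0# < s × InS μs (x +[ s ] u) × Any (λ μ → eval μ (x +[ s ] u) ≈ 0#) μs
    exit-point []       u []       = inj₁ []
    exit-point (μ ∷ μs) {x} u (p ∷ ps) with exit-point μs u ps | ≤⊎> 0# (lin μ u)
    ... | inj₁ all                  | inj₁ 0≤μu = inj₁ (0≤μu ∷ all)
    ... | inj₂ (s , 0<s , ins , any) | inj₁ 0≤μu = inj₂ (s , 0<s ,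
          ≤-respʳ (sym (eval-move μ x s u)) (<⇒≤ p ⊕ <⇒≤ 0<s ⊗ 0≤μu) ∷ ins , there any)
    ... | rest | inj₂ μu<0 with recip (- lin μ u) (<-respʳ (+-identityˡ _) (0<gap μu<0))
    ...   | c , 0<c , Lc≈1 = combine rest
      where
      s : Carrier
      s = eval μ x * c
      0<s : 0# < s
      0<s = pos-* p 0<c
      hit : eval μ (x +[ s ] u) ≈ 0#
      hit = begin
        eval μ (x +[ s ] u)                              ≈⟨ eval-move μ x s u ⟩
        eval μ x + eval μ x * c * lin μ u                ≈⟨ solve 3 (λ e c L → e :+ e :* c :* L
              := e :* (:1 :- :- L :* c)) refl (eval μ x) c (lin μ u) ⟩
        eval μ x * (1# - - lin μ u * c)                  ≈⟨ *-congˡ (+-congˡ (-‿cong Lc≈1)) ⟩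
        eval μ x * (1# - 1#)                             ≈⟨ solve 1 (λ e → e :* (:1 :- :1) := :0) refl (eval μ x) ⟩
        0#                                               ∎
      between : ∀ {s t} φ → 0# ≤ s → s ≤ t → 0# < eval φ x → 0# ≤ eval φ (x +[ t ] u) → 0# ≤ eval φ (x +[ s ] u)
      between {s} {t} φ 0≤s s≤t q r with ≤-total 0# (lin φ u)
      ... | inj₁ 0≤φu = ≤-respʳ (sym (eval-move φ x s u)) (<⇒≤ q ⊕ 0≤s ⊗ 0≤φu)
      ... | inj₂ φu≤0 = ≤-by (≤-respʳ (eval-move φ x t u) r ⊕ gap s≤t ⊗ neg≥0 φu≤0)
            (trans (+-congʳ (eval-move φ x s u))
                  (solve 4 (λ e s t L → e :+ s :* L :- :0 := e :+ t :* L :+ (t :- s) :* :- L)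
                  refl (eval φ x) s t (lin φ u)))
      combine : All (λ μ → 0# ≤ lin μ u) μs ⊎
        (∃ λ s → 0# < s × InS μs (x +[ s ] u) × Any (λ μ → eval μ (x +[ s ] u) ≈ 0#) μs) →
        All (λ μ → 0# ≤ lin μ u) (μ ∷ μs) ⊎
        ∃ λ s → 0# < s × InS (μ ∷ μs) (x +[ s ] u) × Any (λ μ → eval μ (x +[ s ] u) ≈ 0#) (μ ∷ μs)
      combine (inj₁ all) = inj₂ (s , 0<s , ≤-reflexive (sym hit) ∷
        All.zipWith (λ {φ} (q , r) → ≤-respʳ (sym (eval-move φ x s u)) (<⇒≤ q ⊕ <⇒≤ 0<s ⊗ r)) (ps , all) , here hit)
      combine (inj₂ (t , 0<t , ins , any)) with ≤-total s t
      ... | inj₁ s≤t = inj₂ (s , 0<s , ≤-reflexive (sym hit) ∷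
            All.zipWith (λ {φ} (q , r) → between φ (<⇒≤ 0<s) s≤t q r) (ps , ins) , here hit)
      ... | inj₂ t≤s = inj₂ (t , 0<t , between μ (<⇒≤ 0<t) t≤s p (≤-reflexive (sym hit)) ∷ ins , there any)

-- Polyhedral functions and integral directions

module PolyhedralFunctions (em : ExcludedMiddle 0ℓ) (K : ArchimedeanField) where
  open ArchimedeanFieldProperties em K public
  open Functionals em orderedField public

  Respects : ∀ {n} → (Point n → Carrier) → Set
  Respects f = ∀ {x y} → x ≋ y → f x ≈ f y

  PolyOn : ∀ {n} → (Point n → Carrier) → Pred (Point n) 0ℓ → Set
  PolyOn {n} f T = Σ (List (Aff n)) λ ls → ∀ x → T x →
    All (λ l → eval l x ≤ f x) ls × Any (λ l → f x ≈ eval l x) ls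

  -- The zero direction is allowed, since projecting a line onto a hyperplane can collapse it to a
  -- point.
  LineHyp : ∀ {n} → (Point n → Carrier) → List (Aff n) → Set
  LineHyp f μs = ∀ p → InS μs p → ∀ v → PolyOn f (λ x → InS μs x × ∃ λ t → x ≋ p +[ t ] ι v)

  greatest : ∀ {A : Set} (g : A → Carrier) {P : Pred A 0ℓ} xs → Any P xs →
             ∃ λ a → a ∈ xs × P a × All (λ b → P b → g b ≤ g a) xs
  greatest g {P} (x ∷ xs) any with em {Any P xs}
  greatest g {P} (x ∷ xs) (here px) | no ¬any = x , here ≡.refl , px , (λ _ → ≤-refl) ∷ All.tabulate λ b∈ pb →
        ⊥-elim (¬any (lose b∈ pb))
  greatest g {P} (x ∷ xs) (there any) | no ¬any = ⊥-elim (¬any any)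
  ... | yes any′ with greatest g xs any′ | em {P x}
  ...   | a , a∈ , pa , max | no ¬px = a , there a∈ , pa , (λ px → ⊥-elim (¬px px)) ∷ max
  ...   | a , a∈ , pa , max | yes px with ≤-total (g x) (g a)
  ...     | inj₁ gx≤ga = a , there a∈ , pa , (λ _ → gx≤ga) ∷ max
  ...     | inj₂ ga≤gx = x , here ≡.refl , px , (λ _ → ≤-refl) ∷ All.map (λ h pb → ≤-trans (h pb) ga≤gx) max

  bound-All : ∀ {A : Set} (Q : A → Pred Carrier 0ℓ) → (∀ {a c d} → c ≤ d → Q a c → Q a d) →
              ∀ {xs} → All (λ a → ∃ (Q a)) xs → ∃ λ C → 0# ≤ C × All (λ a → Q a C) xs
  bound-All Q up []              = 0# , ≤-refl , []
  bound-All Q up ((c , qc) ∷ qs) with bound-All Q up qs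
  ... | d , 0≤d , qd with upper c d
  ...   | m , c≤m , d≤m = m , ≤-trans 0≤d d≤m , up c≤m qc ∷ All.map (up d≤m) qd

  -- Phrased as a move along a unit vector, so that the line hypothesis applies to a change of one
  -- coordinate.
  setTo : ∀ {n} → Point n → Fin n → Carrier → Point n
  setTo x i a = x +[ a - x i ] ι (unit i)

  opaque
    unfolding lin

    move-same : ∀ {n} (x : Point n) i t → (x +[ t ] ι (unit i)) i ≈ x i + t
    move-same x i t = +-congˡ (trans (*-congˡ (trans (reflexive (≡.cong fromℤ (unit-same i))) fromℤ-1)) (*-identityʳ t))

    move-other : ∀ {n} (x : Point n) {i j} t → ¬ i ≡ j → (x +[ t ] ι (unit i)) j ≈ x j
    move-other x {i} {j} t i≢j = trans
          (+-congˡ (trans (*-congˡ (reflexive (≡.cong fromℤ (unit-other i≢j)))) (zeroʳ t))) (+-identityʳ (x j))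

  opaque
    set-same : ∀ {n} (x : Point n) i a → setTo x i a i ≈ a
    set-same x i a = trans (move-same x i (a - x i)) (solve 2 (λ x a → x :+ (a :- x) := a) refl (x i) a)

    set-other : ∀ {n} (x : Point n) {i j} a → ¬ i ≡ j → setTo x i a j ≈ x j
    set-other x {i} a = move-other x (a - x i)

    box-set : ∀ {n} {c x : Point n} {r} i a → Box c r x → c i - r ≤ a → a ≤ c i + r → Box c r (setTo x i a)
    box-set {x = x} i a b lo hi j with i FinP.≟ j
    ... | yes ≡.refl = ≤-respʳ (sym (set-same x i a)) lo , ≤-respˡ (sym (set-same x i a)) hi
    ... | no i≢j     = ≤-respʳ (sym (set-other x a i≢j)) (proj₁ (b j)) , ≤-respˡ (sym (set-other x a i≢j)) (proj₂ (b j))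

    near-box-move : ∀ {n} (x u : Point n) {r} → 0# < r → Near (λ t → Box x r (x +[ t ] u) × Box x r (x +[ - t ] u))
    near-box-move x u {r} 0<r = near-map (λ t h → (λ i → proj₁ (h i) , proj₁ (proj₂ (h i))) ,
          (λ i → proj₁ (proj₂ (proj₂ (h i))) , proj₂ (proj₂ (proj₂ (h i)))))
      (near-Fin λ i → near-× (near-map
            (λ t h → ≤-by h (solve 4 (λ x u r t → (x :+ t :* u) :- (x :- r) := r :+ t :* u)
            refl (x i) (u i) r t)) (near-nonneg (u i) 0<r))
        (near-× (near-map (λ t h → ≤-by h (solve 4 (λ x u r t → (x :+ r) :- (x :+ t :* u) := r :+ t :* :- u)
              refl (x i) (u i) r t)) (near-nonneg (- u i) 0<r))
        (near-× (near-map (λ t h → ≤-by h (solve 4 (λ x u r t → (x :+ :- t :* u) :- (x :- r) := r :+ t :* :- u)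
              refl (x i) (u i) r t)) (near-nonneg (- u i) 0<r))
         (near-map (λ t h → ≤-by h (solve 4 (λ x u r t → (x :+ r) :- (x :+ :- t :* u) := r :+ t :* u)
               refl (x i) (u i) r t)) (near-nonneg (u i) 0<r)))))

    -- Take t = r and let `v` be the coordinatewise floor of (p - y)/r; the rounding displaces each
    -- coordinate by at most `r`.
    integral-direction : ∀ {n} (y p : Point n) {r} → 0# < r → ∃₂ λ v t → 0# < t × Box p r (y +[ t ] ι v)
    integral-direction {n} y p {r} 0<r with recip r 0<r
    ... | c , 0<c , rc≈1 = v , r , 0<r , λ i →
        ≤-by (<⇒≤ 0<r ⊗ gap (proj₂ (proj₂ (fl i)))) (begin
          y i + r * fromℤ (v i) - (p i - r)                                 ≈⟨
                solve 4 (λ y p r v → y :+ r :* v :- (p :- r) := (r :* v :+ r) :- :1 :* (p :- y))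
                refl (y i) (p i) r (fromℤ (v i)) ⟩
          r * fromℤ (v i) + r - 1# * (p i - y i)                            ≈⟨ +-congˡ (-‿cong (*-congʳ rc≈1)) ⟨
          r * fromℤ (v i) + r - r * c * (p i - y i)                         ≈⟨
                solve 5 (λ y p r c v → (r :* v :+ r) :- r :* c :* (p :- y) := r :* ((v :+ :1) :- c :* (p :- y)))
                refl (y i) (p i) r c (fromℤ (v i)) ⟩
          r * (fromℤ (v i) + 1# - c * (p i - y i))                          ∎) ,
        ≤-by (<⇒≤ 0<r ⊗ gap (proj₁ (proj₂ (fl i))) ⊕ <⇒≤ 0<r) (begin
          p i + r - (y i + r * fromℤ (v i))                                 ≈⟨
                solve 4 (λ y p r v → p :+ r :- (y :+ r :* v) := (:1 :* (p :- y) :- r :* v) :+ r)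
                refl (y i) (p i) r (fromℤ (v i)) ⟩
          1# * (p i - y i) - r * fromℤ (v i) + r                            ≈⟨ +-congʳ (+-congʳ (*-congʳ rc≈1)) ⟨
          r * c * (p i - y i) - r * fromℤ (v i) + r                         ≈⟨
                solve 5 (λ y p r c v → r :* c :* (p :- y) :- r :* v :+ r := r :* (c :* (p :- y) :- v) :+ r)
                refl (y i) (p i) r c (fromℤ (v i)) ⟩
          r * (c * (p i - y i) - fromℤ (v i)) + r                           ∎)
      where
      open import Relation.Binary.Reasoning.Setoid setoid
      fl : ∀ i → ∃ λ k → fromℤ k ≤ c * (p i - y i) × c * (p i - y i) ≤ fromℤ k + 1#
      fl i = floor (c * (p i - y i))
      v : Vector ℤ n
      v i = proj₁ (fl i)

  weight : ∀ {n} → Vector ℕ n → ℕ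
  weight {zero}  u = 0
  weight {suc n} u = u zero ℕ.+ weight (u ∘ suc)

  weight-mono : ∀ {n} (u w : Vector ℕ n) → (∀ i → u i ℕ.≤ w i) →
                weight u ℕ.≤ weight w × ((∀ i → u i ≡ w i) ⊎ weight u ℕ.< weight w)
  weight-mono {zero}  u w u≤w = ℕ.z≤n , inj₁ λ ()
  weight-mono {suc n} u w u≤w with weight-mono (u ∘ suc) (w ∘ suc) (u≤w ∘ suc) | ℕP.m≤n⇒m<n∨m≡n (u≤w zero)
  ... | le , _       | inj₁ lt = ℕP.+-mono-≤ (u≤w zero) le , inj₂ (ℕP.+-mono-<-≤ lt le)
  ... | le , inj₂ lt | inj₂ _  = ℕP.+-mono-≤ (u≤w zero) le , inj₂ (ℕP.+-mono-≤-< (u≤w zero) lt)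
  ... | le , inj₁ eq | inj₂ e  = ℕP.+-mono-≤ (u≤w zero) le , inj₁ λ { zero → e ; (suc i) → eq i }

-- Supporting slopes along lines and one-point Lipschitz bounds

module LineWise (em : ExcludedMiddle 0ℓ) (K : ArchimedeanField) where
  open PolyhedralFunctions em K public
  open import Relation.Binary.Reasoning.Setoid setoid

  module Local {n : ℕ} (μs : List (Aff n)) (f : Point n → Carrier) (f-cong : Respects f) (line : LineHyp f μs) where

    S Sᵒ : Pred (Point n) 0ℓ
    S  = InS μs
    Sᵒ = Str μs

    -- Both signs of `t` are meant: `k` supports `f` on the entire part of the line inside `S`.
    Subgradient : Point n → Vector ℤ n → Carrier → Set
    Subgradient x v k = ∀ t → S (x +[ t ] ι v) → f x + t * k ≤ f (x +[ t ] ι v)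

    -- A supporting slope that is exact for small t ≥ 0 within `S`: the right derivative of `f` at
    -- `x` along `v`.
    Germ : Point n → Vector ℤ n → Carrier → Set
    Germ x v k = Subgradient x v k × Near (λ t → S (x +[ t ] ι v) → f (x +[ t ] ι v) ≤ f x + t * k)

    opaque
      -- Among the functionals that attain the maximum at `x`, the steepest along `v` works. One
      -- that is strictly smaller at `x` stays below it for small t, and one that ties at `x` is no
      -- steeper.
      germ : ∀ x → S x → ∀ v → ∃ λ (l : Aff n) → Germ x v (lin l (ι v))
      germ x x∈S v with line x x∈S v
      ... | ls , h with h x (x∈S , 0# , move-zero x (ι v))
      ...   | all , any with greatest (λ l → lin l (ι v)) ls any
      ...     | l , l∈ , fx≈lx , steepest = l , subgradient , near-map upper-bound
            (near-All (All.zipWith (λ {m} (p , q) → each m p q) (all , steepest)))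
        where
        subgradient : Subgradient x v (lin l (ι v))
        subgradient t t∈ = ≤-respˡ (trans (eval-move l x t (ι v)) (+-congʳ (sym fx≈lx)))
          (All.lookup (proj₁ (h _ (t∈ , t , λ _ → refl))) l∈)
        each : ∀ m → eval m x ≤ f x → (f x ≈ eval m x → lin m (ι v) ≤ lin l (ι v)) →
               Near (λ t → eval m (x +[ t ] ι v) ≤ f x + t * lin l (ι v))
        each m mx≤fx flatter with ≤⊎> (f x) (eval m x)
        ... | inj₁ fx≤mx = near-always λ t 0≤t → ≤-respˡ (sym (eval-move m x t (ι v)))
              (+-mono mx≤fx (*-monoˡ 0≤t (flatter (≤-antisym fx≤mx mx≤fx))))
        ... | inj₂ mx<fx = near-map (λ t p → ≤-respˡ (sym (eval-move m x t (ι v)))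
              (≤-by p (solve 5 (λ f e t a b → (f :+ t :* a) :- (e :+ t :* b) := (f :- e) :+ t :* (a :- b)) refl
                (f x) (eval m x) t (lin l (ι v)) (lin m (ι v)))))
              (near-nonneg (lin l (ι v) - lin m (ι v)) (0<gap mx<fx))
        upper-bound : ∀ t → All (λ m → eval m (x +[ t ] ι v) ≤ f x + t * lin l (ι v)) ls →
                      S (x +[ t ] ι v) → f (x +[ t ] ι v) ≤ f x + t * lin l (ι v)
        upper-bound t bounds t∈ with find (proj₂ (h _ (t∈ , t , λ _ → refl)))
        ... | m , m∈ , f≈m = ≤-respˡ (sym f≈m) (All.lookup bounds m∈)

      -- `D` dominates the slopes, up to sign, of the finitely many functionals on this line, so the
      -- estimate holds at every distance from `x` and along unbounded rays.
      line-lipschitz : ∀ x → S x → ∀ v → ∃ λ D → 0# ≤ D × ∀ t → 0# ≤ t → S (x +[ t ] ι v) →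
                       f (x +[ t ] ι v) ≤ f x + t * D × f x ≤ f (x +[ t ] ι v) + t * D
      line-lipschitz x x∈S v with line x x∈S v
      ... | ls , h with h x (x∈S , 0# , move-zero x (ι v))
                      | bound-All (λ l D → lin l (ι v) ≤ D × - lin l (ι v) ≤ D)
                          (λ c≤d (p , q) → ≤-trans p c≤d , ≤-trans q c≤d)
                                (All.universal (λ l → upper (lin l (ι v)) (- lin l (ι v))) ls)
      ...   | all , any | D , 0≤D , bounds = D , 0≤D , λ t 0≤t t∈ → up t 0≤t t∈ , down t 0≤t t∈
        where
        up : ∀ t → 0# ≤ t → S (x +[ t ] ι v) → f (x +[ t ] ι v) ≤ f x + t * D
        up t 0≤t t∈ with find (proj₂ (h _ (t∈ , t , λ _ → refl)))
        ... | m , m∈ , f≈m = ≤-respˡ (sym (trans f≈m (eval-move m x t (ι v))))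
              (+-mono (All.lookup all m∈) (*-monoˡ 0≤t (proj₁ (All.lookup bounds m∈))))
        down : ∀ t → 0# ≤ t → S (x +[ t ] ι v) → f x ≤ f (x +[ t ] ι v) + t * D
        down t 0≤t t∈ with find any
        ... | m , m∈ , f≈m = ≤-by
              (gap (≤-respˡ (eval-move m x t (ι v)) (All.lookup (proj₁ (h _ (t∈ , t , λ _ → refl))) m∈))
                    ⊕ 0≤t ⊗ gap (proj₂ (All.lookup bounds m∈)))
              (trans (+-congˡ (-‿cong f≈m)) (solve 5 (λ e t L D g → (g :+ t :* D) :- e
                    := (g :- (e :+ t :* L)) :+ t :* (D :- :- L)) refl
                (eval m x) t (lin m (ι v)) D (f (x +[ t ] ι v))))

      germ-unit : ∀ x → S x → ∀ i → ∃ λ k → Germ x (unit i) (fromℤ k)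
      germ-unit x x∈S i with germ x x∈S (unit i)
      ... | l , sub , near = coeff l i ,
            (λ t t∈ → ≤-respˡ (+-congˡ (*-congˡ (lin-unit l i))) (sub t t∈)) ,
            near-map (λ t h t∈ → ≤-respʳ (+-congˡ (*-congˡ (lin-unit l i))) (h t∈)) near

      -- A supporting slope at `x` makes `f` at least as large at the end towards which it does not
      -- decrease.
      quasiconvex : ∀ x → S x → ∀ v {a b M} → a ≤ 0# → 0# ≤ b → S (x +[ a ] ι v) → S (x +[ b ] ι v) →
                    f (x +[ a ] ι v) ≤ M → f (x +[ b ] ι v) ≤ M → f x ≤ M
      quasiconvex x x∈S v {a} {b} a≤0 0≤b a∈ b∈ fa≤M fb≤M with germ x x∈S v
      ... | l , sub , _ with ≤-total 0# (lin l (ι v))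
      ...   | inj₁ 0≤k = ≤-trans (≤-by (0≤b ⊗ 0≤k) (solve 2 (λ f c → f :+ c :- f := c)
            refl (f x) (b * lin l (ι v)))) (≤-trans (sub b b∈) fb≤M)
      ...   | inj₂ k≤0 = ≤-trans (≤-by (neg≥0 a≤0 ⊗ neg≥0 k≤0)
            (solve 3 (λ f a k → f :+ a :* k :- f := :- a :* :- k) refl (f x) a (lin l (ι v)))) (≤-trans (sub a a∈) fa≤M)

      midconvex : ∀ x → S x → ∀ v t → S (x +[ t ] ι v) → S (x +[ - t ] ι v) →
                  f x + f x ≤ f (x +[ t ] ι v) + f (x +[ - t ] ι v)
      midconvex x x∈S v t t∈ -t∈ with germ x x∈S v
      ... | l , sub , _ = ≤-respˡ (solve 3 (λ f t k → (f :+ t :* k) :+ (f :+ :- t :* k) := f :+ f)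
            refl (f x) t (lin l (ι v)))
                          (+-mono (sub t t∈) (sub (- t) -t∈))

    module Bounds (c : Point n) (ε : Carrier) (box⊆S : ∀ {η} → η ≤ ε → ∀ {y} → Box c η y → S y) where

      -- The coordinates in `js` are still free. The inductions over `js` start with all coordinates
      -- free and fix one per step.
      Except : List (Fin n) → Point n → Point n → Set
      Except js z x = ∀ j → j ∈ js ⊎ z j ≈ x j

      opaque
        except-set : ∀ {j js z x y a} → y j ≈ a → (∀ k → ¬ j ≡ k → x k ≈ y k) →
                     Except (j ∷ js) z x → Except js (setTo z j a) y
        except-set {j} {z = z} {a = a} y≈a x≈y ex k with j FinP.≟ k
        ... | yes ≡.refl = inj₂ (trans (set-same z j a) (sym y≈a))
        ... | no j≢k with ex k
        ...   | inj₁ (here k≡j) = ⊥-elim (j≢k (≡.sym k≡j))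
        ...   | inj₁ (there k∈) = inj₁ k∈
        ...   | inj₂ z≈x        = inj₂ (trans (set-other z a j≢k) (trans z≈x (x≈y k j≢k)))

        except-[] : ∀ {z x} → Except [] z x → z ≋ x
        except-[] ex j with ex j
        ... | inj₂ p = p

        override : Vector ℤ n → Fin n → ℤ → Vector ℤ n
        override σ j a k with j FinP.≟ k
        ... | yes _ = a
        ... | no _  = σ k

        override-same : ∀ σ j a → override σ j a j ≡ a
        override-same σ j a with j FinP.≟ j
        ... | yes _  = ≡.refl
        ... | no j≢j = ⊥-elim (j≢j ≡.refl)

        override-other : ∀ σ {j k} a → ¬ j ≡ k → override σ j a k ≡ σ k
        override-other σ {j} {k} a j≢k with j FinP.≟ k
        ... | yes j≡k = ⊥-elim (j≢k j≡k)
        ... | no _    = ≡.refl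

        -- Convexity along the coordinates reduces the bound to the corners c + ησ of the box.
        upper-except : ∀ js σ → ∃ λ C → 0# ≤ C × ∀ {η z} → 0# ≤ η → η ≤ ε → Box c η z →
                       Except js z (c +[ η ] ι σ) → f z ≤ f c + C * η
        upper-except [] σ = bound
          where
          bound : ∃ λ C → 0# ≤ C × ∀ {η z} → 0# ≤ η → η ≤ ε → Box c η z →
                       Except [] z (c +[ η ] ι σ) → f z ≤ f c + C * η
          bound with em {0# ≤ ε}
          -- For a negative `ε` there is no admissible η, and `c` need not lie in `S`; any constant
          -- will do.
          ... | no 0≰ε = 0# , ≤-refl , λ 0≤η η≤ε _ _ → ⊥-elim (0≰ε (≤-trans 0≤η η≤ε))
          ... | yes 0≤ε with line-lipschitz c (box⊆S 0≤ε (box-centre ≤-refl)) σ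
          ...   | D , 0≤D , h = D , 0≤D , λ {η} {z} 0≤η η≤ε b ex →
                  ≤-respˡ (sym (f-cong (except-[] ex))) (≤-respʳ (+-congˡ (*-comm η D))
                    (proj₁ (h η 0≤η (inS-cong (except-[] ex) (box⊆S η≤ε b)))))
        upper-except (j ∷ js) σ with upper-except js (override σ j 1ℤ) | upper-except js (override σ j (ℤ.- 1ℤ))
        ... | C , 0≤C , p | D , 0≤D , q = C + D , 0≤C ⊕ 0≤D , λ {η} {z} 0≤η η≤ε b ex →
          let z⁺ = setTo z j (c j + η)
              z⁻ = setTo z j (c j - η)
              b⁺ = box-set j (c j + η) b (≤-by (0≤η ⊕ 0≤η) (solve 2 (λ c η → c :+ η :- (c :- η) := η :+ η)
                    refl (c j) η)) ≤-refl
              b⁻ = box-set j (c j - η) b ≤-refl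
                    (≤-by (0≤η ⊕ 0≤η) (solve 2 (λ c η → c :+ η :- (c :- η) := η :+ η) refl (c j) η))
              e⁺ = except-set (trans (+-congˡ
                    (*-congˡ (trans (reflexive (≡.cong fromℤ (override-same σ j 1ℤ))) fromℤ-1)))
                    (+-congˡ (*-identityʳ η)))
                     (λ k j≢k → +-congˡ (*-congˡ (reflexive (≡.cong fromℤ (≡.sym (override-other σ 1ℤ j≢k)))))) ex
              e⁻ = except-set (trans (+-congˡ
                    (*-congˡ (trans (reflexive (≡.cong fromℤ (override-same σ j (ℤ.- 1ℤ)))) (-‿cong fromℤ-1))))
                       (solve 2 (λ c η → c :+ η :* :- :1 := c :- η) refl (c j) η))
                     (λ k j≢k → +-congˡ (*-congˡ (reflexive (≡.cong fromℤ (≡.sym (override-other σ (ℤ.- 1ℤ) j≢k)))))) ex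
          in quasiconvex z (box⊆S η≤ε b) (unit j)
               (≤-by (gap (proj₁ (b j))) (solve 3 (λ c η z → :0 :- (c :- η :- z) := z :- (c :- η)) refl (c j) η (z j)))
               (gap (proj₂ (b j)))
               (box⊆S η≤ε b⁻) (box⊆S η≤ε b⁺)
               (≤-trans (q 0≤η η≤ε b⁻ e⁻) (+-mono ≤-refl
                     (≤-by (0≤C ⊗ 0≤η) (solve 3 (λ C D η → (C :+ D) :* η :- D :* η := C :* η) refl C D η))))
               (≤-trans (p 0≤η η≤ε b⁺ e⁺) (+-mono ≤-refl
                     (≤-by (0≤D ⊗ 0≤η) (solve 3 (λ C D η → (C :+ D) :* η :- C :* η := D :* η) refl C D η))))

        upper-bound : ∃ λ C → 0# ≤ C × ∀ {η z} → 0# ≤ η → η ≤ ε → Box c η z → f z ≤ f c + C * η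
        upper-bound with upper-except (allFin n) (λ _ → 0ℤ)
        ... | C , 0≤C , h = C , 0≤C , λ 0≤η η≤ε b → h 0≤η η≤ε b (λ j → inj₁ (∈-allFin j))

        -- Midpoint convexity between z and its reflection in c, one coordinate at a time.
        lower-except : ∀ js → ∃ λ C → 0# ≤ C × ∀ {η z} → 0# ≤ η → η ≤ ε → Box c η z →
                       Except js z c → f c ≤ f z + C * η
        lower-except [] = 0# , ≤-refl , λ {η} {z} 0≤η η≤ε b ex → ≤-reflexive
              (trans (f-cong (λ i → sym (except-[] ex i)))
          (solve 2 (λ f η → f := f :+ :0 :* η) refl (f z) η))
        lower-except (j ∷ js) with lower-except js | upper-bound
        -- The constant comes from f z ≥ 2 f w - f z' with f w ≥ f c - C η and f z' ≤ f c + D η.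
        ... | C , 0≤C , p | D , 0≤D , q = C + C + D , 0≤C ⊕ 0≤C ⊕ 0≤D , λ {η} {z} 0≤η η≤ε b ex →
          let w  = setTo z j (c j)
              bw = box-set j (c j) b (proj₁ (box-centre {x = c} 0≤η j)) (proj₂ (box-centre {x = c} 0≤η j))
              t  = z j - c j
              z≋ : z ≋ w +[ t ] ι (unit j)
              z≋ i = solve 4 (λ z zj cj u → z := z :+ (cj :- zj) :* u :+ (zj :- cj) :* u)
                    refl (z i) (z j) (c j) (fromℤ (unit j i))
              z' = setTo z j (c j + c j - z j)
              z'≋ : z' ≋ w +[ - t ] ι (unit j)
              z'≋ i = solve 4 (λ z zj cj u → z :+ (cj :+ cj :- zj :- zj) :* u := z :+ (cj :- zj) :* u :+ :-
                    (zj :- cj) :* u) refl (z i) (z j) (c j) (fromℤ (unit j i))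
              b' = box-set j (c j + c j - z j) b
                     (≤-by (gap (proj₂ (b j))) (solve 3 (λ c η z → (c :+ c :- z) :- (c :- η) := c :+ η :- z)
                           refl (c j) η (z j)))
                     (≤-by (gap (proj₁ (b j))) (solve 3 (λ c η z → c :+ η :- (c :+ c :- z) := z :- (c :- η))
                           refl (c j) η (z j)))
              mid = midconvex w (box⊆S η≤ε bw) (unit j) t (inS-cong z≋ (box⊆S η≤ε b)) (inS-cong z'≋ (box⊆S η≤ε b'))
              low = p 0≤η η≤ε bw (except-set refl (λ _ _ → refl) ex)
              upp = q 0≤η η≤ε b'
          in ≤-by (gap (≤-respʳ (sym (+-cong (f-cong z≋) (f-cong z'≋))) mid) ⊕ (gap low ⊕ gap low) ⊕ gap upp)
               (solve 7 (λ fc fz fz' fw C D η → fz :+ (C :+ C :+ D) :* η :- fc :=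
                   ((fz :+ fz') :- (fw :+ fw)) :+ ((fw :+ C :* η :- fc) :+ (fw :+ C :* η :- fc)) :+
                         ((fc :+ D :* η) :- fz')) refl
                 (f c) (f z) (f z') (f w) C D η)

        lower-bound : ∃ λ C → 0# ≤ C × ∀ {η z} → 0# ≤ η → η ≤ ε → Box c η z → f c ≤ f z + C * η
        lower-bound with lower-except (allFin n)
        ... | C , 0≤C , h = C , 0≤C , λ 0≤η η≤ε b → h 0≤η η≤ε b (λ j → inj₁ (∈-allFin j))

        -- A slope that supports `f` at both ends of a coordinate move gives the increment of `f`
        -- exactly. So `f` minus the linear form of `a` is unchanged on the way from `z` to `c`, one
        -- coordinate after another.
        affine-box : (a : Vector ℤ n) → 0# ≤ ε →
          (∀ y → Box c ε y → ∀ j → Subgradient y (unit j) (fromℤ (a j))) →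
          ∃ λ k → ∀ y → Box c ε y → f y ≈ eval (aff a k) y
        affine-box a 0≤ε sub = f c - eval l c , λ y b → begin
            f y                              ≈⟨ solve 2 (λ f e → f := e :+ (f :- e)) refl (f y) (eval l y) ⟩
            eval l y + (f y - eval l y)      ≈⟨ +-congˡ (path (allFin n) y b (λ j → inj₁ (∈-allFin j))) ⟩
            eval l y + (f c - eval l c)      ≈⟨ eval-const a (f c - eval l c) y ⟨
            eval (aff a (f c - eval l c)) y  ∎
          where
          l : Aff n
          l = aff a 0#
          path : ∀ js z → Box c ε z → Except js z c → f z - eval l z ≈ f c - eval l c
          path [] z b ex = +-cong (f-cong (except-[] ex)) (-‿cong (eval-cong l (except-[] ex)))
          path (j ∷ js) z b ex = trans step (path js w bw (except-set refl (λ _ _ → refl) ex))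
            where
            w : Point n
            w  = setTo z j (c j)
            bw : Box c ε w
            bw = box-set j (c j) b (proj₁ (box-centre {x = c} 0≤ε j)) (proj₂ (box-centre {x = c} 0≤ε j))
            t : Carrier
            t  = z j - c j
            z≋ : z ≋ w +[ t ] ι (unit j)
            z≋ i = solve 4 (λ z zj cj u → z := z :+ (cj :- zj) :* u :+ (zj :- cj) :* u)
                  refl (z i) (z j) (c j) (fromℤ (unit j i))
            w≋ : w ≋ z +[ - t ] ι (unit j)
            w≋ i = solve 4 (λ z zj cj u → z :+ (cj :- zj) :* u := z :+ :- (zj :- cj) :* u)
                  refl (z i) (z j) (c j) (fromℤ (unit j i))
            lw : eval l w ≈ eval l z + - t * fromℤ (a j)
            lw = trans (eval-cong l w≋) (trans (eval-move l z (- t) (ι (unit j))) (+-congˡ (*-congˡ (lin-unit l j))))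
            fz≥ : f w + t * fromℤ (a j) ≤ f z
            fz≥ = ≤-respʳ (sym (f-cong z≋)) (sub w bw j t (inS-cong z≋ (box⊆S ≤-refl b)))
            fw≥ : f z + - t * fromℤ (a j) ≤ f w
            fw≥ = ≤-respʳ (sym (f-cong w≋)) (sub z b j (- t) (inS-cong w≋ (box⊆S ≤-refl bw)))
            fw : f w ≈ f z + - t * fromℤ (a j)
            fw = ≤-antisym (≤-by (gap fz≥) (solve 4 (λ z w t a → z :+ :- t :* a :- w := z :- (w :+ t :* a))
                  refl (f z) (f w) t (fromℤ (a j)))) fw≥
            step : f z - eval l z ≈ f w - eval l w
            step = trans (solve 3 (λ f e d → f :- e := f :+ d :- (e :+ d))
                  refl (f z) (eval l z) (- t * fromℤ (a j))) (sym (+-cong fw (-‿cong lw)))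

-- Touching functionals at interior points and convexity

module InteriorPoints (em : ExcludedMiddle 0ℓ) (K : ArchimedeanField) where
  open LineWise em K public
  open import Relation.Binary.Reasoning.Setoid setoid

  opaque
    box-shift : ∀ {n} {x y : Point n} {r} t u → Box x r y → Box (x +[ t ] u) r (y +[ t ] u)
    box-shift {x = x} {y} {r} t u b i =
      ≤-by (gap (proj₁ (b i))) (solve 5 (λ x y r t u → y :+ t :* u :- (x :+ t :* u :- r) := y :- (x :- r))
            refl (x i) (y i) r t (u i)) ,
      ≤-by (gap (proj₂ (b i))) (solve 5 (λ x y r t u → x :+ t :* u :+ r :- (y :+ t :* u) := x :+ r :- y)
            refl (x i) (y i) r t (u i))

  opaque
    box-unit : ∀ {n} (x : Point n) i {t} → 0# ≤ t → Box x t (x +[ - t ] ι (unit i))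
    box-unit x i {t} 0≤t j with i FinP.≟ j
    ... | yes ≡.refl = ≤-reflexive (sym (move-same x i (- t))) ,
          ≤-respˡ (sym (move-same x i (- t)))
                (≤-by (0≤t ⊕ 0≤t) (solve 2 (λ x t → x :+ t :- (x :+ :- t) := t :+ t) refl (x i) t))
    ... | no i≢j = ≤-respʳ (sym (move-other x (- t) i≢j)) (proj₁ (box-centre {x = x} 0≤t j)) ,
          ≤-respˡ (sym (move-other x (- t) i≢j)) (proj₂ (box-centre {x = x} 0≤t j))

  module Interior {n : ℕ} (μs : List (Aff n)) (f : Point n → Carrier) (f-cong : Respects f) (line : LineHyp f μs) where
    open Local μs f f-cong line public

    opaque
      -- The estimate compares only with the centre, and its constant depends on `c`: it gives
      -- continuity at each interior point, with a linear rate.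
      bounds : ∀ c → Sᵒ c → ∃ λ C → 0# ≤ C × Near (λ η → ∀ z → Box c η z →
               Sᵒ z × f z ≤ f c + C * η × f c ≤ f z + C * η)
      bounds c c∈ with near-str c c∈
      ... | ε , 0<ε , inner with Bounds.upper-bound c ε box⊆S | Bounds.lower-bound c ε box⊆S
        where
        box⊆S : ∀ {η} → η ≤ ε → ∀ {y} → Box c η y → S y
        box⊆S η≤ε b = str⇒inS (inner ε (<⇒≤ 0<ε) ≤-refl _ (box-mono η≤ε b))
      ...   | C , 0≤C , up | D , 0≤D , lo = C + D , 0≤C ⊕ 0≤D , ε , 0<ε , λ η 0≤η η≤ε z b → inner η 0≤η η≤ε z b ,
              ≤-trans (up 0≤η η≤ε b) (+-mono ≤-refl
                    (≤-by (0≤D ⊗ 0≤η) (solve 3 (λ C D η → (C :+ D) :* η :- C :* η := D :* η) refl C D η))) ,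
              ≤-trans (lo 0≤η η≤ε b) (+-mono ≤-refl
                    (≤-by (0≤C ⊗ 0≤η) (solve 3 (λ C D η → (C :+ D) :* η :- D :* η := C :* η) refl C D η)))

    opaque
      -- Fix t so small that the germ at `x` is exact there. A supporting slope k′ ≥ k + 1 at `y`
      -- would give f an excess of at least t over the step t, whereas the estimates at `x` and at
      -- `x` + t eⱼ allow only (C + D) η. Integrality turns k′ < k + 1 into k′ ≤ k.
      germ-upper-semicontinuous : ∀ x → Sᵒ x → ∀ j {k} → Germ x (unit j) (fromℤ k) →
        Near (λ η → ∀ y → Box x η y → ∀ k′ → Subgradient y (unit j) (fromℤ k′) → k′ ℤ.≤ k)
      germ-upper-semicontinuous x x∈ j {k} (_ , upper-germ) with near-str x x∈
      ... | ε , 0<ε , inner with near-witness (near-× upper-germ (near-box-move x (ι (unit j)) 0<ε))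
      ...   | t , 0<t , ft≤ , bt , _ with bounds x x∈ | bounds (x +[ t ] ι (unit j)) (inner ε (<⇒≤ 0<ε) ≤-refl _ bt)
      ...     | C , _ , nearC | D , _ , nearD = near-map result (near-× (near-× nearC nearD) (near-pos (- (C + D)) 0<t))
        where
        x∈t : Sᵒ (x +[ t ] ι (unit j))
        x∈t = inner ε (<⇒≤ 0<ε) ≤-refl _ bt
        result : ∀ η → ((∀ z → Box x η z → Sᵒ z × f z ≤ f x + C * η × f x ≤ f z + C * η) ×
                        (∀ z → Box (x +[ t ] ι (unit j)) η z → Sᵒ z × f z ≤ f (x +[ t ] ι (unit j)) + D * η × f
                              (x +[ t ] ι (unit j)) ≤ f z + D * η)) ×
                       0# < t + η * - (C + D) → ∀ y → Box x η y → ∀ k′ → Subgradient y (unit j) (fromℤ k′) → k′ ℤ.≤ k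
        result η ((hC , hD) , small) y b k′ sub = ℤP.≤-trans (ℤP.i<j⇒i≤pred[j] (fromℤ-<-cancel {k′} {ℤ.suc k}
            (λ 1+k≤k′ → small (≤-by (<⇒≤ 0<t ⊗ gap (≤-respˡ (fromℤ-suc k) 1+k≤k′)
               ⊕ gap (sub t (str⇒inS (proj₁ (hD _ shifted)))) ⊕ gap (proj₁ (proj₂ (hD _ shifted)))
                     ⊕ gap (ft≤ (str⇒inS x∈t)) ⊕ gap (proj₂ (proj₂ (hC y b))))
              (solve 10 (λ fx fy fxt fyt t k k′ C D η →
                 :0 :- (t :+ η :* :- (C :+ D)) :=
                 t :* (k′ :- (:1 :+ k)) :+ (fyt :- (fy :+ t :* k′)) :+ (fxt :+ D :* η :- fyt) :+
                       (fx :+ t :* k :- fxt) :+ (fy :+ C :* η :- fx)) refl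
                 (f x) (f y) (f (x +[ t ] ι (unit j))) (f (y +[ t ] ι (unit j))) t (fromℤ k) (fromℤ k′) C D η)))))
            (ℤP.≤-reflexive (ℤP.pred-suc k))
          where
          shifted : Box (x +[ t ] ι (unit j)) η (y +[ t ] ι (unit j))
          shifted = box-shift t (ι (unit j)) b

    opaque
      -- Stepping back by `h` gives h k ≥ f y - f y′. Both points lie within ε = 2h of `z`, so the
      -- right side is at least -4 C h; hence the bound 4C for `M`.
      slopes-bounded-below : ∀ z → Sᵒ z → ∃₂ λ (M : ℕ) h → 0# < h × (∀ y → Box z h y → Sᵒ y) ×
        (∀ y → Box z h y → ∀ j k → Subgradient y (unit j) (fromℤ k) → ℤ.- (+ M) ℤ.≤ k)
      slopes-bounded-below z z∈ with bounds z z∈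
      ... | C , 0≤C , ε , 0<ε , near with half ε 0<ε
      ...   | h , 0<h , hh≈ε with archimedean (C + C + (C + C))
      ...     | M , 4C≤M = M , h , 0<h , (λ y b → proj₁ (near ε (<⇒≤ 0<ε) ≤-refl y (box-mono h≤ε b))) , λ y b j k sub →
          let b′ = box-mono (≤-reflexive hh≈ε) (box-trans b (box-unit y j (<⇒≤ 0<h)))
              at-ε = near ε (<⇒≤ 0<ε) ≤-refl
              y′ = y +[ - h ] ι (unit j)
          in fromℤ-≤-cancel (≤-respˡ (sym (fromℤ-neg (+ M))) (≤-trans (neg-mono 4C≤M) (*-cancel-≤ 0<h
             (≤-by (gap (sub (- h) (str⇒inS (proj₁ (at-ε _ b′)))) ⊕ gap (proj₁ (proj₂ (at-ε _ b′)))
                   ⊕ gap (proj₂ (proj₂ (at-ε y (box-mono h≤ε b)))))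
               (trans (solve 6 (λ fy fy′ fz C h k → h :* k :- h :* :- (C :+ C :+ (C :+ C)) :=
                  fy′ :- (fy :+ :- h :* k) :+ (fz :+ C :* (h :+ h) :- fy′) :+ (fy :+ C :* (h :+ h) :- fz))
                        refl (f y) (f y′) (f z) C h (fromℤ k))
                 (+-cong (+-congˡ (+-congʳ (+-congˡ (*-congˡ hh≈ε)))) (+-congʳ (+-congˡ (*-congˡ hh≈ε)))))))))
        where
        h≤ε : h ≤ ε
        h≤ε = ≤-respʳ hh≈ε (≤-by (<⇒≤ 0<h) (solve 1 (λ h → h :+ h :- h := h) refl h))

    Germs : Point n → Vector ℤ n → Set
    Germs x a = ∀ j → Germ x (unit j) (fromℤ (a j))

    opaque
      germs : ∀ x → S x → ∃ (Germs x)
      germs x x∈ = (λ j → proj₁ (germ-unit x x∈ j)) , (λ j → proj₂ (germ-unit x x∈ j))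

    opaque
      -- Semicontinuity gives a box in which no slope exceeds its value at `x`. If some point there
      -- has slopes of smaller total weight, restart at it with half the radius, still within the
      -- old box; otherwise equal weights and the coordinatewise inequality force equal slopes.
      constant-slopes : ∀ M (inside : Pred (Point n) 0ℓ) → (∀ y → inside y → Sᵒ y) →
        (∀ y → inside y → ∀ j k → Subgradient y (unit j) (fromℤ k) → ℤ.- (+ M) ℤ.≤ k) →
        ∀ a → Acc ℕ._<_ (weight (λ j → ℤ.∣ a j ℤ.+ + M ∣)) →
        ∀ x s → 0# < s → (∀ y → Box x s y → inside y) → Germs x a →
        ∃₂ λ p η → ∃ λ (a′ : Vector ℤ n) → 0# < η × (∀ y → Box p η y → inside y) ×
          (∀ y → Box p η y → ∀ j → Subgradient y (unit j) (fromℤ (a′ j)))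
      constant-slopes M inside inside⊆ lower a (acc rec) x s 0<s box⊆ germs-x
        with half s 0<s
      ... | h , 0<h , hh≈s
        with near-witness (near-× (near-Fin
              (λ j → germ-upper-semicontinuous x (inside⊆ x (box⊆ x (box-centre (<⇒≤ 0<s)))) j (germs-x j)))
              (near-≤ 0<h))
      ...   | η , 0<η , below , η≤h
        with em {∃₂ λ y a′ → Box x η y × Germs y a′ × weight (λ j → ℤ.∣ a′ j ℤ.+ + M ∣) ℕ.< weight
              (λ j → ℤ.∣ a j ℤ.+ + M ∣)}
      ...     | yes (y , a′ , b , germs-y , smaller) = constant-slopes M inside inside⊆ lower a′ (rec smaller) y h 0<h
                  (λ z bz → box⊆ z (box-mono (≤-reflexive hh≈s) (box-trans (box-mono η≤h b) bz))) germs-y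
      ...     | no least = x , η , a , 0<η , (λ y b → box⊆ y (η⊆s b)) , same
        where
        η⊆s : ∀ {y} → Box x η y → Box x s y
        η⊆s b = box-mono (≤-trans η≤h (≤-respʳ hh≈s (≤-by (<⇒≤ 0<h) (solve 1 (λ h → h :+ h :- h := h) refl h)))) b
        same : ∀ y → Box x η y → ∀ j → Subgradient y (unit j) (fromℤ (a j))
        same y b j with germs y (str⇒inS (inside⊆ y (box⊆ y (η⊆s b))))
        ... | a′ , germs-y with weight-mono (λ j → ℤ.∣ a′ j ℤ.+ + M ∣) (λ j → ℤ.∣ a j ℤ.+ + M ∣)
                (λ j → ∣+M∣-mono M (low j) (upp j))
          where
          low : ∀ j → ℤ.- (+ M) ℤ.≤ a′ j
          low j = lower y (box⊆ y (η⊆s b)) j (a′ j) (proj₁ (germs-y j))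
          upp : ∀ j → a′ j ℤ.≤ a j
          upp j = below j y b (a′ j) (proj₁ (germs-y j))
        ...   | _ , inj₂ smaller = ⊥-elim (least (y , a′ , b , germs-y , smaller))
        ...   | _ , inj₁ eq = ≡.subst (λ k → Subgradient y (unit j) (fromℤ k))
                  (∣+M∣-injective M (lower y (box⊆ y (η⊆s b)) j (a′ j) (proj₁ (germs-y j)))
                        (below j y b (a′ j) (proj₁ (germs-y j))) (eq j))
                  (proj₁ (germs-y j))

    Touching : Aff n → Set
    Touching l = ∃₂ λ p η → 0# < η × (∀ y → Box p η y → Sᵒ y) × (∀ y → Box p η y → f y ≈ eval l y)

    opaque
      touching-dense : ∀ z → Sᵒ z → ∀ r → 0# < r → ∃ λ l → Σ (Touching l) λ t → Box z r (proj₁ t)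
      touching-dense z z∈ r 0<r with slopes-bounded-below z z∈
      ... | M , h , 0<h , inner , lower with min⁺ h r 0<h 0<r | germs z (str⇒inS z∈)
      ...   | s , 0<s , s≤h , s≤r | a , germs-z
        with constant-slopes M (Box z s) (λ y b → inner y (box-mono s≤h b)) (λ y b → lower y (box-mono s≤h b))
               a (<-wellFounded _) z s 0<s (λ _ b → b) germs-z
      ...     | p , η , a′ , 0<η , box⊆ , subs
        with Bounds.affine-box p η (λ η≤ b → str⇒inS (inner _ (box-mono s≤h (box⊆ _ (box-mono η≤ b))))) a′
              (<⇒≤ 0<η) subs
      ...       | k , f≈ = aff a′ k , (p , η , 0<η , (λ y b → inner y (box-mono s≤h (box⊆ y b))) , f≈) ,
                  box-mono s≤r (box⊆ p (box-centre (<⇒≤ 0<η)))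

    opaque
      -- An integral direction leads from `y` to a point `x` of the box around which `f` is `l` on
      -- both sides along the line. Every supporting slope at `x` then equals that of `l`, and its
      -- supporting inequality at `y` is the claim.
      touching-minorant : ∀ {l} → Touching l → ∀ y → S y → eval l y ≤ f y
      touching-minorant {l} (p , η , 0<η , box⊆ , f≈) y y∈ with half η 0<η
      ... | h , 0<h , hh≈η with integral-direction y p 0<h
      -- Aiming at the box of half the radius leaves room for steps `δ` to both sides.
      ...   | v , t , 0<t , b with near-witness (near-box-move (y +[ t ] ι v) (ι v) 0<h)
      ...     | δ , 0<δ , b⁺ , b⁻ with germ (y +[ t ] ι v) (str⇒inS (box⊆ _ b′)) v
        where
        b′ : Box p η (y +[ t ] ι v)
        b′ = box-mono (≤-respʳ hh≈η (≤-by (<⇒≤ 0<h) (solve 1 (λ h → h :+ h :- h := h) refl h))) b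
      ...       | m , sub , _ = ≤-respˡ ly (≤-respʳ (sym (f-cong y≋)) (sub (- t) (inS-cong y≋ y∈)))
        where
        x : Point n
        x = y +[ t ] ι v
        b₀ : Box p η x
        b₀ = box-mono (≤-respʳ hh≈η (≤-by (<⇒≤ 0<h) (solve 1 (λ h → h :+ h :- h := h) refl h))) b
        b₊ : Box p η (x +[ δ ] ι v)
        b₊ = box-mono (≤-reflexive hh≈η) (box-trans b b⁺)
        b₋ : Box p η (x +[ - δ ] ι v)
        b₋ = box-mono (≤-reflexive hh≈η) (box-trans b b⁻)
        y≋ : y ≋ x +[ - t ] ι v
        y≋ i = solve 3 (λ y t v → y := y :+ t :* v :+ :- t :* v) refl (y i) t (fromℤ (v i))
        value : ∀ s → Box p η (x +[ s ] ι v) → s * lin m (ι v) ≤ s * lin l (ι v)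
        value s bs = ≤-by (gap (sub s (str⇒inS (box⊆ _ bs)))) (begin
          s * L - s * k                         ≈⟨ solve 4 (λ e s L k → s :* L :- s :* k
                := e :+ s :* L :- (e :+ s :* k)) refl (eval l x) s L k ⟩
          eval l x + s * L - (eval l x + s * k) ≈⟨ +-cong (sym (trans (f≈ _ bs) (eval-move l x s (ι v))))
                (-‿cong (+-congʳ (sym (f≈ x b₀)))) ⟩
          f (x +[ s ] ι v) - (f x + s * k)      ∎)
          where
          L k : Carrier
          L = lin l (ι v)
          k = lin m (ι v)
        k≈L : lin m (ι v) ≈ lin l (ι v)
        k≈L = ≤-antisym (*-cancel-≤ 0<δ (value δ b₊)) (*-cancel-≤ 0<δ
          (≤-by (gap (value (- δ) b₋)) (solve 3 (λ δ k L → δ :* k :- δ :* L := :- δ :* L :- :- δ :* k)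
                refl δ (lin m (ι v)) (lin l (ι v)))))
        ly : f x + - t * lin m (ι v) ≈ eval l y
        ly = begin
          f x + - t * lin m (ι v)            ≈⟨ +-cong (f≈ x b₀) (*-congˡ k≈L) ⟩
          eval l x + - t * lin l (ι v)       ≈⟨ eval-move l x (- t) (ι v) ⟨
          eval l (x +[ - t ] ι v)            ≈⟨ eval-cong l y≋ ⟨
          eval l y                           ∎

    opaque
      -- No bound on the slope of `l` is known here. Instead reflect `z` in the nearby touching
      -- point `p`: with y = 2p - z, affinity gives l z = 2 f p - l y ≥ 2 f p - f y, and the
      -- estimates at `z` leave an error of at most 4 C η.
      touching-approximates : ∀ z → Sᵒ z → ∀ ε → 0# < ε → ∃ λ l → Touching l × f z ≤ eval l z + ε
      touching-approximates z z∈ ε 0<ε with bounds z z∈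
      ... | C , 0≤C , r , 0<r , near with small (C + C + (C + C)) ε 0<ε | half r 0<r
      ...   | t , 0<t , 4tC≤ε | h , 0<h , hh≈r with min⁺ t h 0<t 0<h
      ...     | η , 0<η , η≤t , η≤h with touching-dense z z∈ η 0<η
      ...       | l , touching@(p , _ , 0<ρ , _ , f≈) , b = l , touching ,
          ≤-by ((gap (proj₂ (proj₂ (near η 0≤η (≤-trans η≤h h≤r) p b)))
                ⊕ gap (proj₂ (proj₂ (near η 0≤η (≤-trans η≤h h≤r) p b)))) ⊕
                gap (proj₁ (proj₂ at-y)) ⊕ gap (touching-minorant touching y (str⇒inS (proj₁ at-y))) ⊕
                gap 4tC≤ε ⊕ gap η≤t ⊗ (0≤C ⊕ 0≤C ⊕ (0≤C ⊕ 0≤C)))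
            (trans (+-congʳ (+-congʳ lz)) (solve 8 (λ fz fp fy ly C η t ε → (fp :+ fp :- ly) :+ ε :- fz :=
               (fp :+ C :* η :- fz :+ (fp :+ C :* η :- fz)) :+ (fz :+ C :* (η :+ η) :- fy) :+ (fy :- ly) :+
                     (ε :- t :* (C :+ C :+ (C :+ C))) :+ (t :- η) :* (C :+ C :+ (C :+ C))) refl
               (f z) (f p) (f y) (eval l y) C η t ε))
        where
        0≤η : 0# ≤ η
        0≤η = <⇒≤ 0<η
        h≤r : h ≤ r
        h≤r = ≤-respʳ hh≈r (≤-by (<⇒≤ 0<h) (solve 1 (λ h → h :+ h :- h := h) refl h))
        y : Point n
        y = comb 2# p (- 1#) z
        by : Box z (η + η) y
        by i = ≤-by (gap (proj₁ (b i)) ⊕ gap (proj₁ (b i)))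
              (solve 3 (λ p z η → ((:1 :+ :1) :* p :+ :- :1 :* z) :- (z :- (η :+ η))
              := (p :- (z :- η)) :+ (p :- (z :- η))) refl (p i) (z i) η) ,
               ≤-by (gap (proj₂ (b i)) ⊕ gap (proj₂ (b i)))
                     (solve 3 (λ p z η → z :+ (η :+ η) :- ((:1 :+ :1) :* p :+ :- :1 :* z)
                     := (z :+ η :- p) :+ (z :+ η :- p)) refl (p i) (z i) η)
        at-y : Sᵒ y × f y ≤ f z + C * (η + η) × f z ≤ f y + C * (η + η)
        at-y = near (η + η) (0≤η ⊕ 0≤η) (≤-respʳ hh≈r (+-mono η≤h η≤h)) y by
        lz : eval l z ≈ f p + f p - eval l y
        lz = begin
          eval l z                                                    ≈⟨ solve 2 (λ p z → z
                := p :+ p :- ((:1 :+ :1) :* p :+ :- :1 :* z)) refl (eval l p) (eval l z) ⟩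
          eval l p + eval l p - (2# * eval l p + - 1# * eval l z)     ≈⟨ +-cong (+-cong fp fp)
                (-‿cong (eval-comb l 2# p (- 1#) z (solve 0 ((:1 :+ :1) :+ :- :1 := :1) refl))) ⟨
          f p + f p - eval l y                                        ∎
          where
          fp : f p ≈ eval l p
          fp = f≈ p (box-centre (<⇒≤ 0<ρ))

    opaque
      -- A minorant that is within ε of `f` at `q` is affine and lies below `f` at `x` and `y`. Such
      -- minorants exist at interior points, hence the condition on `q`; `x` and `y` may be boundary
      -- points.
      convex : ∀ {x y q α β} → 0# ≤ α → 0# ≤ β → α + β ≈ 1# → S x → S y → Sᵒ q → q ≋ comb α x β y →
               f q ≤ α * f x + β * f y
      convex {x} {y} {q} {α} {β} 0≤α 0≤β α+β≈1 x∈ y∈ q∈ q≋ = ≤-of-small 1# bound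
        where
        bound : ∀ ε → 0# < ε → f q ≤ α * f x + β * f y + 1# * ε
        bound ε 0<ε with touching-approximates q q∈ ε 0<ε
        ... | l , touching , fq≤ = ≤-trans fq≤ (+-mono
              (≤-respˡ (sym (trans (eval-cong l q≋) (eval-comb l α x β y α+β≈1)))
                (+-mono (*-monoˡ 0≤α (touching-minorant touching x x∈))
                      (*-monoˡ 0≤β (touching-minorant touching y y∈))))
              (≤-reflexive (sym (*-identityˡ ε))))

-- Bounding the slopes through the faces

module FullDimensional (em : ExcludedMiddle 0ℓ) (K : ArchimedeanField) where
  open InteriorPoints em K public
  open import Relation.Binary.Reasoning.Setoid setoid

  module Faces {n : ℕ} (μs : List (Aff n)) (f : Point n → Carrier) (f-cong : Respects f) (line : LineHyp f μs) where
    open Interior μs f f-cong line public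

    Face : Aff n → Pred (Point n) 0ℓ
    Face μ x = S x × eval μ x ≈ 0#

    -- A bound on the secant slopes along `v` from interior points into `E`, uniform in the starting
    -- point and in the length.
    BoundedAlong : Vector ℤ n → Pred (Point n) 0ℓ → Carrier → Set
    BoundedAlong v E C = ∀ x s → 0# < s → Sᵒ x → E (x +[ s ] ι v) → f (x +[ s ] ι v) ≤ f x + s * C

    opaque
      -- Near a relative interior point e₀ of a piece of the face, f grows at most linearly towards
      -- the interior of S; convexity spreads this from e₀ to the whole piece.
      piece-bound : ∀ v l (ψs : List (Aff n)) → (∀ x → InS ψs x → S x × f x ≈ eval l x) →
                    ∃ (BoundedAlong v (InS ψs))
      piece-bound v l ψs piece with em {∃ (InS ψs)}
      ... | no empty    = 0# , λ x s _ _ e∈ → ⊥-elim (empty (_ , e∈))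
      ... | yes inhabited with relative-interior-point (InS ψs) (λ 0≤h hh≈1 → inS-comb 0≤h 0≤h hh≈1) inhabited
            ψs (λ _ r → r)
      ...   | e₀ , e₀∈ , relint with line-lipschitz e₀ (proj₁ (piece e₀ e₀∈)) (ℤ.-_ ∘ v)
      ...     | D , 0≤D , lip = D , bound
        where
        bound : BoundedAlong v (InS ψs) D
        -- With e″ beyond e₀ as seen from e, one has e₀ = α e″ + β e. Replacing e by x gives q = α
        -- e″ + β x = e₀ - β s v, a point on the fixed ray from e₀ where `lip` applies. Convexity at
        -- q and affinity of `f` on the piece then cancel the terms in e″.
        bound x s 0<s x∈ e∈ with near-witness (extend-beyond ψs (x +[ s ] ι v) e₀∈ e∈ relint)
        ... | r , 0<r , e″∈ with recip (1# + r) (pos-+ 0<1 (<⇒≤ 0<r))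
        ...   | α , 0<α , [1+r]α≈1 = *-cancel-≤ 0<β (≤-by
                (gap q-convex ⊕ gap (proj₂ (lip (β * s) (<⇒≤ (pos-* 0<β 0<s)) (str⇒inS q∈))))
                (begin
                  β * (f x + s * D) - β * f e                                              ≈⟨ +-congˡ
                        (-‿cong (*-congˡ (proj₂ (piece e e∈)))) ⟩
                  β * (f x + s * D) - β * eval l e                                         ≈⟨
                        solve 8 (λ α r fx s D le l₀ fq →
                      r :* α :* (fx :+ s :* D) :- r :* α :* le :=
                      (α :* (l₀ :+ r :* (l₀ :- le)) :+ r :* α :* fx :- fq) :+
                            (fq :+ r :* α :* s :* D :- (:1 :+ r) :* α :* l₀)) refl
                      α r (f x) s D (eval l e) (eval l e₀) (f q) ⟩
                  (α * (eval l e₀ + r * (eval l e₀ - eval l e)) + β * f x - f q) +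
                        (f q + β * s * D - (1# + r) * α * eval l e₀)
                    ≈⟨ +-cong (+-congʳ (+-congʳ (*-congˡ (sym fe″))))
                          (+-congˡ (-‿cong (trans (*-congʳ [1+r]α≈1)
                          (trans (*-identityˡ _) (sym (proj₂ (piece e₀ e₀∈))))))) ⟩
                  (α * f e″ + β * f x - f q) + (f q + β * s * D - f e₀) ∎))
          where
          e e″ q : Point n
          e  = x +[ s ] ι v
          e″ = e₀ +[ r ] (e₀ ⊝ e)
          β : Carrier
          β = r * α
          q  = e₀ +[ β * s ] ι (ℤ.-_ ∘ v)
          0<β : 0# < β
          0<β = pos-* 0<r 0<α
          α+β≈1 : α + β ≈ 1#
          α+β≈1 = trans (solve 2 (λ α r → α :+ r :* α := (:1 :+ r) :* α) refl α r) [1+r]α≈1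
          q≋ : q ≋ comb α e″ β x
          q≋ i = begin
            e₀ i + β * s * fromℤ (ℤ.- v i)           ≈⟨ +-congˡ (*-congˡ (fromℤ-neg (v i))) ⟩
            e₀ i + β * s * - fromℤ (v i)             ≈⟨ +-congʳ (trans (*-congʳ [1+r]α≈1) (*-identityˡ (e₀ i))) ⟨
            (1# + r) * α * e₀ i + β * s * - fromℤ (v i)
              ≈⟨ solve 6 (λ e₀ r α x s v → (:1 :+ r) :* α :* e₀ :+ r :* α :* s :* :- v
                    := α :* (e₀ :+ r :* (e₀ :- (x :+ s :* v))) :+ r :* α :* x) refl
                   (e₀ i) r α (x i) s (fromℤ (v i)) ⟩
            α * (e₀ i + r * (e₀ i - (x i + s * fromℤ (v i)))) + β * x i ∎
          q∈ : Sᵒ q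
          q∈ = str-cong (λ i → sym (q≋ i)) (str-comb (<⇒≤ 0<α) 0<β α+β≈1 (proj₁ (piece e″ e″∈)) x∈)
          q-convex : f q ≤ α * f e″ + β * f x
          q-convex = convex (<⇒≤ 0<α) (<⇒≤ 0<β) α+β≈1 (proj₁ (piece e″ e″∈)) (str⇒inS x∈) q∈ q≋
          fe″ : f e″ ≈ eval l e₀ + r * (eval l e₀ - eval l e)
          fe″ = trans (proj₂ (piece e″ e″∈)) (trans (eval-move l e₀ r (e₀ ⊝ e)) (+-congˡ (*-congˡ (lin-⊝ l e₀ e))))

    -- The part of the face μ = 0 on which `l` attains the maximum. The equation is encoded by `μ`
    -- and its negative, the combination (-1) μ + 0 μ.
    pieceConstraints : Aff n → List (Aff n) → Aff n → List (Aff n)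
    pieceConstraints μ ls l = μ ∷ affComb (ℤ.- 1ℤ) μ 0ℤ μ ∷ μs ++ map (minus l) ls

    opaque
      -- One piece for each functional of the list; together they cover the face, so a common bound
      -- of the finitely many constants serves.
      face-bound : ∀ v μ → PolyOn f (Face μ) → ∃ (BoundedAlong v (Face μ))
      face-bound v μ (ls , h) with bound-All (λ l → BoundedAlong v (λ x → InS (pieceConstraints μ ls l) x))
          (λ c≤d b x s 0<s x∈ e∈ → ≤-trans (b x s 0<s x∈ e∈) (+-mono ≤-refl (*-monoˡ (<⇒≤ 0<s) c≤d)))
          (All.tabulate {xs = ls} (λ {l} l∈ → piece-bound v l (pieceConstraints μ ls l) (in-piece l l∈)))
        where
        in-piece : ∀ l → l ∈ ls → ∀ x → InS (pieceConstraints μ ls l) x → S x × f x ≈ eval l x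
        in-piece l l∈ x (0≤μ ∷ 0≤-μ ∷ rest) with AllP.++⁻ μs rest
        ... | x∈ , dominant with h x (x∈ , ≤-antisym (≤-by 0≤-μ (sym (trans (eval-affComb (ℤ.- 1ℤ) μ 0ℤ μ x)
                (trans (+-congʳ (*-congʳ (-‿cong fromℤ-1))) (solve 1 (λ m → :- :1 :* m :+ :0 :* m := :0 :- m)
                      refl (eval μ x)))))) 0≤μ)
        ...   | all , any with find any
        ...     | m , m∈ , fx≈mx = x∈ , ≤-antisym
                    (≤-by (All.lookup (AllP.map⁻ dominant) m∈)
                          (trans (+-congˡ (-‿cong fx≈mx)) (sym (eval-minus l m x))))
                    (All.lookup all l∈)
      ... | C , 0≤C , bounds = C , λ x s 0<s x∈ e∈face → on-face x s 0<s x∈ e∈face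
        where
        on-face : BoundedAlong v (Face μ) C
        on-face x s 0<s x∈ (e∈ , μe≈0) with h _ (e∈ , μe≈0)
        ... | all , any with find any
        ...   | l , l∈ , fe≈le = All.lookup bounds l∈ x s 0<s x∈
                (≤-reflexive (sym μe≈0) ∷
                 ≤-reflexive (sym (trans (eval-affComb (ℤ.- 1ℤ) μ 0ℤ μ e) (trans (+-cong (*-congˡ μe≈0) (*-congˡ μe≈0))
                   (solve 1 (λ a → a :* :0 :+ :0 :* :0 := :0) refl (fromℤ (ℤ.- 1ℤ)))))) ∷
                 AllP.++⁺ e∈ (AllP.map⁺ (All.map
                       (λ {m} me≤fe → ≤-respʳ (trans (+-congʳ fe≈le) (sym (eval-minus l m e))) (gap me≤fe)) all)))
          where
          e : Point n
          e = x +[ s ] ι v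

    opaque
      slope-bound : ∀ {x₀} → Sᵒ x₀ → All (λ μ → PolyOn f (Face μ)) μs → ∀ v →
                    ∃ λ C → ∀ l → Touching l → lin l (ι v) ≤ C
      slope-bound {x₀} x₀∈ faces v with line-lipschitz x₀ (str⇒inS x₀∈) v
        | bound-All (λ μ → BoundedAlong v (Face μ))
            (λ c≤d b x s 0<s x∈ e∈ → ≤-trans (b x s 0<s x∈ e∈) (+-mono ≤-refl (*-monoˡ (<⇒≤ 0<s) c≤d)))
            (All.map (λ {μ} → face-bound v μ) faces)
      ... | D , 0≤D , lip | B , 0≤B , bounds = D + B , bound
        where
        bound : ∀ l → Touching l → lin l (ι v) ≤ D + B
        bound l touching@(p , η , 0<η , box⊆ , f≈) with exit-point μs (ι v) (box⊆ p (box-centre (<⇒≤ 0<η)))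
        -- A recession direction does not depend on the base point, so the ray from `x₀` stays in
        -- `S` as well, and `slope-≤` compares `l` with `f` far out on it.
        ... | inj₁ recession = ≤-trans (slope-≤ λ t 0≤t →
                  let x∈ = All.zipWith (λ {μ} (q , r) → ≤-respʳ (sym (eval-move μ x₀ t (ι v)))
                        (<⇒≤ q ⊕ 0≤t ⊗ r)) (x₀∈ , recession)
                  in ≤-trans (≤-respˡ (eval-move l x₀ t (ι v)) (touching-minorant touching _ x∈))
                        (proj₁ (lip t 0≤t x∈)))
                (≤-by 0≤B (solve 2 (λ D B → D :+ B :- D := B) refl D B))
        ... | inj₂ (s , 0<s , e∈ , any) with find any
        ...   | μ , μ∈ , μe≈0 = ≤-trans (*-cancel-≤ 0<s (≤-by
                (gap (All.lookup bounds μ∈ p s 0<s (box⊆ p pp) (e∈ , μe≈0))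
                      ⊕ gap (≤-respˡ (eval-move l p s (ι v)) (touching-minorant touching _ e∈)))
                (trans (solve 5 (λ lp s L B fe → s :* B :- s :* L := lp :+ s :* B :- fe :+
                      (fe :- (lp :+ s :* L))) refl (eval l p) s (lin l (ι v)) B (f (p +[ s ] ι v)))
                  (+-congʳ (+-congʳ (+-congʳ (sym (f≈ p pp))))))))
                (≤-by 0≤D (solve 2 (λ D B → D :+ B :- B := D) refl D B))
          where
          pp : Box p η p
          pp = box-centre (<⇒≤ 0<η)

    opaque
      coefficients-bounded : ∀ {x₀} → Sᵒ x₀ → All (λ μ → PolyOn f (Face μ)) μs →
                             ∃ λ M → ∀ l → Touching l → ∀ i → ℤ.∣ coeff l i ∣ ℕ.≤ M
      coefficients-bounded x₀∈ faces with bound-All (λ i C → ∀ l → Touching l → fromℤ (coeff l i) ≤ C × - fromℤ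
            (coeff l i) ≤ C)
          (λ c≤d b l t → ≤-trans (proj₁ (b l t)) c≤d , ≤-trans (proj₂ (b l t)) c≤d) (All.universal both (allFin n))
        where
        both : ∀ i → ∃ λ C → ∀ l → Touching l → fromℤ (coeff l i) ≤ C × - fromℤ (coeff l i) ≤ C
        both i with slope-bound x₀∈ faces (unit i) | slope-bound x₀∈ faces (ℤ.-_ ∘ unit i)
        ... | C , hC | D , hD with upper C D
        ...   | E , C≤E , D≤E = E , λ l t → ≤-trans (≤-respˡ (lin-unit l i) (hC l t)) C≤E ,
                  ≤-trans (≤-respˡ (trans (lin-neg l (unit i)) (-‿cong (lin-unit l i))) (hD l t)) D≤E
      ... | C , _ , bounds with archimedean C
      ...   | M , C≤M = M , λ l t i → let b = All.lookup bounds (∈-allFin i) l t in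
              ∣∣≤ M (coeff l i) (fromℤ-≤-cancel {coeff l i} {+ M} (≤-trans (proj₁ b) C≤M))
                                (fromℤ-≤-cancel {ℤ.- coeff l i} {+ M}
                                      (≤-trans (≤-respˡ (sym (fromℤ-neg (coeff l i))) (proj₂ b)) C≤M))
        where
        ∣∣≤ : ∀ M k → k ℤ.≤ + M → ℤ.- k ℤ.≤ + M → ℤ.∣ k ∣ ℕ.≤ M
        ∣∣≤ M (+ k)    (ℤ.+≤+ p) _         = p
        ∣∣≤ M -[1+ k ] _         (ℤ.+≤+ p) = p

    opaque
      -- One touching functional for each slope that has any, chosen by excluded middle. It stands
      -- for all of them, because a touching functional is determined by its slope.
      representatives : ∀ (bs : List (Vector ℤ n)) → Σ (List (Aff n)) λ ls → All Touching ls ×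
        (∀ {b} k → b ∈ bs → Touching (aff b k) → Any (λ l → coeff l ≡ b) ls)
      representatives []       = [] , [] , λ _ ()
      representatives (b ∷ bs) with representatives bs | em {∃ λ k → Touching (aff b k)}
      ... | ls , all , any | yes (k , t) = aff b k ∷ ls , t ∷ all , λ where
              k (here ≡.refl) _ → here ≡.refl
              k (there b∈) t    → there (any k b∈ t)
      ... | ls , all , any | no none = ls , all , λ where
              k (here ≡.refl) t → ⊥-elim (none (k , t))
              k (there b∈) t    → any k b∈ t

    opaque
      -- If `l` and `m` have the same slope and `m` touches at `q`, then l q ≤ f q = m q; the
      -- difference being constant, l ≤ m everywhere.
      touching-list : ∀ {x₀} → Sᵒ x₀ → All (λ μ → PolyOn f (Face μ)) μs →
        Σ (List (Aff n)) λ ls → All Touching ls × (∀ l → Touching l → ∀ y → Any (λ m → eval l y ≤ eval m y) ls)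
      touching-list x₀∈ faces with coefficients-bounded x₀∈ faces
      ... | M , bounded with representatives (box-vectors M n)
      ...   | ls , all , represented = ls , all , covered
        where
        covered : ∀ l → Touching l → ∀ y → Any (λ m → eval l y ≤ eval m y) ls
        covered l touching@(p , η , 0<η , box⊆ , f≈) y with find (box-vectors-complete M (coeff l) (bounded l touching))
        ... | b , b∈ , b≗l = Any.map dominates
              (find-touching (represented (const l) b∈ (p , η , 0<η , box⊆ , λ z bz → trans (f≈ z bz)
              (sym (+-congʳ (lin-b≈ z))))))
          where
          lin-b≈ : ∀ {k} z → lin (aff b k) z ≈ lin l z
          lin-b≈ z = lin-coeff-cong z b≗l
          find-touching : Any (λ m → coeff m ≡ b) ls → Any (λ m → coeff m ≡ b × Touching m) ls
          find-touching any with find any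
          ... | m , m∈ , e = lose m∈ (e , All.lookup all m∈)
          dominates : ∀ {m} → coeff m ≡ b × Touching m → eval l y ≤ eval m y
          dominates {m} (e , q , ρ , 0<ρ , box⊆′ , f≈′) = ≤-by
              (gap (≤-respʳ (f≈′ q qq) (touching-minorant touching q (str⇒inS (box⊆′ q qq)))))
              (trans (solve 4 (λ L M c d → M :+ d :- (L :+ c) := (M :- L) :+ (d :- c))
                    refl (lin l y) (lin m y) (const l) (const m))
              (trans (+-congʳ (trans (+-congˡ (-‿cong (same-slope y))) (-‿inverseʳ (lin m y))))
              (trans (+-congʳ (sym (trans (+-congˡ (-‿cong (same-slope q))) (-‿inverseʳ (lin m q)))))
                (solve 4 (λ L M c d → (M :- L) :+ (d :- c) := M :+ d :- (L :+ c))
                      refl (lin l q) (lin m q) (const l) (const m)))))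
            where
            qq : Box q ρ q
            qq = box-centre (<⇒≤ 0<ρ)
            same-slope : ∀ z → lin l z ≈ lin m z
            same-slope z = lin-coeff-cong {l = l} {m} z λ i → ≡.trans (≡.sym (b≗l i)) (≡.cong (λ a → a i) (≡.sym e))

    opaque
      -- An integral direction from `x` reaches a strict point near `x₀` after time t₀. Each
      -- constraint is nonnegative at `x` and positive there, hence positive at every earlier t > 0.
      inward : ∀ {x₀} → Sᵒ x₀ → ∀ x → S x → ∃₂ λ v t₀ → 0# < t₀ × ∀ t → 0# < t → t ≤ t₀ → Sᵒ (x +[ t ] ι v)
      inward {x₀} x₀∈ x x∈ with near-str x₀ x₀∈
      ... | ε , 0<ε , inner with integral-direction x x₀ 0<ε
      ...   | v , t₀ , 0<t₀ , b = v , t₀ , 0<t₀ , λ t 0<t t≤t₀ →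
            All.zipWith (λ {μ} (q , r) μ≤0 → pos-+ (pos-* 0<t r) (gap t≤t₀ ⊗ q) (≤-by (<⇒≤ 0<t₀ ⊗ gap μ≤0)
                (trans (+-congˡ (-‿cong (+-congʳ (*-congˡ (eval-move μ x t₀ (ι v))))))
                (trans (solve 4 (λ m L t s → :0 :- (t :* (m :+ s :* L) :+ (s :- t) :* m)
                      := s :* (:0 :- (m :+ t :* L))) refl (eval μ x) (lin μ (ι v)) t t₀)
                  (*-congˡ (+-congˡ (-‿cong (sym (eval-move μ x t (ι v))))))))))
              (x∈ , inner ε (<⇒≤ 0<ε) ≤-refl _ b)

    opaque
      -- The functional of the list that is greatest at `z` is chosen before ε, so the
      -- approximations up to every ε all apply to it.
      attained-inside : ∀ ls → (∀ l → Touching l → ∀ y → Any (λ m → eval l y ≤ eval m y) ls) →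
                        ∀ z → Sᵒ z → Any (λ m → f z ≤ eval m z) ls
      attained-inside ls covered z z∈ with touching-approximates z z∈ 1# 0<1
      -- The approximation with error 1 only serves to show that `ls` is nonempty.
      ... | l , t , _ with greatest (λ m → eval m z) {λ _ → ⊤} ls (Any.map (λ _ → tt) (covered l t z))
      ...   | m , m∈ , _ , best = lose m∈ (≤-of-small 1# approx)
        where
        approx : ∀ ε → 0# < ε → f z ≤ eval m z + 1# * ε
        approx ε 0<ε with touching-approximates z z∈ ε 0<ε
        ... | k , t , fz≤ with find (covered k t z)
        ...   | k′ , k′∈ , kz≤ = ≤-trans fz≤ (+-mono (≤-trans kz≤ (All.lookup best k′∈ tt))
              (≤-reflexive (sym (*-identityˡ ε))))

    opaque
      -- At boundary points, approach `x` from inside along an integral ray. Up to time t, `f` drops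
      -- by at most t D and a functional of the list rises by at most t B, hence the error (B + D)
      -- ε.
      attained : ∀ {x₀} → Sᵒ x₀ → ∀ ls → (∀ l → Touching l → ∀ y → Any (λ m → eval l y ≤ eval m y) ls) →
                 ∀ x → S x → Any (λ m → f x ≤ eval m x) ls
      attained x₀∈ ls covered x x∈ with inward x₀∈ x x∈
      ... | v , t₀ , 0<t₀ , inside with line-lipschitz x x∈ v
             | bound-All (λ l B → lin l (ι v) ≤ B) (λ c≤d p → ≤-trans p c≤d)
                   (All.universal (λ l → lin l (ι v) , ≤-refl) ls)
             | greatest (λ m → eval m x) {λ _ → ⊤} ls
                   (Any.map (λ _ → tt) (attained-inside ls covered _ (inside t₀ 0<t₀ ≤-refl)))
      ...   | D , 0≤D , lip | B , 0≤B , flat | m , m∈ , _ , best = lose m∈ (≤-of-small (B + D) approx)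
        where
        approx : ∀ ε → 0# < ε → f x ≤ eval m x + (B + D) * ε
        approx ε 0<ε with min⁺ ε t₀ 0<ε 0<t₀
        ... | t , 0<t , t≤ε , t≤t₀ with find (attained-inside ls covered _ (inside t 0<t t≤t₀))
        ...   | k , k∈ , fz≤ = ≤-by
                (gap (proj₂ (lip t (<⇒≤ 0<t) (str⇒inS (inside t 0<t t≤t₀))))
                      ⊕ gap (≤-respʳ (eval-move k x t (ι v)) fz≤) ⊕
                 gap (All.lookup best k∈ tt) ⊕ <⇒≤ 0<t ⊗ gap (All.lookup flat k∈) ⊕ (0≤B ⊕ 0≤D) ⊗ gap t≤ε)
                (solve 9 (λ fx fz kx mx L B D t ε → mx :+ (B :+ D) :* ε :- fx :=
                    (fz :+ t :* D :- fx) :+ (kx :+ t :* L :- fz) :+ (mx :- kx) :+ t :* (B :- L) :+ (B :+ D) :*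
                          (ε :- t)) refl
                  (f x) (f (x +[ t ] ι v)) (eval k x) (eval m x) (lin k (ι v)) B D t ε)

    opaque
      full-dimensional : ∀ {x₀} → Sᵒ x₀ → All (λ μ → PolyOn f (Face μ)) μs → PolyOn f S
      full-dimensional x₀∈ faces with touching-list x₀∈ faces
      ... | ls , touching , covered = ls , λ x x∈ → All.map (λ {l} t → touching-minorant t x x∈) touching ,
            equality x x∈
        where
        equality : ∀ x → S x → Any (λ l → f x ≈ eval l x) ls
        equality x x∈ with find (attained x₀∈ ls covered x x∈)
        ... | l , l∈ , fx≤lx = lose l∈ (≤-antisym fx≤lx (touching-minorant (All.lookup touching l∈) x x∈))

-- Induction on the number of constraints

module Induction (em : ExcludedMiddle 0ℓ) (K : ArchimedeanField) where
  open FullDimensional em K public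
  open import Relation.Binary.Reasoning.Setoid setoid

  -- All functions at once, because the induction passes from `f` to its composite with a
  -- projection.
  PolyhedralFor : ∀ {n} → List (Aff n) → Set
  PolyhedralFor {n} μs = ∀ (f : Point n → Carrier) → Respects f → LineHyp f μs → PolyOn f (InS μs)

  -- Pulling back along π makes a face of S a polyhedron in the whole space with one constraint fewer.
  module Projection {n : ℕ} (ν : Aff n) (w : Vector ℤ n) (νw≡1 : dot (coeff ν) w ≡ 1ℤ) where

    π : Point n → Point n
    π x = x +[ - eval ν x ] ι w

    -- The composite of `l` with `π`, namely l - (l · w) ν; it is integral because `w` is.
    pull : Aff n → Aff n
    pull l = affComb 1ℤ l (ℤ.- dot (coeff l) w) ν

    opaque
      π-cong : ∀ {x y} → x ≋ y → π x ≋ π y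
      π-cong x≋y i = +-cong (x≋y i) (*-congʳ (-‿cong (eval-cong ν x≋y)))

    opaque
      eval-pull : ∀ l x → eval (pull l) x ≈ eval l (π x)
      eval-pull l x = begin
        eval (pull l) x                                                ≈⟨ eval-affComb 1ℤ l (ℤ.- dot (coeff l) w) ν x ⟩
        fromℤ 1ℤ * eval l x + fromℤ (ℤ.- dot (coeff l) w) * eval ν x   ≈⟨ +-cong (*-congʳ fromℤ-1)
              (*-congʳ (trans (fromℤ-neg (dot (coeff l) w)) (-‿cong (fromℤ-dot (coeff l) (const l) w)))) ⟩
        1# * eval l x + - lin l (ι w) * eval ν x                       ≈⟨
              solve 3 (λ l k m → :1 :* l :+ :- k :* m := l :+ :- m :* k) refl (eval l x) (lin l (ι w)) (eval ν x) ⟩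
        eval l x + - eval ν x * lin l (ι w)                            ≈⟨ eval-move l x (- eval ν x) (ι w) ⟨
        eval l (π x)                                                   ∎

    opaque
      π-on : ∀ x → eval ν (π x) ≈ 0#
      π-on x = begin
        eval ν (π x)                             ≈⟨ eval-move ν x (- eval ν x) (ι w) ⟩
        eval ν x + - eval ν x * lin ν (ι w)      ≈⟨ +-congˡ
              (*-congˡ (trans (sym (fromℤ-dot (coeff ν) (const ν) w))
              (trans (reflexive (≡.cong fromℤ νw≡1)) fromℤ-1))) ⟩
        eval ν x + - eval ν x * 1#               ≈⟨ solve 1 (λ e → e :+ :- e :* :1 := :0) refl (eval ν x) ⟩
        0#                                       ∎

    opaque
      π-fixes : ∀ {x} → eval ν x ≈ 0# → π x ≋ x
      π-fixes {x} νx≈0 i = trans (+-congˡ (*-congʳ (-‿cong νx≈0))) (solve 2 (λ x w → x :+ :- :0 :* w := x)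
            refl (x i) (fromℤ (w i)))

    -- The image of `v` under the linear part of `π`; it is zero when `v` is a multiple of `w`.
    direction : Vector ℤ n → Vector ℤ n
    direction v i = v i ℤ.+ ℤ.- (dot (coeff ν) v ℤ.* w i)

    opaque
      π-line : ∀ {x} p t v → x ≋ p +[ t ] ι v → π x ≋ π p +[ t ] ι (direction v)
      π-line {x} p t v x≋ i = begin
        x i + - eval ν x * fromℤ (w i)
          ≈⟨ +-cong (x≋ i) (*-congʳ (-‿cong
                (trans (eval-cong ν x≋) (trans (eval-move ν p t (ι v))
                (+-congˡ (*-congˡ (sym (fromℤ-dot (coeff ν) (const ν) v)))))))) ⟩
        p i + t * fromℤ (v i) + - (eval ν p + t * fromℤ (dot (coeff ν) v)) * fromℤ (w i)
          ≈⟨ solve 6 (λ p t v e d w → p :+ t :* v :+ :- (e :+ t :* d) :* w := p :+ :- e :* w :+ t :*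
                (v :+ :- (d :* w))) refl (p i) t (fromℤ (v i)) (eval ν p) (fromℤ (dot (coeff ν) v)) (fromℤ (w i)) ⟩
        p i + - eval ν p * fromℤ (w i) + t * (fromℤ (v i) + - (fromℤ (dot (coeff ν) v) * fromℤ (w i)))
          ≈⟨ +-congˡ (*-congˡ (trans (fromℤ-+ (v i) _)
                (+-congˡ (trans (fromℤ-neg (dot (coeff ν) v ℤ.* w i)) (-‿cong (fromℤ-* (dot (coeff ν) v) (w i))))))) ⟨
        π p i + t * fromℤ (direction v i) ∎

    opaque
      inS-pull : ∀ {zs x} → InS (map pull zs) x → InS zs (π x)
      inS-pull {x = x} = All.map (λ {l} → ≤-respʳ (eval-pull l x)) ∘ AllP.map⁻

    opaque
      pull-inS : ∀ {zs x} → eval ν x ≈ 0# → InS zs x → InS (map pull zs) x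
      pull-inS {x = x} νx≈0 = AllP.map⁺ ∘ All.map
            (λ {l} → ≤-respʳ (sym (trans (eval-pull l x) (eval-cong l (π-fixes νx≈0)))))

    opaque
      pull-PolyOn : ∀ {f : Point n → Carrier} {T U : Pred (Point n) 0ℓ} → (∀ x → U x → T (π x)) → PolyOn f T →
            PolyOn (f ∘ π) U
      pull-PolyOn {f} U⊆ (ls , h) = map pull ls , λ x x∈ →
        AllP.map⁺ (All.map (λ {l} → ≤-respˡ (sym (eval-pull l x))) (proj₁ (h (π x) (U⊆ x x∈)))) ,
        AnyP.map⁺ (Any.map (λ {l} p → trans p (sym (eval-pull l x))) (proj₂ (h (π x) (U⊆ x x∈))))

    opaque
      -- Since `π` maps integral lines to integral lines or points, `f ∘ π` inherits the line
      -- hypothesis. On the hyperplane `π` is the identity, so a representation of `f ∘ π` restricts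
      -- to one of `f`.
      hyperplane-section : ∀ {μs zs} → PolyhedralFor (map pull zs) →
        (∀ x → InS zs x → eval ν x ≈ 0# → InS μs x) → (∀ x → InS μs x → InS zs x) →
        (f : Point n → Carrier) → Respects f → LineHyp f μs →
        PolyOn f (λ x → InS μs x × eval ν x ≈ 0#)
      hyperplane-section {μs} {zs} ih to from f f-cong line = section (ih (f ∘ π) (f-cong ∘ π-cong) line′)
        where
        into : ∀ x → InS (map pull zs) x → InS μs (π x)
        into x x∈ = to (π x) (inS-pull x∈) (π-on x)
        line′ : LineHyp (f ∘ π) (map pull zs)
        line′ p p∈ v = pull-PolyOn (λ x (x∈ , t , x≋) → into x x∈ , t , π-line p t v x≋)
              (line (π p) (into p p∈) (direction v))
        section : PolyOn (f ∘ π) (InS (map pull zs)) → PolyOn f (λ x → InS μs x × eval ν x ≈ 0#)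
        section (ls , h) = ls , λ x (x∈ , νx≈0) →
          let all , any = h x (pull-inS νx≈0 (from x x∈))
              fπx≈fx = f-cong (π-fixes νx≈0)
          in All.map (≤-respʳ fπx≈fx) all , Any.map (trans (sym fπx≈fx)) any

  opaque
    eval-constant : ∀ {n} (μ : Aff n) → (∀ i → coeff μ i ≡ 0ℤ) → ∀ x y → eval μ x ≈ eval μ y
    eval-constant μ zeros x y = +-congʳ (trans (lin-0 μ x zeros) (sym (lin-0 μ y zeros)))

  opaque
    PolyOn-⊆ : ∀ {n} {f : Point n → Carrier} {T U : Pred (Point n) 0ℓ} → (∀ x → U x → T x) → PolyOn f T → PolyOn f U
    PolyOn-⊆ U⊆T (ls , h) = ls , λ x x∈ → h x (U⊆T x x∈)

  opaque
    face-polyhedral : ∀ {n} m → (∀ (zs : List (Aff n)) → length zs ≡ m → PolyhedralFor zs) →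
      ∀ μs {μ} → length μs ≡ suc m → μ ∈ μs → (f : Point n → Carrier) → Respects f → LineHyp f μs →
      PolyOn f (λ x → InS μs x × eval μ x ≈ 0#)
    face-polyhedral {n} m ih μs {μ} len μ∈ f f-cong line with ∈-∃++ μ∈
    ... | xs , ys , ≡.refl = by-slope (FinP.all? (λ i → coeff μ i ℤP.≟ 0ℤ))
      where
      Face : Pred (Point n) 0ℓ
      Face x = InS (xs ++ μ ∷ ys) x × eval μ x ≈ 0#
      from : ∀ x → InS (xs ++ μ ∷ ys) x → InS (xs ++ ys) x
      from x x∈ with AllP.++⁻ xs x∈
      ... | p , _ ∷ q = AllP.++⁺ p q
      to : ∀ x → InS (xs ++ ys) x → eval μ x ≈ 0# → InS (xs ++ μ ∷ ys) x
      to x x∈ μx≈0 with AllP.++⁻ xs x∈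
      ... | p , q = AllP.++⁺ p (≤-reflexive (sym μx≈0) ∷ q)
      len′ : length (xs ++ ys) ≡ m
      len′ = ℕP.suc-injective (≡.trans (≡.sym (ListP.length-++-sucʳ xs μ ys)) len)
      by-slope : Dec (∀ i → coeff μ i ≡ 0ℤ) → PolyOn f Face
      by-slope (yes zeros) with em {∃ Face}
      ... | no empty = [] , λ x x∈ → ⊥-elim (empty (x , x∈))
      ... | yes (x₀ , _ , μx₀≈0) = PolyOn-⊆ (λ x (x∈ , _) → from x x∈) (ih (xs ++ ys) len′ f f-cong line′)
        where
        to′ : ∀ x → InS (xs ++ ys) x → InS (xs ++ μ ∷ ys) x
        to′ x x∈ = to x x∈ (trans (eval-constant μ zeros x x₀) μx₀≈0)
        line′ : LineHyp f (xs ++ ys)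
        line′ p p∈ v = PolyOn-⊆ (λ x (x∈ , x≋) → to′ x x∈ , x≋) (line p (to′ p p∈) v)
      by-slope (no nonzero) with primitive-part (coeff μ) nonzero
      ... | g , a , w , g≢0 , μ≡ga , aw≡1 with invertible (fromℤ g) (λ p → g≢0 (fromℤ≈0⇒≡0 p))
      ...   | d , gd≈1 = PolyOn-⊆ (λ x (x∈ , μx≈0) → x∈ , *-cancel-≈0 (λ p → g≢0 (fromℤ≈0⇒≡0 p))
            (trans (sym (μ≈gν x)) μx≈0))
              (hyperplane-section {zs = xs ++ ys} (ih _ (≡.trans (ListP.length-map pull (xs ++ ys)) len′))
                (λ x x∈ νx≈0 → to x x∈ (trans (μ≈gν x) (trans (*-congˡ νx≈0) (zeroʳ (fromℤ g))))) from f f-cong line)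
        where
        ν : Aff n
        ν = aff a (d * const μ)
        open Projection ν w aw≡1
        μ≈gν : ∀ x → eval μ x ≈ fromℤ g * eval ν x
        μ≈gν x = begin
          lin μ x + const μ
            ≈⟨ +-cong (lin-coeff-+ μ (fromℤ g) a 0# a (d * const μ) x (λ i → trans (reflexive (≡.cong fromℤ (μ≡ga i)))
                 (trans (fromℤ-* g (a i)) (solve 2 (λ g a → g :* a := g :* a :+ :0 :* a)
                       refl (fromℤ g) (fromℤ (a i))))))
                 (sym (trans (*-congʳ gd≈1) (*-identityˡ (const μ)))) ⟩
          fromℤ g * lin ν x + 0# * lin ν x + fromℤ g * d * const μ
            ≈⟨ solve 4 (λ g L d c → g :* L :+ :0 :* L :+ g :* d :* c := g :* (L :+ d :* c))
                  refl (fromℤ g) (lin ν x) d (const μ) ⟩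
          fromℤ g * eval ν x ∎

  opaque
    -- At a relative interior point either all constraints are positive, and the faces are problems
    -- with fewer constraints, or some constraint vanishes throughout, and `S` is its own face
    -- there.
    polyhedral : ∀ {n} m (μs : List (Aff n)) → length μs ≡ m → PolyhedralFor μs
    polyhedral m μs len f f-cong line with em {∃ (InS μs)}
    ... | no empty = [] , λ x x∈ → ⊥-elim (empty (x , x∈))
    ... | yes inhabited with relative-interior-point (InS μs) (λ 0≤h hh≈1 → inS-comb 0≤h 0≤h hh≈1) inhabited μs
          (λ _ r → r)
    ...   | x₀ , x₀∈ , signs with allOrAny signs
    polyhedral zero    [] len f f-cong line | yes _ | x₀ , x₀∈ , signs | inj₁ x₀-inside = Faces.full-dimensional
          [] f f-cong line x₀-inside []
    polyhedral (suc m) μs len f f-cong line | yes _ | x₀ , x₀∈ , signs | inj₁ x₀-inside =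
      Faces.full-dimensional μs f f-cong line x₀-inside
        (All.tabulate λ μ∈ → face-polyhedral m (polyhedral m) μs len μ∈ f f-cong line)
    polyhedral (suc m) μs len f f-cong line | yes _ | x₀ , x₀∈ , signs | inj₂ vanishing with find vanishing
    ... | μ , μ∈ , μ≈0 = PolyOn-⊆ (λ x x∈ → x∈ , μ≈0 x x∈) (face-polyhedral m (polyhedral m) μs len μ∈ f f-cong line)

-- A subfield of the reals as an archimedean ordered field

realOrderedField : RealField → OrderedField
realOrderedField R = record
  { commutativeRing = commutativeRing
  ; 1≉0             = 1≉0
  ; invertible      = λ x x≉0 → let y , _ , xy≈1 = invertible x x≉0 in y , xy≈1
  ; _≤_             = _≤_
  ; isTotalOrder    = isTotalOrder
  ; +-monoˡ-≤       = +-monoˡ-≤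
  ; *-nonneg        = *-nonneg
  }
  where open RealField R

module Reals (em : ExcludedMiddle 0ℓ) (R : RealField) where
  open RealField R using (UpperBound; complete)
  open Functionals em (realOrderedField R) public

  opaque
    -- If the multiples of 1 were bounded, their supremum less 1 would be a smaller upper bound.
    real-archimedean : ∀ x → ∃ λ n → x ≤ n · 1#
    real-archimedean x with em {∃ λ n → x ≤ n · 1#}
    ... | yes p = p
    ... | no ¬p = contradiction (complete multiples (0# , 0 , refl) (x , bounded))
      where
      multiples : Pred Carrier 0ℓ
      multiples y = ∃ λ n → y ≈ n · 1#
      bounded : UpperBound multiples x
      bounded y (n , y≈n) with ≤-total y x
      ... | inj₁ y≤x = y≤x
      ... | inj₂ x≤y = ⊥-elim (¬p (n , ≤-respʳ y≈n x≤y))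
      contradiction : (∃ λ s → UpperBound multiples s × (∀ u → UpperBound multiples u → s ≤ u)) → ∃ λ n → x ≤ n · 1#
      contradiction (s , above , least) = ⊥-elim (0<1 (≤-by (gap (least (s - 1#) λ y (n , y≈n) →
          ≤-respˡ (sym y≈n) (≤-by (gap (above (suc n · 1#) (suc n , refl)))
                (solve 2 (λ s n → s :- :1 :- n := s :- (:1 :+ n)) refl s (n · 1#)))))
        (solve 1 (λ s → :0 :- :1 := s :- :1 :- s) refl s)))

module SubfieldOfReals (em : ExcludedMiddle 0ℓ) (R : RealField) (F : Subfield R) where
  private
    module R = Reals em R
    module F = Subfield F

  private
    -- Equality ignores the membership proofs, so the first projection is injective and the ring
    -- laws descend from ℝ.
    rawRing : RawRing 0ℓ 0ℓ
    rawRing = record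
      { Carrier = Σ R.Carrier F.member
      ; _≈_     = λ x y → proj₁ x R.≈ proj₁ y
      ; _+_     = λ x y → proj₁ x R.+ proj₁ y , F.+-closed (proj₂ x) (proj₂ y)
      ; _*_     = λ x y → proj₁ x R.* proj₁ y , F.*-closed (proj₂ x) (proj₂ y)
      ; -_      = λ x → R.- proj₁ x , F.neg-closed (proj₂ x)
      ; 0#      = R.0# , F.0-closed
      ; 1#      = R.1# , F.1-closed
      }

    inclusion : IsRingMonomorphism rawRing (CommutativeRing.rawRing R.commutativeRing) proj₁
    inclusion = record
      { isRingHomomorphism = record
        { isSemiringHomomorphism = record
          { isNearSemiringHomomorphism = record
            { +-isMonoidHomomorphism = record
              { isMagmaHomomorphism = record { isRelHomomorphism = record { cong = id } ; homo = λ _ _ → R.refl }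
              ; ε-homo = R.refl
              }
            ; *-homo = λ _ _ → R.refl
            }
          ; 1#-homo = R.refl
          }
        ; -‿homo = λ _ → R.refl
        }
      ; injective = id
      }

  subfieldOrdered : OrderedField
  subfieldOrdered = record
    { commutativeRing = record
      { isCommutativeRing = RingMonomorphism.isCommutativeRing inclusion R.isCommutativeRing }
    ; 1≉0          = R.1≉0
    ; invertible   = λ (x , x∈) x≉0 → let y , xy≈1 = R.invertible x x≉0 in (y , F.inverse-closed xy≈1 x∈) , xy≈1
    ; _≤_          = λ x y → proj₁ x R.≤ proj₁ y
    ; isTotalOrder = On.isTotalOrder proj₁ R.isTotalOrder
    ; +-monoˡ-≤    = λ z → R.+-monoˡ-≤ (proj₁ z)
    ; *-nonneg     = R.*-nonneg
    }

  private
    module K = OrderedField subfieldOrdered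

  proj₁-· : ∀ n → proj₁ (n K.· K.1#) ≡ n R.· R.1#
  proj₁-· zero    = ≡.refl
  proj₁-· (suc n) = ≡.cong (R._+_ R.1#) (proj₁-· n)

  subfield : ArchimedeanField
  subfield = record
    { orderedField = subfieldOrdered
    ; archimedean  = λ (x , _) → let n , x≤n = R.real-archimedean x in n , R.≤-respʳ
          (R.reflexive (≡.sym (proj₁-· n))) x≤n
    }

  proj₁-fromℤ : ∀ k → proj₁ (K.fromℤ k) ≡ R.fromℤ k
  proj₁-fromℤ (+ n)    = proj₁-· n
  proj₁-fromℤ -[1+ n ] = ≡.cong R.-_ (proj₁-· (suc n))

  fromℤ-closed : ∀ k → F.member (R.fromℤ k)
  fromℤ-closed k = F.resp-≈ (R.reflexive (proj₁-fromℤ k)) (proj₂ (K.fromℤ k))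

  proj₁-sum : ∀ {n} (v : Vector K.Carrier n) → proj₁ (K.sum v) ≡ R.sum (proj₁ ∘ v)
  proj₁-sum {zero}  v = ≡.refl
  proj₁-sum {suc n} v = ≡.cong (R._+_ (proj₁ (v zero))) (proj₁-sum (v ∘ suc))

-- From functions over F back to the real statement

module Transfer (em : ExcludedMiddle 0ℓ) (R : RealField) (F : Subfield R) where
  open SubfieldOfReals em R F using (subfield; subfieldOrdered; proj₁-sum; proj₁-fromℤ; fromℤ-closed)
  private
    module R = Reals em R
    module F = Subfield F
    module K = Induction em subfield
    module D = RealField R
  open Polyhedral R F

  forget : ∀ {n} → K.Point n → Point n
  forget y i = proj₁ (y i)

  fromℤ-agrees : ∀ k → D.fromℤ k ≡ R.fromℤ k
  fromℤ-agrees (+ n)    = ≡.refl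
  fromℤ-agrees -[1+ n ] = ≡.refl

  real : ∀ {n} → IntegralFunctional n → R.Aff n
  real l = R.aff (coeff l) (const l)

  opaque
    unfolding R.lin

    eval-real : ∀ {n} (l : IntegralFunctional n) x → eval l x R.≈ R.eval (real l) x
    eval-real l x = R.+-congʳ (MonoidSum.sum-cong-≋ R.+-commutativeMonoid
          (λ i → R.*-congʳ (R.reflexive (fromℤ-agrees (coeff l i)))))

  fromIntegral : ∀ {n} → IntegralFunctional n → K.Aff n
  fromIntegral l = K.aff (coeff l) (const l , const∈F l)

  toIntegral : ∀ {n} → K.Aff n → IntegralFunctional n
  toIntegral l = record { coeff = K.coeff l ; const = proj₁ (K.const l) ; const∈F = proj₂ (K.const l) }

  opaque
    unfolding K.lin

    eval-toIntegral : ∀ {n} (l : K.Aff n) y → proj₁ (K.eval l y) R.≈ eval (toIntegral l) (forget y)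
    eval-toIntegral l y = R.+-congʳ (R.trans (R.reflexive (proj₁-sum (λ i → K.fromℤ (K.coeff l i) K.* y i)))
      (MonoidSum.sum-cong-≋ R.+-commutativeMonoid
            (λ i → R.*-congʳ (R.reflexive (≡.trans (proj₁-fromℤ (K.coeff l i)) (≡.sym (fromℤ-agrees (K.coeff l i))))))))

  module RationalLine {n : ℕ} (p : K.Point (suc n)) (v : Vector ℤ (suc n)) (k : Fin (suc n)) (vₖ≢0 : ¬ v k ≡ 0ℤ) where
    open R using (_≈_; _+_; _*_; _-_; -_; 0#; 1#; sym; trans; refl; solve; _:=_; _:+_; _:*_; _:-_; :-_; :0; :1)

    Line : Pred (Point (suc n)) 0ℓ
    Line x = ∃ λ t → ∀ i → x i ≈ forget p i + t * R.ι v i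

    private
      fromℤ-vₖ≉0 : ¬ R.fromℤ (v k) ≈ 0#
      fromℤ-vₖ≉0 q = vₖ≢0 (R.fromℤ≈0⇒≡0 q)

    -- `s` times the 2×2 minor of x - p and v in the rows j and k. As v k is nonzero, these minors
    -- cut out the line, and s = 1 and s = -1 give the two halfspaces of each equation.
    minor : ℤ → Fin (suc n) → IntegralFunctional (suc n)
    minor s j = record
      { coeff   = λ m → s ℤ.* v k ℤ.* unit j m ℤ.+ ℤ.- (s ℤ.* v j) ℤ.* unit k m
      ; const   = - (R.fromℤ s * (R.fromℤ (v k) * forget p j + - (R.fromℤ (v j) * forget p k)))
      ; const∈F = F.neg-closed (F.*-closed (fromℤ-closed s)
          (F.+-closed (F.*-closed (fromℤ-closed (v k)) (proj₂ (p j)))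
                (F.neg-closed (F.*-closed (fromℤ-closed (v j)) (proj₂ (p k))))))
      }

    opaque
      eval-minor : ∀ s j x → eval (minor s j) x ≈
        R.fromℤ s * (R.fromℤ (v k) * (x j - forget p j) - R.fromℤ (v j) * (x k - forget p k))
      eval-minor s j x = begin
        eval (minor s j) x                               ≈⟨ eval-real (minor s j) x ⟩
        R.lin (real (minor s j)) x + const (minor s j)   ≈⟨ R.+-congʳ (trans (R.lin-const (coeff (minor s j)) _ _ x)
          (trans (R.lin-affComb (s ℤ.* v k) (R.aff (unit j) 0#) (ℤ.- (s ℤ.* v j)) (R.aff (unit k) 0#) x)
            (R.+-cong (R.*-cong (R.fromℤ-* s (v k)) (R.lin-coordinate j 0# x))
                      (R.*-cong (trans (R.fromℤ-neg (s ℤ.* v j)) (R.-‿cong (R.fromℤ-* s (v j))))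
                            (R.lin-coordinate k 0# x))))) ⟩
        R.fromℤ s * R.fromℤ (v k) * x j + - (R.fromℤ s * R.fromℤ (v j)) * x k + const (minor s j)
          ≈⟨ solve 7 (λ s a b xj xk pj pk → s :* a :* xj :+ :- (s :* b) :* xk :+ :-
                (s :* (a :* pj :+ :- (b :* pk))) := s :* (a :* (xj :- pj) :- b :* (xk :- pk))) refl
               (R.fromℤ s) (R.fromℤ (v k)) (R.fromℤ (v j)) (x j) (x k) (forget p j) (forget p k) ⟩
        R.fromℤ s * (R.fromℤ (v k) * (x j - forget p j) - R.fromℤ (v j) * (x k - forget p k)) ∎
        where open import Relation.Binary.Reasoning.Setoid R.setoid

    opaque
      minor-nonconstant : ∀ s → ¬ s ≡ 0ℤ → ∀ i → NonConstant (minor s (punchIn k i))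
      minor-nonconstant s s≢0 i zeros = [ s≢0 , vₖ≢0 ]′ (ℤP.i*j≡0⇒i≡0∨j≡0 s (≡.trans (≡.sym coefficient) (zeros j)))
        where
        j : Fin (suc n)
        j = punchIn k i
        coefficient : coeff (minor s j) j ≡ s ℤ.* v k
        coefficient = ≡.trans (≡.cong₂ ℤ._+_ (≡.trans (≡.cong (s ℤ.* v k ℤ.*_) (unit-same j))
              (ℤP.*-identityʳ (s ℤ.* v k)))
            (≡.trans (≡.cong (ℤ.- (s ℤ.* v j) ℤ.*_) (unit-other (FinP.punchInᵢ≢i k i ∘ ≡.sym)))
                  (ℤP.*-zeroʳ (ℤ.- (s ℤ.* v j)))))
          (ℤP.+-identityʳ (s ℤ.* v k))

    minors : ℤ → List (IntegralFunctional (suc n))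
    minors s = map (λ i → minor s (punchIn k i)) (allFin n)

    opaque
      on-line⇒minors : ∀ s {x} → Line x → All (λ l → x ∈ᴾ Halfspace l) (minors s)
      on-line⇒minors s {x} (t , x≈) = AllP.map⁺
            (All.universal (λ i → R.≤-reflexive (sym (vanishes (punchIn k i)))) (allFin n))
        where
        vanishes : ∀ j → eval (minor s j) x ≈ 0#
        vanishes j = trans (eval-minor s j x)
              (trans (R.*-congˡ (R.+-cong (R.*-congˡ (R.+-congʳ (x≈ j))) (R.-‿cong (R.*-congˡ (R.+-congʳ (x≈ k))))))
          (solve 6 (λ s a b t q r → s :* (a :* (q :+ t :* b :- q) :- b :* (r :+ t :* a :- r)) := :0) refl
            (R.fromℤ s) (R.fromℤ (v k)) (R.fromℤ (v j)) t (forget p j) (forget p k)))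

    opaque
      minors⇒on-line : ∀ {x} → All (λ l → x ∈ᴾ Halfspace l) (minors 1ℤ) → All (λ l → x ∈ᴾ Halfspace l)
            (minors (ℤ.- 1ℤ)) → Line x
      minors⇒on-line {x} pos neg with R.invertible (R.fromℤ (v k)) fromℤ-vₖ≉0
      -- The parameter is read off at the pivot coordinate: t = (x k - p k)/v k.
      ... | c , vₖc≈1 = (x k - forget p k) * c , on
        where
        proportional : ∀ i → let j = punchIn k i in R.fromℤ (v k) * (x j - forget p j) - R.fromℤ (v j) *
              (x k - forget p k) ≈ 0#
        proportional i = R.≤-antisym
          (R.≤-by (R.≤-respʳ (trans (eval-minor (ℤ.- 1ℤ) _ x) (R.*-congʳ (R.-‿cong R.fromℤ-1)))
                (All.lookup (AllP.map⁻ neg) (∈-allFin i)))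
            (solve 1 (λ d → :0 :- d := :- :1 :* d) refl _))
          (R.≤-by (R.≤-respʳ (trans (eval-minor 1ℤ _ x) (R.*-congʳ R.fromℤ-1))
                (All.lookup (AllP.map⁻ pos) (∈-allFin i)))
            (solve 1 (λ d → d :- :0 := :1 :* d) refl _))
        difference : ∀ j → R.fromℤ (v k) * (x j - forget p j) - R.fromℤ (v j) * (x k - forget p k) ≈ 0#
        difference j with k FinP.≟ j
        ... | yes ≡.refl = solve 2 (λ a d → a :* d :- a :* d := :0) refl (R.fromℤ (v k)) (x k - forget p k)
        ... | no k≢j = ≡.subst (λ j → R.fromℤ (v k) * (x j - forget p j) - R.fromℤ (v j) * (x k - forget p k) ≈ 0#)
              (FinP.punchIn-punchOut k≢j) (proportional (punchOut k≢j))
        on : ∀ j → x j ≈ forget p j + (x k - forget p k) * c * R.fromℤ (v j)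
        on j = begin
          x j                                             ≈⟨ solve 2 (λ x p → x := p :+ :1 :* (x :- p))
                refl (x j) (forget p j) ⟩
          forget p j + 1# * (x j - forget p j)            ≈⟨ R.+-congˡ (R.*-congʳ vₖc≈1) ⟨
          forget p j + R.fromℤ (v k) * c * (x j - forget p j)
            ≈⟨ solve 6 (λ p d e a b c → p :+ a :* c :* d := p :+ c :* (a :* d :- b :* e) :+ e :* c :* b) refl
                 (forget p j) (x j - forget p j) (x k - forget p k) (R.fromℤ (v k)) (R.fromℤ (v j)) c ⟩
          forget p j + c * (R.fromℤ (v k) * (x j - forget p j) - R.fromℤ (v j) * (x k - forget p k)) +
                (x k - forget p k) * c * R.fromℤ (v j)
            ≈⟨ R.+-congʳ (trans (R.+-congˡ (trans (R.*-congˡ (difference j)) (R.zeroʳ c))) (R.+-identityʳ _)) ⟩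
          forget p j + (x k - forget p k) * c * R.fromℤ (v j) ∎
          where open import Relation.Binary.Reasoning.Setoid R.setoid

    isRationalLine : IsRationalLine Line
    isRationalLine =
      (forget p , R.ι v , (λ zeros → fromℤ-vₖ≉0 (zeros k)) , id , id) ,
      minors 1ℤ ++ minors (ℤ.- 1ℤ) ,
      AllP.++⁺ (AllP.map⁺ (All.universal (minor-nonconstant 1ℤ λ ()) (allFin n)))
               (AllP.map⁺ (All.universal (minor-nonconstant (ℤ.- 1ℤ) λ ()) (allFin n))) ,
      (λ x∈ → AllP.++⁺ (on-line⇒minors 1ℤ x∈) (on-line⇒minors (ℤ.- 1ℤ) x∈)) ,
      λ x∈ → uncurry minors⇒on-line (AllP.++⁻ (minors 1ℤ) x∈)

  module Main {n : ℕ} (S : Pred (Point (suc n)) 0ℓ) (ls : List (IntegralFunctional (suc n)))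
    (S≐ : S ≐ (λ x → All (λ l → x ∈ᴾ Halfspace l) ls)) (f : RealFunction (S ∩ Fⁿ))
    (lines : (L : Pred (Point (suc n)) 0ℓ) → IsRationalLine L → IsIntegralPolyhedral
          (restrict {T = (S ∩ Fⁿ) ∩ L} proj₁ f)) where

    μs : List (K.Aff (suc n))
    μs = map fromIntegral ls

    opaque
      inS⇒S : ∀ {y} → K.InS μs y → S (forget y)
      inS⇒S {y} y∈ = proj₂ S≐ (All.map (λ {l} → R.≤-respʳ (eval-toIntegral (fromIntegral l) y)) (AllP.map⁻ y∈))

    opaque
      S⇒inS : ∀ {y} → S (forget y) → K.InS μs y
      S⇒inS {y} y∈ = AllP.map⁺ (All.map (λ {l} → R.≤-respʳ (R.sym (eval-toIntegral (fromIntegral l) y))) (proj₁ S≐ y∈))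

    point : ∀ y → K.InS μs y → Σ (Point (suc n)) (S ∩ Fⁿ)
    point y y∈ = forget y , inS⇒S y∈ , λ i → proj₂ (y i)

    opaque
      maximum-closed : ∀ (ls : List⁺ (IntegralFunctional (suc n))) y → F.member
            (maximum (List⁺.map (λ l → eval l (forget y)) ls))
      maximum-closed (l ∷ ls) y = Extrema.argmax-all D.totalOrder id {P = F.member} (closed l)
            (AllP.map⁺ (All.universal closed ls))
        where
        closed : ∀ l → F.member (eval l (forget y))
        closed l = F.resp-≈ (eval-toIntegral (fromIntegral l) y) (proj₂ (K.eval (fromIntegral l) y))

    opaque
      -- On the line through `y` along the first unit vector, `f` is a maximum of F-integral
      -- functionals, and these take values in F on Fⁿ.
      value∈F : ∀ y (y∈ : K.InS μs y) → F.member (Func.to f (point y y∈))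
      value∈F y y∈ with lines Line isRationalLine
        where open RationalLine y (unit zero) zero (λ ())
      ... | ms , f≈ = F.resp-≈ (R.sym
            (f≈ (forget y) ((inS⇒S y∈ , λ i → proj₂ (y i)) , R.0# , R.move-zero (forget y) (R.ι (unit zero)))))
            (maximum-closed ms y)

    -- Outside S the value is the junk value 0.
    extend : ∀ y → Dec (K.InS μs y) → K.Carrier
    extend y (yes y∈) = Func.to f (point y y∈) , value∈F y y∈
    extend y (no _)   = K.0#

    f̂ : K.Point (suc n) → K.Carrier
    f̂ y = extend y em

    opaque
      f̂-extends : ∀ y → K.InS μs y → (x : Σ (Point (suc n)) (S ∩ Fⁿ)) → (∀ i → forget y i R.≈ proj₁ x i) →
            proj₁ (f̂ y) R.≈ Func.to f x
      f̂-extends y y∈ x y≋x with em {K.InS μs y}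
      ... | yes _  = Func.cong f y≋x
      ... | no y∉ = ⊥-elim (y∉ y∈)

    opaque
      f̂-cong : K.Respects f̂
      f̂-cong {x} {y} x≋y = agree em em
        where
        agree : ∀ dx dy → extend x dx K.≈ extend y dy
        agree (yes x∈) (yes y∈) = Func.cong f {point x x∈} {point y y∈} x≋y
        agree (yes x∈) (no y∉)  = ⊥-elim (y∉ (K.inS-cong x≋y x∈))
        agree (no x∉)  (yes y∈) = ⊥-elim (x∉ (K.inS-cong (λ i → K.sym {x i} {y i} (x≋y i)) y∈))
        agree (no _)   (no _)   = K.refl {K.0#}

    opaque
      polyOn-line : ∀ p (v : Vector ℤ (suc n)) k → ¬ v k ≡ 0ℤ → K.PolyOn f̂
            (λ x → K.InS μs x × ∃ λ t → x K.≋ p K.+[ t ] K.ι v)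
      polyOn-line p v k vₖ≢0 with lines Line isRationalLine
        where open RationalLine p v k vₖ≢0
      ... | m ∷ ms , f≈ = map fromIntegral (m ∷ ms) , maximal
        where
        maximal : ∀ y → (K.InS μs y × ∃ λ t → y K.≋ p K.+[ t ] K.ι v) →
          All (λ l → K.eval l y K.≤ f̂ y) (map fromIntegral (m ∷ ms)) × Any (λ l → f̂ y K.≈ K.eval l y)
                (map fromIntegral (m ∷ ms))
        maximal y (y∈ , t , y≋) =
          (below {m} (Extrema.⊥≤max D.totalOrder (value m) values) ∷
           AllP.map⁺ (All.map (λ {l} → below {l}) (AllP.map⁻ (Extrema.xs≤max D.totalOrder (value m) values)))) ,
          [ (λ q → here (equal {m} q)) , (λ q → let l , l∈ , r = ∈-map⁻ value q in there
                (AnyP.map⁺ (lose l∈ (equal {l} r)))) ]′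
            (Extrema.argmax-sel D.totalOrder id (value m) values)
          where
          value : IntegralFunctional (suc n) → R.Carrier
          value l = eval l (forget y)
          values : List R.Carrier
          values = map value ms
          top : R.Carrier
          top = maximum (value m ∷ values)
          f̂≈ : proj₁ (f̂ y) R.≈ top
          f̂≈ = R.trans (f̂-extends y y∈ (point y y∈) (λ _ → R.refl))
            (f≈ (forget y) ((inS⇒S y∈ , λ i → proj₂ (y i)) , proj₁ t , λ i → R.trans (y≋ i)
                  (R.+-congˡ (R.*-congˡ (R.reflexive (proj₁-fromℤ (v i)))))))
          below : ∀ {l} → value l R.≤ top → K.eval (fromIntegral l) y K.≤ f̂ y
          below {l} q = R.≤-respˡ (R.sym (eval-toIntegral (fromIntegral l) y)) (R.≤-respʳ (R.sym f̂≈) q)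
          equal : ∀ {l} → top ≡ value l → f̂ y K.≈ K.eval (fromIntegral l) y
          equal {l} q = R.trans f̂≈ (R.trans (R.reflexive q) (R.sym (eval-toIntegral (fromIntegral l) y)))

    opaque
      f̂-linewise : K.LineHyp f̂ μs
      f̂-linewise p p∈ v with FinP.all? (λ i → v i ℤP.≟ 0ℤ)
      ... | no nonzero = let k , vₖ≢0 = FinP.¬∀⟶∃¬ _ _ (λ i → v i ℤP.≟ 0ℤ) nonzero in polyOn-line p v k vₖ≢0
      -- For v = 0 the line is the point `p`, which lies on the line along the first unit vector.
      ... | yes zeros  = K.PolyOn-⊆ {f = f̂} (λ x (x∈ , t , x≋) → x∈ , K.0# , λ i →
          R.trans (x≋ i) (R.trans (R.+-congˡ (R.*-congˡ (R.reflexive (≡.cong (proj₁ ∘ K.fromℤ) (zeros i)))))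
            (R.solve 3 (λ p t u → p R.:+ t R.:* R.:0 R.:= p R.:+ R.:0 R.:* u) R.refl (forget p i) (proj₁ t)
                  (proj₁ (K.ι (unit zero) i)))))
          (polyOn-line p (unit zero) zero (λ ()))

    isIntegralPolyhedral : IsIntegralPolyhedral f
    isIntegralPolyhedral with K.polyhedral (length μs) μs ≡.refl f̂ f̂-cong f̂-linewise
    -- An empty list means that `S ∩ Fⁿ` is empty; the zero functional is a default that makes the
    -- list nonempty.
    ... | [] , h = record { coeff = λ _ → 0ℤ ; const = R.0# ; const∈F = F.0-closed } ∷ [] ,
          λ x (x∈S , x∈F) → none (proj₂ (h (λ i → x i , x∈F i) (S⇒inS x∈S)))
      where
      none : ∀ {P : Pred (K.Aff (suc n)) 0ℓ} {A : Set} → Any P [] → A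
      none ()
    ... | m ∷ ms , h = toIntegral m ∷ map toIntegral ms , λ x (x∈S , x∈F) → value x x∈S x∈F
      where
      value : ∀ x x∈S x∈F → Func.to f (x , x∈S , x∈F) R.≈ maximum
            (List⁺.map (λ l → eval l x) (toIntegral m ∷ map toIntegral ms))
      value x x∈S x∈F = R.≤-antisym
          (Extrema.v≤max⁺ D.totalOrder _ _ (attained any))
          (Extrema.max≤v⁺ D.totalOrder (below m (All.head all))
                (AllP.map⁺ (AllP.map⁺ (All.map (λ {l} → below l) (All.tail all)))))
        where
        y : K.Point (suc n)
        y i = x i , x∈F i
        all : All (λ l → K.eval l y K.≤ f̂ y) (m ∷ ms)
        all = proj₁ (h y (S⇒inS x∈S))
        any : Any (λ l → f̂ y K.≈ K.eval l y) (m ∷ ms)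
        any = proj₂ (h y (S⇒inS x∈S))
        f̂y≈ : proj₁ (f̂ y) R.≈ Func.to f (x , x∈S , x∈F)
        f̂y≈ = f̂-extends y (S⇒inS x∈S) _ (λ _ → R.refl)
        below : ∀ l → K.eval l y K.≤ f̂ y → eval (toIntegral l) x R.≤ Func.to f (x , x∈S , x∈F)
        below l p = R.≤-respˡ (eval-toIntegral l y) (R.≤-respʳ f̂y≈ p)
        equal : ∀ l → f̂ y K.≈ K.eval l y → Func.to f (x , x∈S , x∈F) R.≤ eval (toIntegral l) x
        equal l p = R.≤-reflexive (R.trans (R.sym f̂y≈) (R.trans p (eval-toIntegral l y)))
        attained : Any (λ l → f̂ y K.≈ K.eval l y) (m ∷ ms) →
          Func.to f (x , x∈S , x∈F) R.≤ eval (toIntegral m) x ⊎ Any (Func.to f (x , x∈S , x∈F) R.≤_)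
                (map (λ l → eval l x) (map toIntegral ms))
        attained (here p)  = inj₁ (equal m p)
        attained (there p) = inj₂ (AnyP.map⁺ (AnyP.map⁺ (Any.map (λ {l} → equal l) p)))

open import Data.Nat.Base using (_≤_)

theorem7p4 : ExcludedMiddle 0ℓ →
    (R : RealField) (F : Subfield R) →
    let open Polyhedral R F in
    (n : ℕ) → 1 ≤ n →
    (S : Pred (Point n) 0ℓ) → IsRationalPolyhedral S →
    (f : RealFunction (S ∩ Fⁿ)) →
    ((L : Pred (Point n) 0ℓ) → IsRationalLine L →
    IsIntegralPolyhedral (restrict {T = (S ∩ Fⁿ) ∩ L} proj₁ f)) →
    IsIntegralPolyhedral f
theorem7p4 em R F (suc n) _ S (ls , _ , S≐) f lines = Transfer.Main.isIntegralPolyhedral em R F S ls S≐ f lines
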